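{- There exists an integer $d_0>0$ such that for every fixed integer $d\geq d_0$, if $G$ is the uniformly random $d$-regular graph on the vertex set $[n]$ (with $dn$ even), then with probability tending to $1$ as $n\to\infty$: (1) for every integer $k$ with $\frac{d}{2}+\sqrt{d}\leq k\leq d$, $r_\ell(G,\mathcal{K}^V_k)=d-k+1$; (2) for every integer $k$ with $1\leq k<\frac{d}{2}+\sqrt{d}$, $\frac{d}{2}-\sqrt{d}< r_\ell(G,\mathcal{K}^V_k)\leq\min\{d-k+1,\frac{d}{2}+4\sqrt{d\ln d}\}$.
   Context: For a monotone increasing graph property $\mathcal{P}$ and a graph $G$, the local resilience is $r_\ell(G,\mathcal{P})=\min\{r: \exists H\subseteq G \text{ with } \Delta(H)=r \text{ and } G- H\notin\mathcal{P}\}$, where $H\subseteq G$ is a subgraph on the same vertex set, $\Delta(H)$ its maximum degree, and $G-H$ the graph obtained by deleting the edges of $H$. $\mathcal{K}^V_k$ denotes the property of being $k$-vertex connected (removing any $k-1$ vertices leaves the graph connected). -}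

module Defs where

open import Data.Nat using (ℕ; zero; suc; _+_; _*_; _∸_; _^_; _≤_; _<_; _⊔_)
open import Data.Nat.Properties using (_!≢0)
open import Data.Nat.Divisibility using (_∣_)
open import Data.Nat.Base using (_!)
open import Data.Bool using (Bool; true; false; _∧_; not; if_then_else_)
open import Data.Bool.Properties using () renaming (_≟_ to _≟B_)
open import Data.Fin using (Fin)
open import Data.Fin.Subset using (Subset; _∉_; ∣_∣)
open import Data.Vec using (Vec; []; _∷_; lookup; zipWith; toList; map)
open import Data.List using (List; []; _∷_; concatMap; length; allFin; foldr)
open import Data.Bool.ListAction using (and)
import Data.List as L
open import Data.List.Relation.Unary.All using (All)
open import Data.List.Relation.Unary.Unique.Propositional using (Unique)
open import Data.Integer using (+_)
open import Data.Rational using (ℚ; 0ℚ; _/_) renaming (_+_ to _+ℚ_; _≤_ to _≤ℚ_)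
open import Data.Product using (Σ; _×_)
open import Data.Sum using (_⊎_)
open import Relation.Nullary using (¬_; Dec; yes; no)
open import Relation.Binary.PropositionalEquality using (_≡_)

Adj : ℕ → Set
Adj n = Vec (Vec Bool n) n

edge : ∀ {n} → Adj n → Fin n → Fin n → Bool
edge A i j = lookup (lookup A i) j

trues : ∀ {m} → Vec Bool m → ℕ
trues [] = 0
trues (true ∷ xs) = suc (trues xs)
trues (false ∷ xs) = trues xs

deg : ∀ {n} → Adj n → Fin n → ℕ
deg A i = trues (lookup A i)

maxDeg : ∀ {n} → Adj n → ℕ
maxDeg A = foldr _⊔_ 0 (toList (map trues A))

IsGraph : ∀ {n} → Adj n → Set
IsGraph A = (∀ i j → edge A i j ≡ edge A j i) × (∀ i → edge A i i ≡ false)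

eqB : Bool → Bool → Bool
eqB a b with a ≟B b
... | yes _ = true
... | no _ = false

eqℕ : ℕ → ℕ → Bool
eqℕ zero zero = true
eqℕ (suc a) (suc b) = eqℕ a b
eqℕ _ _ = false

allF : (n : ℕ) → (Fin n → Bool) → Bool
allF n f = and (L.map f (allFin n))

regularB : ℕ → ∀ {n} → Adj n → Bool
regularB d {n} A =
  allF n (λ i → allF n (λ j → eqB (edge A i j) (edge A j i)))
  ∧ allF n (λ i → not (edge A i i))
  ∧ allF n (λ i → eqℕ (deg A i) d)

IsRegular : ℕ → ∀ {n} → Adj n → Set
IsRegular d A = regularB d A ≡ true

vecsOver : ∀ {a} {A : Set a} → List A → (m : ℕ) → List (Vec A m)
vecsOver xs zero = [] ∷ []
vecsOver xs (suc m) = concatMap (λ x → L.map (x ∷_) (vecsOver xs m)) xs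

allAdj : (n : ℕ) → List (Adj n)
allAdj n = vecsOver (vecsOver (true ∷ false ∷ []) n) n

countB : ∀ {a} {A : Set a} → (A → Bool) → List A → ℕ
countB f [] = 0
countB f (x ∷ xs) = if f x then suc (countB f xs) else countB f xs

numRegular : ℕ → ℕ → ℕ
numRegular d n = countB (regularB d) (allAdj n)

_⊆G_ : ∀ {n} → Adj n → Adj n → Set
H ⊆G G = IsGraph H × (∀ i j → edge H i j ≡ true → edge G i j ≡ true)

_−G_ : ∀ {n} → Adj n → Adj n → Adj n
G −G H = zipWith (zipWith (λ a b → a ∧ not b)) G H

data Reach {n} (G : Adj n) (S : Subset n) (u : Fin n) : Fin n → Set where
  here : Reach G S u u
  step : ∀ {w v} → Reach G S u w → edge G w v ≡ true → v ∉ S → Reach G S u v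

ConnectedAvoiding : ∀ {n} → Adj n → Subset n → Set
ConnectedAvoiding G S = ∀ u v → u ∉ S → v ∉ S → Reach G S u v

KConn : ℕ → ∀ {n} → Adj n → Set
KConn k {n} G = (S : Subset n) → ∣ S ∣ < k → ConnectedAvoiding G S

LocalResilience : ℕ → ∀ {n} → Adj n → ℕ → Set
LocalResilience k {n} G r =
  Σ (Adj n) (λ H → H ⊆G G × maxDeg H ≡ r × ¬ KConn k (G −G H))
  × (∀ H → H ⊆G G → ¬ KConn k (G −G H) → r ≤ maxDeg H)

-- d/2 + √d ≤ k   ⇔   d ≤ 2k  and  4d ≤ (2k - d)²
HighK : ℕ → ℕ → Set
HighK d k = d ≤ 2 * k × 4 * d ≤ (2 * k ∸ d) ^ 2

-- d/2 - √d < r   ⇔   d ≤ 2r  or  (d - 2r)² < 4d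
AboveLower : ℕ → ℕ → Set
AboveLower d r = d ≤ 2 * r ⊎ (d ∸ 2 * r) ^ 2 < 4 * d

expPartial : ℕ → ℕ → ℚ
expPartial a zero = 0ℚ
expPartial a (suc N) = expPartial a N +ℚ ((+ (a ^ N)) / (N !)) {{N !≢0}}

-- e^a ≤ M  (the partial sums increase to e^a)
ExpLE : ℕ → ℕ → Set
ExpLE a M = ∀ N → expPartial a N ≤ℚ ((+ M) / 1)

-- r ≤ d/2 + 4√(d ln d)
--   ⇔ 2r ≤ d  or  (2r - d)² ≤ 64 d ln d
--   ⇔ 2r ≤ d  or  e^((2r-d)²) ≤ d^(64 d)
BelowUpper : ℕ → ℕ → Set
BelowUpper d r = 2 * r ≤ d ⊎ ExpLE ((2 * r ∸ d) ^ 2) (d ^ (64 * d))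

Event : ℕ → ∀ {n} → Adj n → Set
Event d G =
  (∀ k → HighK d k → k ≤ d → LocalResilience k G (d ∸ k + 1))
  × (∀ k → 1 ≤ k → ¬ HighK d k →
       Σ ℕ (λ r → LocalResilience k G r × AboveLower d r
                   × r ≤ d ∸ k + 1 × BelowUpper d r))

-- "with probability tending to 1 as n → ∞" over the uniform d-regular graph
-- on [n] (dn even): for every m ≥ 1 there is N such that for all n ≥ N with
-- dn even, the number of d-regular graphs on [n] violating P is at most a
-- 1/m fraction of all d-regular graphs on [n]. The count of violators is
-- expressed as: every duplicate-free list of violators has length ≤ total/m.
WHP : ℕ → (∀ {n} → Adj n → Set) → Set
WHP d P = ∀ m → 1 ≤ m → Σ ℕ λ N → ∀ n → N ≤ n → 2 ∣ d * n →
  (B : List (Adj n)) → Unique B → All (λ G → IsRegular d G × ¬ P G) B →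
  m * length B ≤ numRegular d n

{-# OPTIONS --safe #-}

-- No spectral gap is needed: everything probabilistic follows from one switching. For u, v ∈ A and x, y ∉ A
-- replace the edges uv, xy by ux, vy. Double counting shows that Y t, the number of d-regular graphs with at most
-- t edges leaving A, satisfies Y t · (d|A| − t)(d|Aᶜ| − t − 2d²) ≤ (t + 2)² · Y (t + 2). Iterating this,
-- * a set W of bounded size spans more than |W| edges with probability O(n^(−|W|−1)), while there are at most
--   n^|W| such sets;
-- * for |A| = a ≤ b = n − a, with a larger than a constant, at most (d/2 − √d)a + d² edges leave A with
--   probability at most (a/b)^a (2/9)^a (the true rate is near e^(−2a), and 9/2 < 5 = 1 + 2 + 2 < e²), while
--   there are C(n,a) ≤ (4b/a)^a such sets.
-- In a graph avoiding both events, let S with |S| < k separate A from the rest after deleting H with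
-- Δ(H) ≤ d − k. For large A too few edges leave A; for small A the sets A and A ∪ S span so few edges that
-- |A| ≤ 1, contradicting the minimum degree k. The upper bounds are deterministic: isolate a vertex, or delete
-- the edges across a partition as in Stiebitz's theorem, where every vertex has ⌊(d−1)/2⌋ neighbours on its side
-- (this replaces a random partition and the local lemma).
module Submission where

open import Defs
open import Data.Bool using (Bool; true; false; _∧_; _∨_; not; _xor_; if_then_else_; T)
open import Data.Bool.ListAction using (and)
import Data.Bool.Properties as Bool
open import Data.Empty using (⊥; ⊥-elim)
open import Data.Fin using (Fin; zero; suc; fromℕ<; toℕ)
import Data.Fin.Properties as Fin
open import Data.Fin.Subset using (Subset; _∉_; ∣_∣) renaming (⊥ to ∅)
open import Data.Fin.Subset.Properties using (∉⊥; ∣⊥∣≡0)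
open import Data.Integer using (+≤+) renaming (+_ to pos)
import Data.Integer as ℤ
import Data.Integer.Properties as ℤ
open import Data.List using (List; []; _∷_; _++_; concatMap; foldr; map; length; allFin)
open import Data.List.Membership.Propositional using (_∈_; lose)
open import Data.List.Membership.Propositional.Properties using (∈-concatMap⁺; ∈-map⁺; ∈-allFin)
open import Data.List.Relation.Unary.All using (All; []; _∷_)
import Data.List.Relation.Unary.All as All
open import Data.List.Relation.Unary.AllPairs using ([]; _∷_)
open import Data.List.Relation.Unary.Any using (here; there)
open import Data.List.Relation.Unary.Unique.Propositional using (Unique)
open import Data.Nat using (ℕ; zero; suc; _+_; _*_; _∸_; _^_; _≤_; _<_; _⊔_; z≤n; s≤s; _≤ᵇ_; _≡ᵇ_; _!; _/_; _%_; NonZero; >-nonZero)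
open import Data.Nat.Combinatorics using (_C_; nCk≡n!/k![n-k]!; nCk+nC[k+1]≡[n+1]C[k+1]; k![n∸k]!∣n!)
open import Data.Nat.DivMod using (m/n*n≡m; m≡m%n+[m/n]*n; m%n<n)
open import Data.Nat.ListAction using () renaming (sum to sumᴸ)
open import Data.Nat.Properties
open import Data.Nat.Tactic.RingSolver using (solve-∀)
open import Data.Product using (Σ; _×_; _,_; proj₁; proj₂; ∃)
open import Data.Rational using (ℚ; 0ℚ; toℚᵘ) renaming (_+_ to _+ℚ_; _≤_ to _≤ℚ_; _/_ to _/ℚ_)
import Data.Rational.Properties as ℚ
open import Data.Rational.Unnormalised using (mkℚᵘ; *≤*)
import Data.Rational.Unnormalised as ℚᵘ
import Data.Rational.Unnormalised.Properties as ℚᵘ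
open import Data.Sum using (_⊎_; inj₁; inj₂)
open import Data.Vec using (Vec; []; _∷_; lookup; zipWith; tabulate; toList) renaming (map to mapⱽ)
open import Data.Vec.Properties using (lookup-zipWith; lookup∘tabulate; ≡-dec; []=⇒lookup; lookup⇒[]=)
open import Function using (_∘_)
open import Relation.Binary.Definitions using (DecidableEquality)
open import Relation.Binary.PropositionalEquality using (_≡_; _≢_; refl; sym; trans; cong; cong₂; subst; subst₂; ≢-sym)
open import Relation.Nullary using (¬_; Dec; yes; no; does; contradiction)
open import Relation.Nullary.Decidable using (dec-true; dec-false; _×-dec_)
open import Algebra.Properties.Semiring.Sum +-*-semiring using (sum; sum-cong-≗; ∑-distrib-+; ∑-comm; *-distribˡ-sum; *-distribʳ-sum)
open ≤-Reasoning

-- Every count is a sum of indicators over all Boolean matrices. A switching is the xor with fixed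
-- masks, so it permutes all matrices, whether or not the outcome is a graph; double counting
-- therefore takes one implication per quadruple u, v, x, y and no inverse map among regular graphs.
--
-- The obstacle is the union bound over large sets. The ratio of consecutive counts Y t improves as
-- t falls below d|A|/2, and about √d/2 blocks of |A| switchings fit between (d/2 - √d)|A| and
-- d|A|/2. Block l gains about (1 + 16l/d)^|A|, and all blocks together about exp(2|A|). Against the
-- binomial estimate with base 4 the proved rate leaves (8/9)^|A|, which absorbs the weights (a +
-- 1)(a + 2) of the sum over sizes a and the required factor m once |A| passes a constant. This
-- fixes the boundary between small and large sets, which therefore depends on m.

private variable
  X Y : Set

-- Truth values as numbers

𝟙 : Bool → ℕ
𝟙 true  = 1
𝟙 false = 0

𝟙≤1 : ∀ b → 𝟙 b ≤ 1
𝟙≤1 true  = ≤-refl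
𝟙≤1 false = z≤n

𝟙-∧ : ∀ a b → 𝟙 (a ∧ b) ≡ 𝟙 a * 𝟙 b
𝟙-∧ true  b = sym (+-identityʳ _)
𝟙-∧ false b = refl

𝟙-not : ∀ b → 𝟙 b + 𝟙 (not b) ≡ 1
𝟙-not true  = refl
𝟙-not false = refl

𝟙-mono : ∀ a b → (a ≡ true → b ≡ true) → 𝟙 a ≤ 𝟙 b
𝟙-mono true  b h rewrite h refl = ≤-refl
𝟙-mono false b h = z≤n

∧-split : ∀ {a b} → a ∧ b ≡ true → a ≡ true × b ≡ true
∧-split {true} {true} refl = refl , refl

∧-join : ∀ {a b} → a ≡ true → b ≡ true → a ∧ b ≡ true
∧-join refl refl = refl

not-true : ∀ {a} → not a ≡ true → a ≡ false
not-true {false} refl = refl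

false⇒not : ∀ {a} → a ≡ false → not a ≡ true
false⇒not refl = refl

≤ᵇ-true : ∀ {m n} → m ≤ n → (m ≤ᵇ n) ≡ true
≤ᵇ-true {m} {n} p with m ≤ᵇ n | ≤⇒≤ᵇ p
... | true | _ = refl

true-≤ᵇ : ∀ m n → (m ≤ᵇ n) ≡ true → m ≤ n
true-≤ᵇ m n e = ≤ᵇ⇒≤ m n (subst T (sym e) _)

infix 5 _==_
_==_ : ∀ {n} → Fin n → Fin n → Bool
i == j = does (i Fin.≟ j)

==-refl : ∀ {n} (i : Fin n) → (i == i) ≡ true
==-refl i = dec-true (i Fin.≟ i) refl

≢⇒== : ∀ {n} {i j : Fin n} → i ≢ j → (i == j) ≡ false
≢⇒== {i = i} {j} h = dec-false (i Fin.≟ j) h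

==⇒≡ : ∀ {n} (i j : Fin n) → (i == j) ≡ true → i ≡ j
==⇒≡ i j e with i Fin.≟ j
... | yes p = p

-- Sums

abstract
  ∑ : ∀ {n} → (Fin n → ℕ) → ℕ
  ∑ = sum

  ∑-cong : ∀ {n} {f g : Fin n → ℕ} → (∀ i → f i ≡ g i) → ∑ f ≡ ∑ g
  ∑-cong = sum-cong-≗

  ∑-+ : ∀ {n} (f g : Fin n → ℕ) → ∑ (λ i → f i + g i) ≡ ∑ f + ∑ g
  ∑-+ = ∑-distrib-+

  ∑-swap : ∀ {m n} (f : Fin m → Fin n → ℕ) → ∑ (λ i → ∑ (f i)) ≡ ∑ (λ j → ∑ (λ i → f i j))
  ∑-swap = ∑-comm

  ∑-scaleˡ : ∀ {n} c (f : Fin n → ℕ) → ∑ (λ i → c * f i) ≡ c * ∑ f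
  ∑-scaleˡ c f = sym (*-distribˡ-sum c f)

  ∑-scaleʳ : ∀ {n} c (f : Fin n → ℕ) → ∑ (λ i → f i * c) ≡ ∑ f * c
  ∑-scaleʳ c f = sym (*-distribʳ-sum c f)

  ∑-zero : (f : Fin 0 → ℕ) → ∑ f ≡ 0
  ∑-zero f = refl

  ∑-suc : ∀ {n} (f : Fin (suc n) → ℕ) → ∑ f ≡ f zero + ∑ (λ i → f (suc i))
  ∑-suc f = refl

  ∑-mono : ∀ {n} {f g : Fin n → ℕ} → (∀ i → f i ≤ g i) → ∑ f ≤ ∑ g
  ∑-mono {zero}  h = z≤n
  ∑-mono {suc n} h = +-mono-≤ (h zero) (∑-mono (h ∘ suc))

  ∑-const : ∀ n c → ∑ {n} (λ _ → c) ≡ n * c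
  ∑-const zero    c = refl
  ∑-const (suc n) c = cong (c +_) (∑-const n c)

  ∑-pick : ∀ {n} (v : Fin n) (f : Fin n → ℕ) → ∑ (λ j → 𝟙 (j == v) * f j) ≡ f v
  ∑-pick {suc n} zero f = begin-equality
    f zero + 0 + ∑ {n} (λ _ → 0) ≡⟨ cong (f zero + 0 +_) (trans (∑-const n 0) (*-zeroʳ n)) ⟩
    f zero + 0 + 0               ≡⟨ trans (+-identityʳ _) (+-identityʳ _) ⟩
    f zero                       ∎
  ∑-pick (suc v) f = ∑-pick v (f ∘ suc)

  ∑-term : ∀ {n} (f : Fin n → ℕ) v → f v ≤ ∑ f
  ∑-term f zero    = m≤m+n _ _
  ∑-term f (suc v) = ≤-trans (∑-term (f ∘ suc) v) (m≤n+m _ _)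

  ∑-positive : ∀ {n} (f : Fin n → ℕ) → 1 ≤ ∑ f → ∃ λ i → 1 ≤ f i
  ∑-positive {suc n} f h with f zero in eq
  ... | suc k = zero , subst (1 ≤_) (sym eq) (s≤s z≤n)
  ... | zero  with ∑-positive (f ∘ suc) h
  ...   | i , p = suc i , p

  S : ∀ {a} {A : Set a} → List A → (A → ℕ) → ℕ
  S xs f = sumᴸ (map f xs)

  S-[] : ∀ {a} {A : Set a} (f : A → ℕ) → S [] f ≡ 0
  S-[] f = refl

  S-∷ : ∀ {a} {A : Set a} (x : A) xs (f : A → ℕ) → S (x ∷ xs) f ≡ f x + S xs f
  S-∷ x xs f = refl

∑∑ : ∀ {n} → (Fin n → Fin n → ℕ) → ℕ
∑∑ f = ∑ (λ i → ∑ (f i))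

∑∑-cong : ∀ {n} {f g : Fin n → Fin n → ℕ} → (∀ i j → f i j ≡ g i j) → ∑∑ f ≡ ∑∑ g
∑∑-cong h = ∑-cong λ i → ∑-cong (h i)

∑∑-mono : ∀ {n} {f g : Fin n → Fin n → ℕ} → (∀ i j → f i j ≤ g i j) → ∑∑ f ≤ ∑∑ g
∑∑-mono h = ∑-mono λ i → ∑-mono (h i)

∑∑-+ : ∀ {n} (f g : Fin n → Fin n → ℕ) → ∑∑ (λ i j → f i j + g i j) ≡ ∑∑ f + ∑∑ g
∑∑-+ f g = trans (∑-cong λ i → ∑-+ (f i) (g i)) (∑-+ (∑ ∘ f) (∑ ∘ g))

∑∑-scaleˡ : ∀ {n} c (f : Fin n → Fin n → ℕ) → ∑∑ (λ i j → c * f i j) ≡ c * ∑∑ f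
∑∑-scaleˡ c f = trans (∑-cong λ i → ∑-scaleˡ c (f i)) (∑-scaleˡ c (∑ ∘ f))

∑∑-pick : ∀ {n} (a b : Fin n) (f : Fin n → Fin n → ℕ) → ∑∑ (λ i j → 𝟙 (i == a) * (𝟙 (j == b) * f i j)) ≡ f a b
∑∑-pick a b f = begin-equality
  ∑∑ (λ i j → 𝟙 (i == a) * (𝟙 (j == b) * f i j)) ≡⟨ ∑-cong (λ i → trans (∑-scaleˡ (𝟙 (i == a)) _) (cong (𝟙 (i == a) *_) (∑-pick b (f i)))) ⟩
  ∑ (λ i → 𝟙 (i == a) * f i b)                  ≡⟨ ∑-pick a (λ i → f i b) ⟩
  f a b ∎

abstract
  S-cong : ∀ (xs : List X) {f g : X → ℕ} → (∀ x → f x ≡ g x) → S xs f ≡ S xs g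
  S-cong []       h = refl
  S-cong (x ∷ xs) h = cong₂ _+_ (h x) (S-cong xs h)

  S-mono : ∀ (xs : List X) {f g : X → ℕ} → (∀ x → f x ≤ g x) → S xs f ≤ S xs g
  S-mono []       h = z≤n
  S-mono (x ∷ xs) h = +-mono-≤ (h x) (S-mono xs h)

  S-0 : ∀ (xs : List X) → S xs (λ _ → 0) ≡ 0
  S-0 []       = refl
  S-0 (x ∷ xs) = S-0 xs

  S-+ : ∀ (xs : List X) (f g : X → ℕ) → S xs (λ x → f x + g x) ≡ S xs f + S xs g
  S-+ []       f g = refl
  S-+ (x ∷ xs) f g rewrite S-+ xs f g = interchange (f x) (g x) (S xs f) (S xs g)
    where
    interchange : ∀ a b c d → a + b + (c + d) ≡ a + c + (b + d)
    interchange = solve-∀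

  S-scaleʳ : ∀ (xs : List X) c (f : X → ℕ) → S xs (λ x → f x * c) ≡ S xs f * c
  S-scaleʳ []       c f = refl
  S-scaleʳ (x ∷ xs) c f = trans (cong (f x * c +_) (S-scaleʳ xs c f)) (sym (*-distribʳ-+ c (f x) _))

  S-scaleˡ : ∀ (xs : List X) c (f : X → ℕ) → S xs (λ x → c * f x) ≡ c * S xs f
  S-scaleˡ xs c f = trans (S-cong xs λ x → *-comm c (f x)) (trans (S-scaleʳ xs c f) (*-comm _ c))

  S-++ : ∀ (xs ys : List X) (f : X → ℕ) → S (xs ++ ys) f ≡ S xs f + S ys f
  S-++ []       ys f = refl
  S-++ (x ∷ xs) ys f = trans (cong (f x +_) (S-++ xs ys f)) (sym (+-assoc (f x) _ _))

  S-map : ∀ (xs : List X) (h : X → Y) (f : Y → ℕ) → S (map h xs) f ≡ S xs (f ∘ h)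
  S-map []       h f = refl
  S-map (x ∷ xs) h f = cong (f (h x) +_) (S-map xs h f)

  S-concatMap : ∀ (xs : List X) (g : X → List Y) (f : Y → ℕ) → S (concatMap g xs) f ≡ S xs (λ x → S (g x) f)
  S-concatMap []       g f = refl
  S-concatMap (x ∷ xs) g f = trans (S-++ (g x) _ f) (cong (S (g x) f +_) (S-concatMap xs g f))

  S-swap : ∀ (xs : List X) (ys : List Y) (f : X → Y → ℕ) →
    S xs (λ x → S ys (f x)) ≡ S ys (λ y → S xs (λ x → f x y))
  S-swap []       ys f = sym (S-0 ys)
  S-swap (x ∷ xs) ys f = trans (cong (S ys (f x) +_) (S-swap xs ys f)) (sym (S-+ ys (f x) _))

  S-∑ : ∀ {n} (xs : List X) (f : X → Fin n → ℕ) → S xs (λ x → ∑ (f x)) ≡ ∑ (λ i → S xs (λ x → f x i))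
  S-∑ {n = zero}  xs f = S-0 xs
  S-∑ {n = suc n} xs f = trans (S-+ xs _ _) (cong (S xs (λ x → f x zero) +_) (S-∑ xs (λ x i → f x (suc i))))

  countB≡S : ∀ (f : X → Bool) xs → countB f xs ≡ S xs (𝟙 ∘ f)
  countB≡S f []       = refl
  countB≡S f (x ∷ xs) with f x
  ... | true  = cong suc (countB≡S f xs)
  ... | false = countB≡S f xs

  S-∈ : ∀ {xs : List X} {x} (f : X → ℕ) → x ∈ xs → f x ≤ S xs f
  S-∈ f (here refl) = m≤m+n _ _
  S-∈ f (there p)   = ≤-trans (S-∈ f p) (m≤n+m _ _)

  -- A value is struck out by zeroing its weight, not by shortening `xs`, so that `unique-length≤S`
  -- can recurse on the same list. An inequality, because `x` may occur in `xs` more than once.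
  S-erase : (_≟_ : DecidableEquality X) {xs : List X} {x : X} (f : X → ℕ) → x ∈ xs →
    f x + S xs (λ y → if does (x ≟ y) then 0 else f y) ≤ S xs f
  S-erase _≟_ {xs = z ∷ xs} {x} f (here refl) = +-monoʳ-≤ (f x) (begin
    (if does (x ≟ x) then 0 else f x) + _ ≡⟨ cong (λ b → (if b then 0 else f x) + S xs (λ y → if does (x ≟ y) then 0 else f y)) (dec-true (x ≟ x) refl) ⟩
    S xs (λ y → if does (x ≟ y) then 0 else f y) ≤⟨ S-mono xs (λ y → drop (does (x ≟ y)) (f y)) ⟩
    S xs f ∎)
    where
    drop : ∀ b k → (if b then 0 else k) ≤ k
    drop true  k = z≤n
    drop false k = ≤-refl
  S-erase _≟_ {xs = z ∷ xs} {x} f (there p) = begin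
    f x + (_ + s)      ≤⟨ +-monoʳ-≤ (f x) (+-monoˡ-≤ s (drop (does (x ≟ z)) (f z))) ⟩
    f x + (f z + s)    ≡⟨ comm₃ (f x) (f z) s ⟩
    f z + (f x + s)    ≤⟨ +-monoʳ-≤ (f z) (S-erase _≟_ f p) ⟩
    f z + S xs f       ∎
    where
    s : ℕ
    s = S xs (λ y → if does (x ≟ y) then 0 else f y)
    drop : ∀ b k → (if b then 0 else k) ≤ k
    drop true  k = z≤n
    drop false k = ≤-refl
    comm₃ : ∀ a b c → a + (b + c) ≡ b + (a + c)
    comm₃ = solve-∀

  -- Each entry of `ys` is charged to its own value in `xs`: once the head's weight is zeroed,
  -- uniqueness keeps the other weights positive. This turns a bound on a sum over all matrices into
  -- one on duplicate-free lists, the form in which `WHP` counts.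
  unique-length≤S : (_≟_ : DecidableEquality X) (xs ys : List X) (f : X → ℕ) →
    Unique ys → All (λ y → y ∈ xs × 1 ≤ f y) ys → length ys ≤ S xs f
  unique-length≤S _≟_ xs []       f _         _                  = z≤n
  unique-length≤S {X} _≟_ xs (y ∷ ys) f (y∉ ∷ u) ((y∈ , fy) ∷ h) = begin
    1 + length ys ≤⟨ +-mono-≤ fy (unique-length≤S _≟_ xs ys f′ u (All.zipWith keep (y∉ , h))) ⟩
    f y + S xs f′ ≤⟨ S-erase _≟_ f y∈ ⟩
    S xs f        ∎
    where
    f′ : X → ℕ
    f′ = λ z → if does (y ≟ z) then 0 else f z
    keep : ∀ {z : X} → y ≢ z × (z ∈ xs × 1 ≤ f z) → z ∈ xs × 1 ≤ f′ z
    keep {z} (y≢z , z∈ , fz) = z∈ , subst (λ b → 1 ≤ (if b then 0 else f z)) (sym (dec-false (y ≟ z) y≢z)) fz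

S-∑∑ : ∀ {n} (xs : List X) (f : X → Fin n → Fin n → ℕ) → S xs (λ x → ∑∑ (f x)) ≡ ∑∑ (λ i j → S xs (λ x → f x i j))
S-∑∑ xs f = trans (S-∑ xs _) (∑-cong λ i → S-∑ xs (λ x → f x i))

-- Enumerations of vectors

S-vecsOver : ∀ (xs : List X) m (f : Vec X (suc m) → ℕ) →
  S (vecsOver xs (suc m)) f ≡ S xs (λ x → S (vecsOver xs m) (λ v → f (x ∷ v)))
S-vecsOver xs m f = trans (S-concatMap xs _ f) (S-cong xs λ x → S-map (vecsOver xs m) (x ∷_) f)

∈-vecsOver : ∀ {xs : List X} → (∀ x → x ∈ xs) → ∀ {m} (v : Vec X m) → v ∈ vecsOver xs m
∈-vecsOver h []      = here refl
∈-vecsOver {xs = xs} h (x ∷ v) = ∈-concatMap⁺ (λ x → map (x ∷_) (vecsOver xs _)) (lose (h x) (∈-map⁺ (x ∷_) (∈-vecsOver h v)))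

-- The hypothesis says through sums that each `g y` permutes `xs`, and the conclusion has the same
-- shape for vectors. Two applications lift this from Booleans to rows and from rows to matrices
-- without naming a bijection.
S-zipWith : ∀ (xs : List X) (g : Y → X → X) → (∀ y f → S xs (f ∘ g y) ≡ S xs f) →
  ∀ {m} (ys : Vec Y m) f → S (vecsOver xs m) (f ∘ zipWith g ys) ≡ S (vecsOver xs m) f
S-zipWith xs g inv []       f = S-cong (vecsOver xs 0) λ { [] → refl }
S-zipWith xs g inv {suc m} (y ∷ ys) f = begin-equality
  S (vecsOver xs (suc m)) (f ∘ zipWith g (y ∷ ys))                          ≡⟨ S-vecsOver xs m _ ⟩
  S xs (λ x → S (vecsOver xs m) (λ v → f (g y x ∷ zipWith g ys v)))         ≡⟨ S-cong xs (λ x → S-zipWith xs g inv ys (λ v → f (g y x ∷ v))) ⟩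
  S xs ((λ x → S (vecsOver xs m) (λ v → f (x ∷ v))) ∘ g y)                  ≡⟨ inv y _ ⟩
  S xs (λ x → S (vecsOver xs m) (λ v → f (x ∷ v)))                          ≡⟨ S-vecsOver xs m f ⟨
  S (vecsOver xs (suc m)) f                                                 ∎

bools : List Bool
bools = true ∷ false ∷ []

abstract
  S-xor : ∀ b (f : Bool → ℕ) → S bools (f ∘ (b xor_)) ≡ S bools f
  S-xor true  f = swap (f true) (f false)
    where
    swap : ∀ a b → b + (a + 0) ≡ a + (b + 0)
    swap = solve-∀
  S-xor false f = refl

allSubsets : ∀ n → List (Vec Bool n)
allSubsets = vecsOver bools

∈-bools : ∀ b → b ∈ bools
∈-bools true  = here refl
∈-bools false = there (here refl)

∈-allSubsets : ∀ {n} (A : Vec Bool n) → A ∈ allSubsets n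
∈-allSubsets = ∈-vecsOver ∈-bools

∈-allAdj : ∀ {n} (G : Adj n) → G ∈ allAdj n
∈-allAdj = ∈-vecsOver ∈-allSubsets

_≟ᴬ_ : ∀ {n} → DecidableEquality (Adj n)
_≟ᴬ_ = ≡-dec (≡-dec Bool._≟_)

S-allAdj-xor : ∀ {n} (M : Adj n) (f : Adj n → ℕ) → S (allAdj n) (f ∘ zipWith (zipWith _xor_) M) ≡ S (allAdj n) f
S-allAdj-xor {n} = S-zipWith (allSubsets n) (zipWith _xor_) (S-zipWith bools _xor_ S-xor)

-- Degrees and regularity

trues≡∑ : ∀ {n} (v : Vec Bool n) → trues v ≡ ∑ (λ i → 𝟙 (lookup v i))
trues≡∑ []          = sym (∑-zero _)
trues≡∑ (true ∷ v)  = trans (cong suc (trues≡∑ v)) (sym (∑-suc _))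
trues≡∑ (false ∷ v) = trans (trues≡∑ v) (sym (∑-suc _))

deg≡∑ : ∀ {n} (G : Adj n) i → deg G i ≡ ∑ (λ j → 𝟙 (edge G i j))
deg≡∑ G i = trues≡∑ (lookup G i)

and⁻ : ∀ (f : X → Bool) {xs x} → and (map f xs) ≡ true → x ∈ xs → f x ≡ true
and⁻ f h (here refl) = proj₁ (∧-split h)
and⁻ f h (there p)   = and⁻ f (proj₂ (∧-split h)) p

and⁺ : ∀ (f : X → Bool) xs → (∀ x → f x ≡ true) → and (map f xs) ≡ true
and⁺ f []       h = refl
and⁺ f (x ∷ xs) h = ∧-join (h x) (and⁺ f xs h)

allF⁻ : ∀ {n} (f : Fin n → Bool) → allF n f ≡ true → ∀ i → f i ≡ true
allF⁻ f h i = and⁻ f h (∈-allFin i)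

allF⁺ : ∀ {n} (f : Fin n → Bool) → (∀ i → f i ≡ true) → allF n f ≡ true
allF⁺ f h = and⁺ f (allFin _) h

eqB⁻ : ∀ a b → eqB a b ≡ true → a ≡ b
eqB⁻ true  true  _ = refl
eqB⁻ false false _ = refl

eqB⁺ : ∀ {a b} → a ≡ b → eqB a b ≡ true
eqB⁺ {true}  refl = refl
eqB⁺ {false} refl = refl

eqℕ⁻ : ∀ a b → eqℕ a b ≡ true → a ≡ b
eqℕ⁻ zero    zero    _ = refl
eqℕ⁻ (suc a) (suc b) h = cong suc (eqℕ⁻ a b h)

eqℕ⁺ : ∀ {a b} → a ≡ b → eqℕ a b ≡ true
eqℕ⁺ {zero}  refl = refl
eqℕ⁺ {suc a} refl = eqℕ⁺ {a} refl

regular⁻ : ∀ {d n} (G : Adj n) → IsRegular d G → IsGraph G × (∀ i → deg G i ≡ d)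
regular⁻ G h with ∧-split h
... | s , h′ with ∧-split h′
...   | l , r =
  ((λ i j → eqB⁻ _ _ (allF⁻ _ (allF⁻ _ s i) j)) , λ i → not-true (allF⁻ _ l i)) ,
  λ i → eqℕ⁻ _ _ (allF⁻ _ r i)

regular⁺ : ∀ {d n} (G : Adj n) → IsGraph G → (∀ i → deg G i ≡ d) → IsRegular d G
regular⁺ G (s , l) r =
  ∧-join (allF⁺ _ λ i → allF⁺ _ λ j → eqB⁺ (s i j))
    (∧-join (allF⁺ _ λ i → false⇒not (l i)) (allF⁺ _ λ i → eqℕ⁺ (r i)))

-- Degrees, cuts and the numbers of adjacent pairs inside a set are all of this form, so a single
-- account of how a switching changes it serves for each of them.
wt : ∀ {n} → (Fin n → Fin n → ℕ) → Adj n → ℕ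
wt w G = ∑∑ λ i j → w i j * 𝟙 (edge G i j)

-- Switchings

mask : ∀ {n} → Fin n → Fin n → Fin n → Fin n → Bool
mask a b i j = ((i == a) ∧ (j == b)) ∨ ((i == b) ∧ (j == a))

toggle : ∀ {n} → Fin n → Fin n → Adj n → Adj n
toggle a b = zipWith (zipWith _xor_) (tabulate λ i → tabulate (mask a b i))

edge-toggle : ∀ {n} (a b : Fin n) G i j → edge (toggle a b G) i j ≡ mask a b i j xor edge G i j
edge-toggle a b G i j =
  trans (cong (λ r → lookup r j) (lookup-zipWith (zipWith _xor_) i (tabulate λ i → tabulate (mask a b i)) G))
  (trans (cong (λ r → lookup (zipWith _xor_ r (lookup G i)) j) (lookup∘tabulate (λ i → tabulate (mask a b i)) i))
  (trans (lookup-zipWith _xor_ j (tabulate (mask a b i)) (lookup G i))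
  (cong (_xor edge G i j) (lookup∘tabulate (mask a b i) j))))

∨-split : ∀ {a b} → a ∨ b ≡ true → a ≡ true ⊎ b ≡ true
∨-split {true}  h = inj₁ refl
∨-split {false} h = inj₂ h

mask⁻ : ∀ {n} (a b i j : Fin n) → mask a b i j ≡ true → (i ≡ a × j ≡ b) ⊎ (i ≡ b × j ≡ a)
mask⁻ a b i j h with ∨-split {(i == a) ∧ (j == b)} h
... | inj₁ p = inj₁ (==⇒≡ i a (proj₁ (∧-split p)) , ==⇒≡ j b (proj₂ (∧-split p)))
... | inj₂ p = inj₂ (==⇒≡ i b (proj₁ (∧-split {i == b} p)) , ==⇒≡ j a (proj₂ (∧-split {i == b} p)))

mask-avoids : ∀ {n} (a b : Fin n) {i} j → i ≢ a → i ≢ b → mask a b i j ≡ false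
mask-avoids a b {i} j p q rewrite ≢⇒== p | ≢⇒== q = refl

mask-self : ∀ {n} (a b : Fin n) → mask a b a b ≡ true
mask-self a b rewrite ==-refl a | ==-refl b = refl

mask-sym : ∀ {n} (a b i j : Fin n) → mask a b i j ≡ mask a b j i
mask-sym a b i j = trans (cong₂ _∨_ (Bool.∧-comm (i == a) (j == b)) (Bool.∧-comm (i == b) (j == a)))
  (Bool.∨-comm ((j == b) ∧ (i == a)) ((j == a) ∧ (i == b)))

𝟙-mask : ∀ {n} {a b : Fin n} → a ≢ b → ∀ i j → 𝟙 (mask a b i j) ≡ 𝟙 (i == a) * 𝟙 (j == b) + 𝟙 (i == b) * 𝟙 (j == a)
𝟙-mask {a = a} {b} a≢b i j with i Fin.≟ a | i Fin.≟ b
... | yes p | yes q = contradiction (trans (sym p) q) a≢b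
... | yes p | no  q with j == b
...   | true  = refl
...   | false = refl
𝟙-mask a≢b i j | no p | yes q = sym (+-identityʳ _)
𝟙-mask a≢b i j | no p | no  q = refl

mask-weight : ∀ {n} {a b : Fin n} → a ≢ b → ∀ w → ∑∑ (λ i j → w i j * 𝟙 (mask a b i j)) ≡ w a b + w b a
mask-weight {a = a} {b} a≢b w = begin-equality
  ∑∑ (λ i j → w i j * 𝟙 (mask a b i j)) ≡⟨ ∑∑-cong (λ i j → trans (cong (w i j *_) (𝟙-mask a≢b i j)) (rearrange (w i j) (𝟙 (i == a)) (𝟙 (j == b)) (𝟙 (i == b)) (𝟙 (j == a)))) ⟩
  ∑∑ (λ i j → 𝟙 (i == a) * (𝟙 (j == b) * w i j) + 𝟙 (i == b) * (𝟙 (j == a) * w i j)) ≡⟨ ∑∑-+ _ _ ⟩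
  ∑∑ (λ i j → 𝟙 (i == a) * (𝟙 (j == b) * w i j)) + ∑∑ (λ i j → 𝟙 (i == b) * (𝟙 (j == a) * w i j)) ≡⟨ cong₂ _+_ (∑∑-pick a b w) (∑∑-pick b a w) ⟩
  w a b + w b a ∎
  where
  rearrange : ∀ w p q r s → w * (p * q + r * s) ≡ p * (q * w) + r * (s * w)
  rearrange = solve-∀

toggle-on : ∀ {n} {a b : Fin n} (G : Adj n) → IsGraph G → a ≢ b → edge G a b ≡ false →
  ∀ w → wt w (toggle a b G) ≡ wt w G + (w a b + w b a)
toggle-on {a = a} {b} G (sy , _) a≢b off w = begin-equality
  wt w (toggle a b G)                                             ≡⟨ ∑∑-cong pointwise ⟩
  ∑∑ (λ i j → w i j * 𝟙 (edge G i j) + w i j * 𝟙 (mask a b i j)) ≡⟨ ∑∑-+ _ _ ⟩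
  wt w G + ∑∑ (λ i j → w i j * 𝟙 (mask a b i j))                  ≡⟨ cong (wt w G +_) (mask-weight a≢b w) ⟩
  wt w G + (w a b + w b a)                                        ∎
  where
  xor-on : ∀ m e → (m ≡ true → e ≡ false) → 𝟙 (m xor e) ≡ 𝟙 e + 𝟙 m
  xor-on true  e h rewrite h refl = refl
  xor-on false e h = sym (+-identityʳ _)
  masked : ∀ i j → mask a b i j ≡ true → edge G i j ≡ false
  masked i j h with mask⁻ a b i j h
  ... | inj₁ (refl , refl) = off
  ... | inj₂ (refl , refl) = trans (sy i j) off
  pointwise : ∀ i j → w i j * 𝟙 (edge (toggle a b G) i j) ≡ w i j * 𝟙 (edge G i j) + w i j * 𝟙 (mask a b i j)
  pointwise i j = trans (cong (λ e → w i j * 𝟙 e) (edge-toggle a b G i j))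
    (trans (cong (w i j *_) (xor-on _ _ (masked i j))) (*-distribˡ-+ (w i j) _ _))

toggle-off : ∀ {n} {a b : Fin n} (G : Adj n) → IsGraph G → a ≢ b → edge G a b ≡ true →
  ∀ w → wt w (toggle a b G) + (w a b + w b a) ≡ wt w G
toggle-off {a = a} {b} G (sy , _) a≢b on w = begin-equality
  wt w (toggle a b G) + (w a b + w b a)                             ≡⟨ cong (wt w (toggle a b G) +_) (mask-weight a≢b w) ⟨
  wt w (toggle a b G) + ∑∑ (λ i j → w i j * 𝟙 (mask a b i j))       ≡⟨ ∑∑-+ _ _ ⟨
  ∑∑ (λ i j → w i j * 𝟙 (edge (toggle a b G) i j) + w i j * 𝟙 (mask a b i j)) ≡⟨ ∑∑-cong pointwise ⟩
  wt w G                                                            ∎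
  where
  xor-off : ∀ m e → (m ≡ true → e ≡ true) → 𝟙 (m xor e) + 𝟙 m ≡ 𝟙 e
  xor-off true  e h rewrite h refl = refl
  xor-off false e h = +-identityʳ _
  masked : ∀ i j → mask a b i j ≡ true → edge G i j ≡ true
  masked i j h with mask⁻ a b i j h
  ... | inj₁ (refl , refl) = on
  ... | inj₂ (refl , refl) = trans (sy i j) on
  pointwise : ∀ i j → w i j * 𝟙 (edge (toggle a b G) i j) + w i j * 𝟙 (mask a b i j) ≡ w i j * 𝟙 (edge G i j)
  pointwise i j = trans (cong (λ e → w i j * 𝟙 e + _) (edge-toggle a b G i j))
    (trans (sym (*-distribˡ-+ (w i j) _ _)) (cong (w i j *_) (xor-off _ _ (masked i j))))

toggle-graph : ∀ {n} {a b : Fin n} (G : Adj n) → IsGraph G → a ≢ b → IsGraph (toggle a b G)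
toggle-graph {a = a} {b} G (sy , lo) a≢b =
  (λ i j → trans (edge-toggle a b G i j) (trans (cong₂ _xor_ (mask-sym a b i j) (sy i j)) (sym (edge-toggle a b G j i)))) ,
  λ i → trans (edge-toggle a b G i i) (trans (cong (_xor edge G i i) (diagonal i)) (lo i))
  where
  diagonal : ∀ i → mask a b i i ≡ false
  diagonal i with mask a b i i in eq
  ... | false = refl
  ... | true with mask⁻ a b i i eq
  ...   | inj₁ (p , q) = contradiction (trans (sym p) q) a≢b
  ...   | inj₂ (p , q) = contradiction (trans (sym q) p) a≢b

edge-toggle-other : ∀ {n} (a b : Fin n) G {i} j → i ≢ a → i ≢ b → edge (toggle a b G) i j ≡ edge G i j
edge-toggle-other a b G j p q = trans (edge-toggle a b G _ j) (cong (_xor edge G _ j) (mask-avoids a b j p q))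

edge-toggle-otherʳ : ∀ {n} (a b : Fin n) G i {j} → IsGraph G → j ≢ a → j ≢ b → edge (toggle a b G) i j ≡ edge G i j
edge-toggle-otherʳ a b G i {j} g p q = trans (edge-toggle a b G i j)
  (cong (_xor edge G i j) (trans (mask-sym a b i j) (mask-avoids a b i p q)))

edge-toggle-self : ∀ {n} (a b : Fin n) G → edge (toggle a b G) a b ≡ not (edge G a b)
edge-toggle-self a b G = trans (edge-toggle a b G a b) (cong (_xor edge G a b) (mask-self a b))

S-toggle : ∀ {n} (a b : Fin n) (f : Adj n → ℕ) → S (allAdj n) (f ∘ toggle a b) ≡ S (allAdj n) f
S-toggle a b = S-allAdj-xor (tabulate λ i → tabulate (mask a b i))

edge⇒≢ : ∀ {n} (G : Adj n) {i j} → IsGraph G → edge G i j ≡ true → i ≢ j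
edge⇒≢ G {i} (_ , lo) e refl with trans (sym e) (lo i)
... | ()

-- Read from the inside: `vy` and `ux` are put in, then `xy` and `uv` taken out. No test is made, so
-- for fixed vertices this permutes all matrices; that edges are exchanged as intended is proved in
-- `Switch` for suitable quadruples.
switch : ∀ {n} → Fin n → Fin n → Fin n → Fin n → Adj n → Adj n
switch u v x y G = toggle u v (toggle x y (toggle u x (toggle v y G)))

S-switch : ∀ {n} (u v x y : Fin n) (f : Adj n → ℕ) → S (allAdj n) (f ∘ switch u v x y) ≡ S (allAdj n) f
S-switch u v x y f =
  trans (S-toggle v y (f ∘ toggle u v ∘ toggle x y ∘ toggle u x))
  (trans (S-toggle u x (f ∘ toggle u v ∘ toggle x y))
  (trans (S-toggle x y (f ∘ toggle u v)) (S-toggle u v f)))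

module Switch {n} (G : Adj n) (g : IsGraph G) {u v x y : Fin n}
  (u≢x : u ≢ x) (u≢y : u ≢ y) (v≢x : v ≢ x) (v≢y : v ≢ y)
  (uv : edge G u v ≡ true) (xy : edge G x y ≡ true) (ux : edge G u x ≡ false) (vy : edge G v y ≡ false) where

  private
    u≢v : u ≢ v
    u≢v = edge⇒≢ G g uv
    x≢y : x ≢ y
    x≢y = edge⇒≢ G g xy
    G₁ G₂ G₃ : Adj n
    G₁ = toggle v y G
    G₂ = toggle u x G₁
    G₃ = toggle x y G₂
    g₁ : IsGraph G₁
    g₁ = toggle-graph G g v≢y
    g₂ : IsGraph G₂
    g₂ = toggle-graph G₁ g₁ u≢x
    g₃ : IsGraph G₃
    g₃ = toggle-graph G₂ g₂ x≢y
    ux₁ : edge G₁ u x ≡ false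
    ux₁ = trans (edge-toggle-other v y G x u≢v u≢y) ux
    xy₂ : edge G₂ x y ≡ true
    xy₂ = trans (edge-toggle-otherʳ u x G₁ x g₁ (≢-sym u≢y) (≢-sym x≢y))
      (trans (edge-toggle-other v y G y (≢-sym v≢x) x≢y) xy)
    uv₃ : edge G₃ u v ≡ true
    uv₃ = trans (edge-toggle-other x y G₂ v u≢x u≢y)
      (trans (edge-toggle-otherʳ u x G₁ u g₁ (≢-sym u≢v) v≢x)
      (trans (edge-toggle-other v y G v u≢v u≢y) uv))

  switch-graph : IsGraph (switch u v x y G)
  switch-graph = toggle-graph G₃ g₃ u≢v

  switch-ux : edge (switch u v x y G) u x ≡ true
  switch-ux = trans (edge-toggle-otherʳ u v G₃ u g₃ (≢-sym u≢x) (≢-sym v≢x))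
    (trans (edge-toggle-other x y G₂ x u≢x u≢y)
    (trans (edge-toggle-self u x G₁) (cong not ux₁)))

  switch-vy : edge (switch u v x y G) v y ≡ true
  switch-vy = trans (edge-toggle-otherʳ u v G₃ v g₃ (≢-sym u≢y) (≢-sym v≢y))
    (trans (edge-toggle-other x y G₂ y v≢x v≢y)
    (trans (edge-toggle-other u x G₁ y (≢-sym u≢v) v≢x)
    (trans (edge-toggle-self v y G) (cong not vy))))

  switch-wt : ∀ w → wt w (switch u v x y G) + ((w u v + w v u) + (w x y + w y x)) ≡
                    wt w G + ((w v y + w y v) + (w u x + w x u))
  switch-wt w = begin-equality
    wt w (switch u v x y G) + (p + q) ≡⟨ +-assoc (wt w (switch u v x y G)) p q ⟨
    wt w (switch u v x y G) + p + q   ≡⟨ cong (_+ q) (toggle-off G₃ g₃ u≢v uv₃ w) ⟩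
    wt w G₃ + q                       ≡⟨ toggle-off G₂ g₂ x≢y xy₂ w ⟩
    wt w G₂                           ≡⟨ toggle-on G₁ g₁ u≢x ux₁ w ⟩
    wt w G₁ + s                       ≡⟨ cong (_+ s) (toggle-on G g v≢y vy w) ⟩
    wt w G + r + s                    ≡⟨ +-assoc (wt w G) r s ⟩
    wt w G + (r + s)                  ∎
    where
    p q r s : ℕ
    p = w u v + w v u
    q = w x y + w y x
    r = w v y + w y v
    s = w u x + w x u

deg≡wt : ∀ {n} (G : Adj n) i → deg G i ≡ wt (λ k _ → 𝟙 (k == i)) G
deg≡wt G i = trans (deg≡∑ G i) (sym (trans (∑-cong λ k → ∑-scaleˡ (𝟙 (k == i)) _) (∑-pick i _)))

-- Each of `u`, `v`, `x`, `y` is an end of one removed and one added edge, so for the weight of row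
-- `i` the corrections on the two sides of `switch-wt` are the same four indicators in another
-- order.
switch-regular : ∀ {d n} (G : Adj n) {u v x y} → IsRegular d G → u ≢ x → u ≢ y → v ≢ x → v ≢ y →
  edge G u v ≡ true → edge G x y ≡ true → edge G u x ≡ false → edge G v y ≡ false →
  IsRegular d (switch u v x y G)
switch-regular {d} G {u} {v} {x} {y} r u≢x u≢y v≢x v≢y uv xy ux vy with regular⁻ G r
... | g , dg = regular⁺ (switch u v x y G) switch-graph λ i → begin-equality
  deg (switch u v x y G) i                       ≡⟨ deg≡wt (switch u v x y G) i ⟩
  wt (λ k _ → 𝟙 (k == i)) (switch u v x y G)     ≡⟨ +-cancelʳ-≡ _ _ _ (trans (switch-wt (λ k _ → 𝟙 (k == i))) (cong (wt (λ k _ → 𝟙 (k == i)) G +_) (shuffle (𝟙 (v == i)) (𝟙 (y == i)) (𝟙 (u == i)) (𝟙 (x == i))))) ⟩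
  wt (λ k _ → 𝟙 (k == i)) G                      ≡⟨ deg≡wt G i ⟨
  deg G i                                        ≡⟨ dg i ⟩
  d                                              ∎
  where
  open Switch G (proj₁ (regular⁻ G r)) u≢x u≢y v≢x v≢y uv xy ux vy
  shuffle : ∀ v y u x → (v + y) + (u + x) ≡ (u + v) + (x + y)
  shuffle = solve-∀

-- Counting switchings

∑-product : ∀ {m n} (f : Fin m → ℕ) (g : Fin n → ℕ) → ∑ (λ i → ∑ (λ j → f i * g j)) ≡ ∑ f * ∑ g
∑-product f g = trans (∑-cong λ i → ∑-scaleˡ (f i) g) (∑-scaleʳ (∑ g) f)

∑∑-product : ∀ {n} (f g : Fin n → Fin n → ℕ) → ∑∑ (λ u v → ∑∑ (λ x y → f u v * g x y)) ≡ ∑∑ f * ∑∑ g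
∑∑-product f g = trans (∑∑-cong λ u v → ∑∑-scaleˡ (f u v) g)
  (trans (∑-cong λ u → ∑-scaleʳ (∑∑ g) (f u)) (∑-scaleʳ (∑∑ g) (λ u → ∑ (f u))))

∑∑-swap : ∀ {n} (f : Fin n → Fin n → ℕ) → ∑∑ f ≡ ∑∑ (λ i j → f j i)
∑∑-swap = ∑-swap

-- Edge counts relative to a vertex set

inside outside : ∀ {n} → Vec Bool n → Fin n → ℕ
inside  A i = 𝟙 (lookup A i)
outside A i = 𝟙 (not (lookup A i))

in+out : ∀ {n} (A : Vec Bool n) i → inside A i + outside A i ≡ 1
in+out A i = 𝟙-not (lookup A i)

size cosize : ∀ {n} → Vec Bool n → ℕ
size   A = ∑ (inside A)
cosize A = ∑ (outside A)

size+cosize : ∀ {n} (A : Vec Bool n) → size A + cosize A ≡ n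
size+cosize {n} A = trans (sym (∑-+ (inside A) (outside A))) (trans (∑-cong (in+out A)) (trans (∑-const n 1) (*-identityʳ n)))

cross : ∀ {n} → Vec Bool n → Adj n → ℕ
cross A = wt (λ i j → inside A i * outside A j)

-- Each edge counts twice here but once in `cross`; the factor two returns in `denseBound` and in
-- the arithmetic of `ClosedSet`.
inner outer : ∀ {n} → Vec Bool n → Adj n → ℕ
inner A = wt (λ i j → inside A i * inside A j)
outer A = wt (λ i j → outside A i * outside A j)

inner+cross : ∀ {d n} (A : Vec Bool n) (G : Adj n) → (∀ i → deg G i ≡ d) → inner A G + cross A G ≡ d * size A
inner+cross {d} A G r = begin-equality
  inner A G + cross A G                                   ≡⟨ ∑∑-+ _ _ ⟨
  ∑∑ (λ i j → inside A i * inside A j * 𝟙 (edge G i j) + inside A i * outside A j * 𝟙 (edge G i j)) ≡⟨ ∑∑-cong (λ i j → trans (factor (inside A i) (inside A j) (outside A j) (𝟙 (edge G i j))) (cong (λ k → inside A i * (k * 𝟙 (edge G i j))) (in+out A j))) ⟩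
  ∑∑ (λ i j → inside A i * (1 * 𝟙 (edge G i j)))          ≡⟨ ∑-cong (λ i → trans (∑-scaleˡ (inside A i) (λ j → 1 * 𝟙 (edge G i j))) (cong (inside A i *_) (trans (∑-cong (λ j → *-identityˡ _)) (trans (sym (deg≡∑ G i)) (r i))))) ⟩
  ∑ (λ i → inside A i * d)                                ≡⟨ ∑-scaleʳ d (inside A) ⟩
  size A * d                                              ≡⟨ *-comm (size A) d ⟩
  d * size A                                              ∎
  where
  factor : ∀ a b c e → a * b * e + a * c * e ≡ a * ((b + c) * e)
  factor = solve-∀

outer+cross : ∀ {d n} (A : Vec Bool n) (G : Adj n) → IsGraph G → (∀ i → deg G i ≡ d) → outer A G + cross A G ≡ d * cosize A
outer+cross {d} A G (sy , _) r = begin-equality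
  outer A G + cross A G                                   ≡⟨ cong (outer A G +_) (∑∑-swap _) ⟩
  outer A G + ∑∑ (λ i j → inside A j * outside A i * 𝟙 (edge G j i)) ≡⟨ ∑∑-+ _ _ ⟨
  ∑∑ (λ i j → outside A i * outside A j * 𝟙 (edge G i j) + inside A j * outside A i * 𝟙 (edge G j i)) ≡⟨ ∑∑-cong (λ i j → trans (cong (λ e → outside A i * outside A j * 𝟙 (edge G i j) + inside A j * outside A i * 𝟙 e) (sy j i)) (trans (factor (outside A i) (outside A j) (inside A j) (𝟙 (edge G i j))) (cong (λ k → outside A i * (k * 𝟙 (edge G i j))) (in+out A j)))) ⟩
  ∑∑ (λ i j → outside A i * (1 * 𝟙 (edge G i j)))         ≡⟨ ∑-cong (λ i → trans (∑-scaleˡ (outside A i) (λ j → 1 * 𝟙 (edge G i j))) (cong (outside A i *_) (trans (∑-cong (λ j → *-identityˡ _)) (trans (sym (deg≡∑ G i)) (r i))))) ⟩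
  ∑ (λ i → outside A i * d)                               ≡⟨ ∑-scaleʳ d (outside A) ⟩
  cosize A * d                                            ≡⟨ *-comm (cosize A) d ⟩
  d * cosize A                                            ∎
  where
  factor : ∀ a b c e → a * b * e + c * a * e ≡ a * ((c + b) * e)
  factor = solve-∀

module _ {n} (A : Vec Bool n) (G : Adj n) where

  innerTerm outerTerm : Fin n → Fin n → ℕ
  innerTerm u v = inside A u * inside A v * 𝟙 (edge G u v)
  outerTerm x y = outside A x * outside A y * 𝟙 (edge G x y)

  switchable : Fin n → Fin n → Fin n → Fin n → ℕ
  switchable u v x y = innerTerm u v * outerTerm x y * (𝟙 (not (edge G u x)) * 𝟙 (not (edge G v y)))

  switched : Fin n → Fin n → Fin n → Fin n → ℕ
  switched u v x y = (inside A u * outside A x * 𝟙 (edge G u x)) * (inside A v * outside A y * 𝟙 (edge G v y))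

  -- A way to arrive at `G` is recorded by the two crossing edges `ux` and `vy`, chosen
  -- independently, so the sum over quadruples factorises.
  ∑-switched : ∑∑ (λ u v → ∑∑ (switched u v)) ≡ cross A G * cross A G
  ∑-switched = trans
    (∑∑-cong λ u v → ∑-product (λ x → inside A u * outside A x * 𝟙 (edge G u x)) (λ y → inside A v * outside A y * 𝟙 (edge G v y)))
    (∑-product (λ u → ∑ (λ x → inside A u * outside A x * 𝟙 (edge G u x))) _)

  -- Start from all pairs of an inner and an outer edge. For fixed `u`, `v`, at most d² pairs (x, y)
  -- are spoilt because `ux` is an edge: x is a neighbour of `u`, and y one of x. The edge `vy`
  -- spoils at most d² more.
  switchable-count : ∀ {d} → IsGraph G → (∀ i → deg G i ≡ d) →
    inner A G * (outer A G ∸ 2 * (d * d)) ≤ ∑∑ (λ u v → ∑∑ (switchable u v))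
  switchable-count {d} (sy , _) r = begin
    I * (O ∸ 2 * (d * d))            ≡⟨ *-distribˡ-∸ I O (2 * (d * d)) ⟩
    I * O ∸ I * (2 * (d * d))        ≤⟨ m≤n+o⇒m∸n≤o (I * O) (I * (2 * (d * d))) total ⟩
    ∑∑ (λ u v → ∑∑ (switchable u v)) ∎
    where
    I O : ℕ
    I = inner A G
    O = outer A G
    e : Fin n → Fin n → ℕ
    e i j = 𝟙 (edge G i j)
    row : ∀ i → ∑ (e i) ≡ d
    row i = trans (sym (deg≡∑ G i)) (r i)
    col : ∀ j → ∑ (λ i → e i j) ≡ d
    col j = trans (∑-cong λ i → cong 𝟙 (sy i j)) (row j)
    conflict : ∀ P Q b ux vy → Q ≤ 𝟙 b → P * Q ≤ P * Q * (𝟙 (not ux) * 𝟙 (not vy)) + (P * (𝟙 ux * 𝟙 b) + P * (𝟙 vy * 𝟙 b))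
    conflict P Q b true  vy h = ≤-trans (*-monoʳ-≤ P (≤-trans h (≤-reflexive (sym (*-identityˡ _))))) (≤-trans (m≤m+n (P * (1 * 𝟙 b)) (P * (𝟙 vy * 𝟙 b))) (m≤n+m _ (P * Q * 0)))
    conflict P Q b false true h = ≤-trans (*-monoʳ-≤ P (≤-trans h (≤-reflexive (sym (*-identityˡ _))))) (≤-trans (m≤n+m (P * (1 * 𝟙 b)) (P * 0)) (m≤n+m _ (P * Q * 0)))
    conflict P Q b false false h = ≤-trans (≤-reflexive (sym (*-identityʳ _))) (m≤m+n _ _)
    outerTerm≤ : ∀ x y → outerTerm x y ≤ 𝟙 (edge G x y)
    outerTerm≤ x y = ≤-trans (*-monoˡ-≤ (e x y) (*-mono-≤ (𝟙≤1 (not (lookup A x))) (𝟙≤1 (not (lookup A y))))) (≤-reflexive (*-identityˡ _))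
    conflict₁ : ∑∑ (λ u v → ∑∑ (λ x y → innerTerm u v * (e u x * e x y))) ≡ I * (d * d)
    conflict₁ = trans (∑∑-cong λ u v → trans (∑∑-scaleˡ (innerTerm u v) (λ x y → e u x * e x y))
        (cong (innerTerm u v *_) (trans (∑-cong λ x → trans (∑-scaleˡ (e u x) (e x)) (cong (e u x *_) (row x)))
          (trans (∑-scaleʳ d (e u)) (cong (_* d) (row u))))))
      (trans (∑-cong λ u → ∑-scaleʳ (d * d) (innerTerm u)) (∑-scaleʳ (d * d) λ u → ∑ (innerTerm u)))
    conflict₂ : ∑∑ (λ u v → ∑∑ (λ x y → innerTerm u v * (e v y * e x y))) ≡ I * (d * d)
    conflict₂ = trans (∑∑-cong λ u v → trans (∑∑-scaleˡ (innerTerm u v) (λ x y → e v y * e x y))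
        (cong (innerTerm u v *_) (trans (∑∑-swap (λ x y → e v y * e x y)) (trans (∑-cong λ y → trans (∑-scaleˡ (e v y) (λ x → e x y)) (cong (e v y *_) (col y)))
          (trans (∑-scaleʳ d (e v)) (cong (_* d) (row v)))))))
      (trans (∑-cong λ u → ∑-scaleʳ (d * d) (innerTerm u)) (∑-scaleʳ (d * d) λ u → ∑ (innerTerm u)))
    total : I * O ≤ I * (2 * (d * d)) + ∑∑ (λ u v → ∑∑ (switchable u v))
    total = begin
      I * O ≡⟨ ∑∑-product innerTerm outerTerm ⟨
      ∑∑ (λ u v → ∑∑ (λ x y → innerTerm u v * outerTerm x y))
        ≤⟨ ∑∑-mono (λ u v → ∑∑-mono λ x y → conflict (innerTerm u v) (outerTerm x y) (edge G x y) (edge G u x) (edge G v y) (outerTerm≤ x y)) ⟩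
      ∑∑ (λ u v → ∑∑ (λ x y → switchable u v x y + (innerTerm u v * (e u x * e x y) + innerTerm u v * (e v y * e x y))))
        ≡⟨ ∑∑-cong (λ u v → trans (∑∑-+ (switchable u v) _) (cong (∑∑ (switchable u v) +_) (∑∑-+ (λ x y → innerTerm u v * (e u x * e x y)) _))) ⟩
      ∑∑ (λ u v → ∑∑ (switchable u v) + (∑∑ (λ x y → innerTerm u v * (e u x * e x y)) + ∑∑ (λ x y → innerTerm u v * (e v y * e x y))))
        ≡⟨ trans (∑∑-+ (λ u v → ∑∑ (switchable u v)) _) (cong (∑∑ (λ u v → ∑∑ (switchable u v)) +_) (∑∑-+ (λ u v → ∑∑ (λ x y → innerTerm u v * (e u x * e x y))) _)) ⟩
      F + (∑∑ (λ u v → ∑∑ (λ x y → innerTerm u v * (e u x * e x y))) + ∑∑ (λ u v → ∑∑ (λ x y → innerTerm u v * (e v y * e x y))))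
        ≡⟨ cong (F +_) (cong₂ _+_ conflict₁ conflict₂) ⟩
      F + (I * (d * d) + I * (d * d)) ≡⟨ double F I (d * d) ⟩
      I * (2 * (d * d)) + F ∎
      where
      F : ℕ
      F = ∑∑ (λ u v → ∑∑ (switchable u v))
      double : ∀ F I D → F + (I * D + I * D) ≡ I * (2 * D) + F
      double = solve-∀

sparseCut : ℕ → ∀ {n} → Vec Bool n → ℕ → Adj n → Bool
sparseCut d A t G = regularB d G ∧ (cross A G ≤ᵇ t)

#sparseCut : ℕ → ∀ {n} → Vec Bool n → ℕ → ℕ
#sparseCut d {n} A t = S (allAdj n) (λ G → 𝟙 (sparseCut d A t G))

≢-sides : ∀ {n} (A : Vec Bool n) {i j} → lookup A i ≡ true → lookup A j ≡ false → i ≢ j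
≢-sides A p q refl with trans (sym p) q
... | ()

-- The edges `uv` and `xy` stay on one side and contribute nothing to the cut, while `ux` and `vy`
-- contribute one each, so the budget grows by exactly 2. Merging the indicators into one Boolean
-- reduces the inequality to an implication.
switch-sparseCut : ∀ {d n} (A : Vec Bool n) t u v x y (G : Adj n) →
  𝟙 (sparseCut d A t G) * switchable A G u v x y ≤
  𝟙 (sparseCut d A (2 + t) (switch u v x y G)) * switched A (switch u v x y G) u v x y
switch-sparseCut {d} A t u v x y G = begin
  𝟙 (sparseCut d A t G) * switchable A G u v x y ≡⟨ before (sparseCut d A t G) au av (edge G u v) (not ax) (not ay) (edge G x y) (not (edge G u x)) (not (edge G v y)) ⟩
  𝟙 (sparseCut d A t G ∧ (((au ∧ av) ∧ edge G u v) ∧ ((not ax ∧ not ay) ∧ edge G x y)) ∧ (not (edge G u x) ∧ not (edge G v y)))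
    ≤⟨ 𝟙-mono _ _ implication ⟩
  𝟙 (sparseCut d A (2 + t) G′ ∧ ((au ∧ not ax) ∧ edge G′ u x) ∧ ((av ∧ not ay) ∧ edge G′ v y))
    ≡⟨ after (sparseCut d A (2 + t) G′) au (not ax) (edge G′ u x) av (not ay) (edge G′ v y) ⟨
  𝟙 (sparseCut d A (2 + t) G′) * switched A G′ u v x y ∎
  where
  G′ : Adj _
  G′ = switch u v x y G
  au av ax ay : Bool
  au = lookup A u
  av = lookup A v
  ax = lookup A x
  ay = lookup A y
  𝟙-∧₃ : ∀ a b c → 𝟙 a * 𝟙 b * 𝟙 c ≡ 𝟙 ((a ∧ b) ∧ c)
  𝟙-∧₃ a b c = sym (trans (𝟙-∧ (a ∧ b) c) (cong (_* 𝟙 c) (𝟙-∧ a b)))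
  before : ∀ s a b c p q r k l → 𝟙 s * (𝟙 a * 𝟙 b * 𝟙 c * (𝟙 p * 𝟙 q * 𝟙 r) * (𝟙 k * 𝟙 l)) ≡ 𝟙 (s ∧ (((a ∧ b) ∧ c) ∧ ((p ∧ q) ∧ r)) ∧ (k ∧ l))
  before s a b c p q r k l = sym (trans (𝟙-∧ s _) (cong (𝟙 s *_) (trans (𝟙-∧ (((a ∧ b) ∧ c) ∧ ((p ∧ q) ∧ r)) (k ∧ l))
    (cong₂ _*_ (trans (𝟙-∧ ((a ∧ b) ∧ c) _) (sym (cong₂ _*_ (𝟙-∧₃ a b c) (𝟙-∧₃ p q r)))) (𝟙-∧ k l)))))
  after : ∀ s a b c p q r → 𝟙 s * (𝟙 a * 𝟙 b * 𝟙 c * (𝟙 p * 𝟙 q * 𝟙 r)) ≡ 𝟙 (s ∧ ((a ∧ b) ∧ c) ∧ ((p ∧ q) ∧ r))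
  after s a b c p q r = sym (trans (𝟙-∧ s _) (cong (𝟙 s *_) (trans (𝟙-∧ ((a ∧ b) ∧ c) _) (sym (cong₂ _*_ (𝟙-∧₃ a b c) (𝟙-∧₃ p q r))))))
  implication : sparseCut d A t G ∧ (((au ∧ av) ∧ edge G u v) ∧ ((not ax ∧ not ay) ∧ edge G x y)) ∧ (not (edge G u x) ∧ not (edge G v y)) ≡ true →
    sparseCut d A (2 + t) G′ ∧ ((au ∧ not ax) ∧ edge G′ u x) ∧ ((av ∧ not ay) ∧ edge G′ v y) ≡ true
  implication h with ∧-split {sparseCut d A t G} h
  ... | sc , h₁ with ∧-split {((au ∧ av) ∧ edge G u v) ∧ ((not ax ∧ not ay) ∧ edge G x y)} h₁
  ... | h₂ , h₃ with ∧-split {(au ∧ av) ∧ edge G u v} h₂ | ∧-split {not (edge G u x)} h₃ | ∧-split {regularB d G} sc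
  ... | h₄ , h₅ | nux , nvy | rg , cr with ∧-split {au ∧ av} h₄ | ∧-split {not ax ∧ not ay} h₅
  ... | h₆ , uv | h₇ , xy with ∧-split {au} h₆ | ∧-split {not ax} h₇
  ... | pu , pv | nx , ny =
    ∧-join (∧-join (switch-regular G rg u≢x u≢y v≢x v≢y uv xy (not-true nux) (not-true nvy)) (≤ᵇ-true cross′))
      (∧-join (∧-join (∧-join pu nx) switch-ux) (∧-join (∧-join pv ny) switch-vy))
    where
    u≢x : u ≢ x
    u≢x = ≢-sides A pu (not-true nx)
    u≢y : u ≢ y
    u≢y = ≢-sides A pu (not-true ny)
    v≢x : v ≢ x
    v≢x = ≢-sides A pv (not-true nx)
    v≢y : v ≢ y
    v≢y = ≢-sides A pv (not-true ny)
    open Switch G (proj₁ (regular⁻ G rg)) u≢x u≢y v≢x v≢y uv xy (not-true nux) (not-true nvy)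
    w : Fin _ → Fin _ → ℕ
    w i j = inside A i * outside A j
    removed : (w u v + w v u) + (w x y + w y x) ≡ 0
    removed rewrite pu | pv | not-true {ax} nx | not-true {ay} ny = refl
    added : (w v y + w y v) + (w u x + w x u) ≡ 2
    added rewrite pu | pv | not-true {ax} nx | not-true {ay} ny = refl
    cross′ : cross A G′ ≤ 2 + t
    cross′ = begin
      cross A G′     ≡⟨ +-identityʳ (cross A G′) ⟨
      cross A G′ + 0 ≡⟨ cong (cross A G′ +_) removed ⟨
      cross A G′ + ((w u v + w v u) + (w x y + w y x)) ≡⟨ switch-wt w ⟩
      cross A G + ((w v y + w y v) + (w u x + w x u)) ≡⟨ cong (cross A G +_) added ⟩
      cross A G + 2  ≡⟨ +-comm (cross A G) 2 ⟩
      2 + cross A G  ≤⟨ +-monoʳ-≤ 2 (true-≤ᵇ _ _ cr) ⟩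
      2 + t          ∎

-- The lower bound for switchings out of a graph uses that `inner` and `outer` are degree sums minus
-- the cut, hence large when the cut is at most t; the upper bound is the square of a cut of at most
-- t + 2.
switching-inequality : ∀ d {n} (A : Vec Bool n) t →
  #sparseCut d A t * ((d * size A ∸ t) * (d * cosize A ∸ t ∸ 2 * (d * d))) ≤ #sparseCut d A (2 + t) * ((2 + t) * (2 + t))
switching-inequality d {n} A t = begin
  #sparseCut d A t * c ≡⟨ S-scaleʳ (allAdj n) c _ ⟨
  S (allAdj n) (λ G → 𝟙 (sparseCut d A t G) * c) ≤⟨ S-mono (allAdj n) many ⟩
  S (allAdj n) (λ G → 𝟙 (sparseCut d A t G) * ∑∑ (λ u v → ∑∑ (switchable A G u v))) ≡⟨ S-cong (allAdj n) (λ G → sym (∑⁴-scale (𝟙 (sparseCut d A t G)) (switchable A G))) ⟩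
  S (allAdj n) (λ G → ∑∑ (λ u v → ∑∑ (λ x y → 𝟙 (sparseCut d A t G) * switchable A G u v x y))) ≡⟨ S-∑⁴ (λ G u v x y → 𝟙 (sparseCut d A t G) * switchable A G u v x y) ⟩
  ∑∑ (λ u v → ∑∑ (λ x y → S (allAdj n) (λ G → 𝟙 (sparseCut d A t G) * switchable A G u v x y)))
    -- For a fixed quadruple the sum over all matrices may be reindexed by the switching.
    ≤⟨ ∑∑-mono (λ u v → ∑∑-mono λ x y → ≤-trans (S-mono (allAdj n) (switch-sparseCut A t u v x y)) (≤-reflexive (S-switch u v x y (λ G → 𝟙 (sparseCut d A (2 + t) G) * switched A G u v x y)))) ⟩
  ∑∑ (λ u v → ∑∑ (λ x y → S (allAdj n) (λ G → 𝟙 (sparseCut d A (2 + t) G) * switched A G u v x y))) ≡⟨ S-∑⁴ (λ G u v x y → 𝟙 (sparseCut d A (2 + t) G) * switched A G u v x y) ⟨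
  S (allAdj n) (λ G → ∑∑ (λ u v → ∑∑ (λ x y → 𝟙 (sparseCut d A (2 + t) G) * switched A G u v x y))) ≡⟨ S-cong (allAdj n) (λ G → ∑⁴-scale (𝟙 (sparseCut d A (2 + t) G)) (switched A G)) ⟩
  S (allAdj n) (λ G → 𝟙 (sparseCut d A (2 + t) G) * ∑∑ (λ u v → ∑∑ (switched A G u v))) ≤⟨ S-mono (allAdj n) few ⟩
  S (allAdj n) (λ G → 𝟙 (sparseCut d A (2 + t) G) * ((2 + t) * (2 + t))) ≡⟨ S-scaleʳ (allAdj n) _ _ ⟩
  #sparseCut d A (2 + t) * ((2 + t) * (2 + t)) ∎
  where
  c : ℕ
  c = (d * size A ∸ t) * (d * cosize A ∸ t ∸ 2 * (d * d))
  ∑⁴-scale : ∀ k (f : Fin n → Fin n → Fin n → Fin n → ℕ) → ∑∑ (λ u v → ∑∑ (λ x y → k * f u v x y)) ≡ k * ∑∑ (λ u v → ∑∑ (f u v))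
  ∑⁴-scale k f = trans (∑∑-cong λ u v → ∑∑-scaleˡ k (f u v)) (∑∑-scaleˡ k (λ u v → ∑∑ (f u v)))
  S-∑⁴ : ∀ (f : Adj n → Fin n → Fin n → Fin n → Fin n → ℕ) →
    S (allAdj n) (λ G → ∑∑ (λ u v → ∑∑ (f G u v))) ≡ ∑∑ (λ u v → ∑∑ (λ x y → S (allAdj n) (λ G → f G u v x y)))
  S-∑⁴ f = trans (S-∑∑ (allAdj n) (λ G u v → ∑∑ (f G u v))) (∑∑-cong λ u v → S-∑∑ (allAdj n) (λ G → f G u v))
  guarded : ∀ b {k l} → (b ≡ true → k ≤ l) → 𝟙 b * k ≤ 𝟙 b * l
  guarded true  h = *-monoʳ-≤ 1 (h refl)
  guarded false h = z≤n
  many : ∀ G → 𝟙 (sparseCut d A t G) * c ≤ 𝟙 (sparseCut d A t G) * ∑∑ (λ u v → ∑∑ (switchable A G u v))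
  many G = guarded (sparseCut d A t G) λ h → let (rg , cr) = ∧-split {regularB d G} h; (g , dg) = regular⁻ G rg; cr≤ = true-≤ᵇ (cross A G) t cr in begin
    c ≤⟨ *-mono-≤ (∸-monoʳ-≤ (d * size A) cr≤) (∸-monoˡ-≤ (2 * (d * d)) (∸-monoʳ-≤ (d * cosize A) cr≤)) ⟩
    (d * size A ∸ cross A G) * (d * cosize A ∸ cross A G ∸ 2 * (d * d))
      ≡⟨ cong₂ (λ p q → p * (q ∸ 2 * (d * d))) (trans (cong (_∸ cross A G) (sym (inner+cross A G dg))) (m+n∸n≡m (inner A G) (cross A G))) (trans (cong (_∸ cross A G) (sym (outer+cross A G g dg))) (m+n∸n≡m (outer A G) (cross A G))) ⟩
    inner A G * (outer A G ∸ 2 * (d * d)) ≤⟨ switchable-count A G g dg ⟩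
    ∑∑ (λ u v → ∑∑ (switchable A G u v)) ∎
  few : ∀ G → 𝟙 (sparseCut d A (2 + t) G) * ∑∑ (λ u v → ∑∑ (switched A G u v)) ≤ 𝟙 (sparseCut d A (2 + t) G) * ((2 + t) * (2 + t))
  few G = guarded (sparseCut d A (2 + t) G) λ h → let cr≤ = true-≤ᵇ (cross A G) (2 + t) (proj₂ (∧-split {regularB d G} h)) in
    ≤-trans (≤-reflexive (∑-switched A G)) (*-mono-≤ cr≤ cr≤)

#sparseCut≤ : ∀ d {n} (A : Vec Bool n) t → #sparseCut d A t ≤ numRegular d n
#sparseCut≤ d {n} A t = ≤-trans (S-mono (allAdj n) λ G → 𝟙-mono _ (regularB d G) (λ h → proj₁ (∧-split h)))
  (≤-reflexive (sym (countB≡S (regularB d) (allAdj n))))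

-- Iterating the switching inequality

^-distrib-* : ∀ x y a → (x * y) ^ a ≡ x ^ a * y ^ a
^-distrib-* x y zero    = refl
^-distrib-* x y (suc a) rewrite ^-distrib-* x y a = interchange x y (x ^ a) (y ^ a)
  where
  interchange : ∀ x y p q → x * y * (p * q) ≡ x * p * (y * q)
  interchange = solve-∀

cancelʳ-≤ : ∀ {x y} k → 1 ≤ k → x * k ≤ y * k → x ≤ y
cancelʳ-≤ {x} {y} k@(suc _) _ h = *-cancelʳ-≤ x y k h

module _ {Y : ℕ → ℕ} {r p L : ℕ} (ratio : ∀ i → 2 + i ≤ L → Y i * r ≤ Y (2 + i) * p) where

  -- The ratio is one constant on the whole range up to `L`. For bounded sets a single range
  -- suffices; for large sets, where the ratio improves as the cut shrinks, `Blocks` uses one short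
  -- range at a time.
  chain : ∀ s j → 2 * s + j ≤ L → Y j * r ^ s ≤ Y (2 * s + j) * p ^ s
  chain zero    j h = ≤-refl
  chain (suc s) j h = begin
    Y j * (r * r ^ s)               ≡⟨ *-assoc (Y j) r (r ^ s) ⟨
    Y j * r * r ^ s                 ≤⟨ *-monoˡ-≤ (r ^ s) (ratio j (≤-trans (m≤n+m (2 + j) (2 * s)) (≤-trans (≤-reflexive (shift s j)) h))) ⟩
    Y (2 + j) * p * r ^ s           ≡⟨ swapʳ (Y (2 + j)) p (r ^ s) ⟩
    Y (2 + j) * r ^ s * p           ≤⟨ *-monoˡ-≤ p (chain s (2 + j) (≤-trans (≤-reflexive (shift s j)) h)) ⟩
    Y (2 * s + (2 + j)) * p ^ s * p ≡⟨ cong (λ i → Y i * p ^ s * p) (shift s j) ⟩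
    Y (2 * suc s + j) * p ^ s * p   ≡⟨ swapʳ′ (Y (2 * suc s + j)) (p ^ s) p ⟩
    Y (2 * suc s + j) * (p * p ^ s) ∎
    where
    shift : ∀ s j → 2 * s + (2 + j) ≡ 2 * suc s + j
    shift = solve-∀
    swapʳ : ∀ a b c → a * b * c ≡ a * c * b
    swapʳ = solve-∀
    swapʳ′ : ∀ a b c → a * b * c ≡ a * (c * b)
    swapʳ′ = solve-∀

-- Divided by d^k this is the gain of blocks 1 to k, a factor 1 + 16l/d from block l; for k small
-- against d it is close to exp(8k²/d).
T-prod : ℕ → ℕ → ℕ
T-prod d zero    = 1
T-prod d (suc k) = (d + 16 * suc k) * T-prod d k

-- The right-hand side is 2d² times the second-order truncation of exp(8K²/d).
T-prod-lower : ∀ d k → d ^ suc k * (2 * (d * d) + 16 * (d * (suc k * suc k)) + 64 * ((suc k * k) * (suc k * k))) ≤ 2 * (d * d) * T-prod d (suc k)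
T-prod-lower d zero = begin
  d ^ 1 * (2 * (d * d) + 16 * (d * (1 * 1)) + 64 * ((1 * 0) * (1 * 0))) ≤⟨ m≤m+n _ (16 * (d * d)) ⟩
  d ^ 1 * (2 * (d * d) + 16 * (d * (1 * 1)) + 64 * ((1 * 0) * (1 * 0))) + 16 * (d * d) ≡⟨ identity d ⟩
  2 * (d * d) * T-prod d 1 ∎
  where
  identity : ∀ d → d * 1 * (2 * (d * d) + 16 * (d * (1 * 1)) + 64 * ((1 * 0) * (1 * 0))) + 16 * (d * d) ≡ 2 * (d * d) * ((d + 16 * 1) * 1)
  identity = solve-∀
T-prod-lower d (suc k) = begin
  d * P * f (suc K)                               ≤⟨ m≤m+n _ _ ⟩
  d * P * f (suc K) + P * (16 * (d * d) + 256 * (d * (K * K)) + 1024 * (suc K * ((K * k) * (K * k)))) ≡⟨ identity d k P ⟩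
  (d + 16 * suc K) * (P * (2 * (d * d) + 16 * (d * (K * K)) + 64 * ((K * k) * (K * k)))) ≤⟨ *-monoʳ-≤ (d + 16 * suc K) (T-prod-lower d k) ⟩
  (d + 16 * suc K) * (2 * (d * d) * T-prod d K)   ≡⟨ swapˡ (d + 16 * suc K) (2 * (d * d)) (T-prod d K) ⟩
  2 * (d * d) * T-prod d (suc K)                  ∎
  where
  K P : ℕ
  K = suc k
  P = d ^ K
  f : ℕ → ℕ
  f K = 2 * (d * d) + 16 * (d * (K * K)) + 64 * ((K * suc k) * (K * suc k))
  swapˡ : ∀ a b c → a * (b * c) ≡ b * (a * c)
  swapˡ = solve-∀
  identity : ∀ d k P →
    d * P * (2 * (d * d) + 16 * (d * ((2 + k) * (2 + k))) + 64 * (((2 + k) * (1 + k)) * ((2 + k) * (1 + k))))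
      + P * (16 * (d * d) + 256 * (d * ((1 + k) * (1 + k))) + 1024 * ((2 + k) * (((1 + k) * k) * ((1 + k) * k))))
    ≡ (d + 16 * (2 + k)) * (P * (2 * (d * d) + 16 * (d * ((1 + k) * (1 + k))) + 64 * (((1 + k) * k) * ((1 + k) * k))))
  identity = solve-∀

-- Write K for k + 1. As K k ≥ 15d/64, the three terms of `T-prod-lower` add up to at least 1 + 15/8
-- + 225/128 = 593/128, whereas 9/2 = 576/128. The surplus 17/128 is the term with 17 below.
T-prod-9/2 : ∀ d k → 1 ≤ d → 15 * d ≤ 64 * (suc k * k) → 9 * d ^ suc k ≤ 2 * T-prod d (suc k)
T-prod-9/2 d k 1≤d h = cancelʳ-≤ (64 * (d * d)) (*-mono-≤ (s≤s (z≤n {63})) (*-mono-≤ 1≤d 1≤d)) (begin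
  9 * P * (64 * (d * d))                                             ≡⟨ e₁ P (d * d) ⟩
  P * (128 * (d * d) + 448 * (d * d))                                ≤⟨ *-monoʳ-≤ P (+-monoʳ-≤ (128 * (d * d)) (≤-trans (m≤m+n _ (17 * (d * d))) (≤-reflexive (e₂ d)))) ⟩
  P * (128 * (d * d) + (16 * (d * (15 * d)) + 15 * d * (15 * d)))    ≤⟨ *-monoʳ-≤ P (+-monoʳ-≤ (128 * (d * d)) (+-mono-≤ (*-monoʳ-≤ 16 (*-monoʳ-≤ d h)) (*-mono-≤ h h))) ⟩
  P * (128 * (d * d) + (16 * (d * (64 * z)) + 64 * z * (64 * z)))    ≤⟨ *-monoʳ-≤ P (+-monoʳ-≤ (128 * (d * d)) (+-monoˡ-≤ (64 * z * (64 * z)) (*-monoʳ-≤ 16 (*-monoʳ-≤ d (*-monoʳ-≤ 64 (*-monoʳ-≤ (suc k) (n≤1+n k))))))) ⟩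
  P * (128 * (d * d) + (16 * (d * (64 * (suc k * suc k))) + 64 * z * (64 * z))) ≡⟨ e₃ P d (suc k * suc k) z ⟩
  64 * (P * (2 * (d * d) + 16 * (d * (suc k * suc k)) + 64 * (z * z))) ≤⟨ *-monoʳ-≤ 64 (T-prod-lower d k) ⟩
  64 * (2 * (d * d) * T-prod d (suc k))                              ≡⟨ e₄ (d * d) (T-prod d (suc k)) ⟩
  2 * T-prod d (suc k) * (64 * (d * d))                              ∎)
  where
  P z : ℕ
  P = d ^ suc k
  z = suc k * k
  e₁ : ∀ P D → 9 * P * (64 * D) ≡ P * (128 * D + 448 * D)
  e₁ = solve-∀
  e₂ : ∀ d → 448 * (d * d) + 17 * (d * d) ≡ 16 * (d * (15 * d)) + 15 * d * (15 * d)
  e₂ = solve-∀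
  e₃ : ∀ P d q z → P * (128 * (d * d) + (16 * (d * (64 * q)) + 64 * z * (64 * z))) ≡ 64 * (P * (2 * (d * d) + 16 * (d * q) + 64 * (z * z)))
  e₃ = solve-∀
  e₄ : ∀ D Θ → 64 * (2 * D * Θ) ≡ 2 * Θ * (64 * D)
  e₄ = solve-∀

module Blocks (Y : ℕ → ℕ) (N d a b : ℕ) (1≤a : 1 ≤ a) (a≤b : a ≤ b) (1≤d : 1 ≤ d) (b-large : 4 * (d * d) ≤ b)
  (Y≤N : ∀ t → Y t ≤ N)
  (switching : ∀ t → Y t * ((d * a ∸ t) * (d * b ∸ t ∸ 2 * (d * d))) ≤ Y (2 + t) * ((2 + t) * (2 + t))) where

  double-∸ : ∀ x y z → z + 2 * y ≤ 2 * x → z ≤ 2 * (x ∸ y)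
  double-∸ x y z h = ≤-trans (m+n≤o⇒m≤o∸n z h) (≤-reflexive (sym (*-distribˡ-∸ 2 x y)))

  -- Here E = d - 4(l + 1), and 2 + i is at most aE/2. The switching inequality gives the ratio
  -- (a/b) E²/(D D′) with D = E + 8(l + 1) and D′ = D - 1, where the 1 pays for the conflicts
  -- through 4d² ≤ b. To first order in l/E this is (a/b) d/(d + 16(l + 1)), and replacing l + 1 by
  -- l makes up for that 1.
  ratio : ∀ l e i → d ≡ 4 * suc l + suc e → 2 * (2 + i) ≤ a * suc e →
    Y i * (b * (d + 16 * l)) ≤ Y (2 + i) * (a * d)
  ratio l e i d≡ h = cancelʳ-≤ (a * (E * E)) (*-mono-≤ 1≤a (s≤s z≤n)) (begin
    Y i * (b * (d + 16 * l)) * (a * (E * E))      ≡⟨ r₁ (Y i) a b (E * E) (d + 16 * l) ⟩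
    -- What remains is E²(d + 16l) ≤ D D′ d, where `main` writes the difference with nonnegative
    -- coefficients.
    Y i * (a * b) * (E * E * (d + 16 * l))        ≤⟨ *-monoʳ-≤ (Y i * (a * b)) (≤-trans (≤-reflexive (cong (λ d → E * E * (d + 16 * l)) d≡)) (≤-trans (m≤m+n _ _) (≤-reflexive (main l E)))) ⟩
    Y i * (a * b) * (D * D′ * (4 * suc l + E))    ≡⟨ cong (λ d → Y i * (a * b) * (D * D′ * d)) d≡ ⟨
    Y i * (a * b) * (D * D′ * d)                  ≡⟨ r₂ (Y i) a b D D′ d ⟩
    Y i * (a * D * (b * D′)) * d                  ≤⟨ *-monoˡ-≤ d (*-monoʳ-≤ (Y i) (*-mono-≤ lower₁ lower₂)) ⟩
    Y i * (2 * p * (2 * q)) * d                   ≡⟨ r₃ (Y i) p q d ⟩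
    4 * (Y i * (p * q)) * d                       ≤⟨ *-monoˡ-≤ d (*-monoʳ-≤ 4 (switching i)) ⟩
    4 * (Y (2 + i) * ((2 + i) * (2 + i))) * d     ≡⟨ r₄ (Y (2 + i)) (2 + i) d ⟩
    Y (2 + i) * (2 * (2 + i) * (2 * (2 + i))) * d ≤⟨ *-monoˡ-≤ d (*-monoʳ-≤ (Y (2 + i)) (*-mono-≤ h h)) ⟩
    Y (2 + i) * (a * E * (a * E)) * d             ≡⟨ r₅ (Y (2 + i)) a E d ⟩
    Y (2 + i) * (a * d) * (a * (E * E))           ∎)
    where
    E D D′ p q : ℕ
    E  = suc e
    D  = 8 * suc l + E
    D′ = 8 * l + 7 + E
    p  = d * a ∸ i
    q  = d * b ∸ i ∸ 2 * (d * d)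
    r₁ : ∀ y a b E q → y * (b * q) * (a * E) ≡ y * (a * b) * (E * q)
    r₁ = solve-∀
    r₂ : ∀ y a b D D′ d → y * (a * b) * (D * D′ * d) ≡ y * (a * D * (b * D′)) * d
    r₂ = solve-∀
    r₃ : ∀ y p q d → y * (2 * p * (2 * q)) * d ≡ 4 * (y * (p * q)) * d
    r₃ = solve-∀
    r₄ : ∀ y i d → 4 * (y * (i * i)) * d ≡ y * (2 * i * (2 * i)) * d
    r₄ = solve-∀
    r₅ : ∀ y a e d → y * (a * e * (a * e)) * d ≡ y * (a * d) * (a * (e * e))
    r₅ = solve-∀
    main : ∀ l E → E * E * (4 * suc l + E + 16 * l) + (15 * (E * E) + E * (8 * suc l * (8 * l + 7) + (16 * l + 15) * (4 * suc l)) + 8 * suc l * (8 * l + 7) * (4 * suc l))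
      ≡ (8 * suc l + E) * (8 * l + 7 + E) * (4 * suc l + E)
    main = solve-∀
    2i≤ : 2 * i ≤ a * E
    2i≤ = ≤-trans (*-monoʳ-≤ 2 (m≤n+m i 2)) h
    lower₁ : a * D ≤ 2 * p
    lower₁ = double-∸ (d * a) i (a * D) (begin
      a * D + 2 * i                ≤⟨ +-monoʳ-≤ (a * D) 2i≤ ⟩
      a * D + a * E                ≡⟨ s₁ a l E ⟩
      2 * ((4 * suc l + E) * a)    ≡⟨ cong (λ d → 2 * (d * a)) d≡ ⟨
      2 * (d * a)                  ∎)
      where
      s₁ : ∀ a l E → a * (8 * suc l + E) + a * E ≡ 2 * ((4 * suc l + E) * a)
      s₁ = solve-∀
    lower₂ : b * D′ ≤ 2 * q
    lower₂ = double-∸ (d * b ∸ i) (2 * (d * d)) (b * D′) (≤-trans (≤-reflexive (cong (b * D′ +_) (s₂ (d * d)))) (≤-trans (+-monoʳ-≤ (b * D′) b-large)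
      (double-∸ (d * b) i (b * D′ + b) (begin
      b * D′ + b + 2 * i           ≤⟨ +-monoʳ-≤ (b * D′ + b) (≤-trans 2i≤ (*-monoˡ-≤ E a≤b)) ⟩
      b * D′ + b + b * E           ≡⟨ s₁ b l E ⟩
      2 * ((4 * suc l + E) * b)    ≡⟨ cong (λ d → 2 * (d * b)) d≡ ⟨
      2 * (d * b)                  ∎))))
      where
      s₁ : ∀ b l E → b * (8 * l + 7 + E) + b + b * E ≡ 2 * ((4 * suc l + E) * b)
      s₁ = solve-∀
      s₂ : ∀ D → 2 * (2 * D) ≡ 4 * D
      s₂ = solve-∀

  -- While at most a(d − 4(l+1))/2 edges cross, one switching shrinks the count by a/b · d/(d + 16l).
  block : ∀ l t → 2 * t + 4 * a * (l + 2) ≤ a * d → Y t * (b * (d + 16 * l)) ^ a ≤ Y (2 * a + t) * (a * d) ^ a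
  block l t h = chain {Y} {b * (d + 16 * l)} {a * d} {2 * a + t} (λ i i≤ → ratio l e i d≡ (narrow i i≤)) a t ≤-refl
    where
    room : 4 * (l + 2) ≤ d
    room = *-cancelˡ-≤ a {{>-nonZero 1≤a}} (≤-trans (≤-reflexive (r₁ a l)) (≤-trans (m≤n+m _ (2 * t)) h))
      where
      r₁ : ∀ a l → a * (4 * (l + 2)) ≡ 4 * a * (l + 2)
      r₁ = solve-∀
    e : ℕ
    e = 3 + (d ∸ 4 * (l + 2))
    d≡ : d ≡ 4 * suc l + suc e
    d≡ = trans (sym (m+[n∸m]≡n room)) (r₁ l (d ∸ 4 * (l + 2)))
      where
      r₁ : ∀ l x → 4 * (l + 2) + x ≡ 4 * suc l + suc (3 + x)
      r₁ = solve-∀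
    narrow : ∀ i → 2 + i ≤ 2 * a + t → 2 * (2 + i) ≤ a * suc e
    narrow i i≤ = +-cancelʳ-≤ (4 * a * suc l) _ _ (begin
      2 * (2 + i) + 4 * a * suc l      ≤⟨ +-monoˡ-≤ (4 * a * suc l) (*-monoʳ-≤ 2 i≤) ⟩
      2 * (2 * a + t) + 4 * a * suc l  ≡⟨ r₁ a t l ⟩
      2 * t + 4 * a * (l + 2)          ≤⟨ h ⟩
      a * d                            ≡⟨ cong (a *_) d≡ ⟩
      a * (4 * suc l + suc e)          ≡⟨ r₂ a l (suc e) ⟩
      a * suc e + 4 * a * suc l        ∎)
      where
      r₁ : ∀ a t l → 2 * (2 * a + t) + 4 * a * suc l ≡ 2 * t + 4 * a * (l + 2)
      r₁ = solve-∀
      r₂ : ∀ a l e → a * (4 * suc l + e) ≡ a * e + 4 * a * suc l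
      r₂ = solve-∀

  1≤d^a : 1 ≤ d ^ a
  1≤d^a = m^n>0 d {{>-nonZero 1≤d}} a

  -- Blocks K, K - 1, ..., 0 are passed in this order, each raising t by 2a. Only block 0 keeps its
  -- factor (a/b)^a, and the others trade theirs for 1 by a ≤ b: one such factor is what the number
  -- of sets of size a calls for.
  blocks : ∀ K t → 2 * t + 4 * a * (K + 2) ≤ a * d → Y t * (b ^ a * T-prod d K ^ a) ≤ N * (a ^ a * (d ^ K) ^ a)
  blocks zero t h = cancelʳ-≤ (d ^ a) 1≤d^a (begin
    Y t * (b ^ a * 1 ^ a) * d ^ a        ≡⟨ r₁ (Y t) (b ^ a) (1 ^ a) (d ^ a) ⟩
    Y t * (b ^ a * d ^ a) * 1 ^ a        ≡⟨ cong (λ k → Y t * k * 1 ^ a) (^-distrib-* b d a) ⟨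
    Y t * (b * d) ^ a * 1 ^ a            ≡⟨ cong (λ k → Y t * (b * k) ^ a * 1 ^ a) (+-identityʳ d) ⟨
    Y t * (b * (d + 16 * 0)) ^ a * 1 ^ a ≤⟨ *-monoˡ-≤ (1 ^ a) (block 0 t h) ⟩
    Y (2 * a + t) * (a * d) ^ a * 1 ^ a  ≤⟨ *-monoˡ-≤ (1 ^ a) (*-monoˡ-≤ ((a * d) ^ a) (Y≤N _)) ⟩
    N * (a * d) ^ a * 1 ^ a              ≡⟨ cong (λ k → N * k * 1 ^ a) (^-distrib-* a d a) ⟩
    N * (a ^ a * d ^ a) * 1 ^ a          ≡⟨ r₁ N (a ^ a) (d ^ a) (1 ^ a) ⟩
    N * (a ^ a * 1 ^ a) * d ^ a          ∎)
    where
    r₁ : ∀ y b o d → y * (b * o) * d ≡ y * (b * d) * o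
    r₁ = solve-∀
  blocks (suc K) t h = begin
    Y t * (b ^ a * (c * Θ) ^ a)                  ≡⟨ cong (λ k → Y t * (b ^ a * k)) (^-distrib-* c Θ a) ⟩
    Y t * (b ^ a * (c ^ a * Θ ^ a))              ≡⟨ r₁ (Y t) (b ^ a) (c ^ a) (Θ ^ a) ⟩
    Y t * c ^ a * (b ^ a * Θ ^ a)                ≤⟨ *-monoˡ-≤ (b ^ a * Θ ^ a) ratioᶜ ⟩
    Y (2 * a + t) * d ^ a * (b ^ a * Θ ^ a)      ≡⟨ r₂ (Y (2 * a + t)) (d ^ a) (b ^ a * Θ ^ a) ⟩
    Y (2 * a + t) * (b ^ a * Θ ^ a) * d ^ a      ≤⟨ *-monoˡ-≤ (d ^ a) (blocks K (2 * a + t) (≤-trans (≤-reflexive (r₃ a t K)) h)) ⟩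
    N * (a ^ a * (d ^ K) ^ a) * d ^ a            ≡⟨ r₄ N (a ^ a) ((d ^ K) ^ a) (d ^ a) ⟩
    N * (a ^ a * (d ^ a * (d ^ K) ^ a))          ≡⟨ cong (λ k → N * (a ^ a * k)) (^-distrib-* d (d ^ K) a) ⟨
    N * (a ^ a * (d ^ suc K) ^ a)                ∎
    where
    c Θ : ℕ
    c = d + 16 * suc K
    Θ = T-prod d K
    r₁ : ∀ y b c t → y * (b * (c * t)) ≡ y * c * (b * t)
    r₁ = solve-∀
    r₂ : ∀ y d x → y * d * x ≡ y * x * d
    r₂ = solve-∀
    r₃ : ∀ a t K → 2 * (2 * a + t) + 4 * a * (K + 2) ≡ 2 * t + 4 * a * (suc K + 2)
    r₃ = solve-∀
    r₄ : ∀ N a x d → N * (a * x) * d ≡ N * (a * (d * x))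
    r₄ = solve-∀
    ratioᶜ : Y t * c ^ a ≤ Y (2 * a + t) * d ^ a
    ratioᶜ = cancelʳ-≤ (b ^ a) (m^n>0 b {{>-nonZero (≤-trans 1≤a a≤b)}} a) (begin
      Y t * c ^ a * b ^ a              ≡⟨ s₁ (Y t) (c ^ a) (b ^ a) ⟩
      Y t * (b ^ a * c ^ a)            ≡⟨ cong (Y t *_) (^-distrib-* b c a) ⟨
      Y t * (b * c) ^ a                ≤⟨ block (suc K) t h ⟩
      Y (2 * a + t) * (a * d) ^ a      ≤⟨ *-monoʳ-≤ (Y (2 * a + t)) (^-monoˡ-≤ a (*-monoˡ-≤ d a≤b)) ⟩
      Y (2 * a + t) * (b * d) ^ a      ≡⟨ cong (Y (2 * a + t) *_) (^-distrib-* b d a) ⟩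
      Y (2 * a + t) * (b ^ a * d ^ a)  ≡⟨ s₁ (Y (2 * a + t)) (d ^ a) (b ^ a) ⟨
      Y (2 * a + t) * d ^ a * b ^ a    ∎)
      where
      s₁ : ∀ y c b → y * c * b ≡ y * (b * c)
      s₁ = solve-∀

  few-crossing : ∀ k t → 15 * d ≤ 64 * (suc k * k) → 2 * t + 4 * a * (suc k + 2) ≤ a * d →
    Y t * (b ^ a * 9 ^ a) ≤ N * (a ^ a * 2 ^ a)
  few-crossing k t hk ht = cancelʳ-≤ (P ^ a) (m^n>0 P {{>-nonZero (m^n>0 d {{>-nonZero 1≤d}} (suc k))}} a) (begin
    Y t * (b ^ a * 9 ^ a) * P ^ a       ≡⟨ r₁ (Y t) (b ^ a) (9 ^ a) (P ^ a) ⟩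
    Y t * (b ^ a * (9 ^ a * P ^ a))     ≡⟨ cong (λ k → Y t * (b ^ a * k)) (^-distrib-* 9 P a) ⟨
    Y t * (b ^ a * (9 * P) ^ a)         ≤⟨ *-monoʳ-≤ (Y t) (*-monoʳ-≤ (b ^ a) (^-monoˡ-≤ a (T-prod-9/2 d k 1≤d hk))) ⟩
    Y t * (b ^ a * (2 * Θ) ^ a)         ≡⟨ cong (λ k → Y t * (b ^ a * k)) (^-distrib-* 2 Θ a) ⟩
    Y t * (b ^ a * (2 ^ a * Θ ^ a))     ≡⟨ r₂ (Y t) (b ^ a) (2 ^ a) (Θ ^ a) ⟩
    Y t * (b ^ a * Θ ^ a) * 2 ^ a       ≤⟨ *-monoˡ-≤ (2 ^ a) (blocks (suc k) t ht) ⟩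
    N * (a ^ a * P ^ a) * 2 ^ a         ≡⟨ r₃ N (a ^ a) (P ^ a) (2 ^ a) ⟩
    N * (a ^ a * 2 ^ a) * P ^ a         ∎)
    where
    P Θ : ℕ
    P = d ^ suc k
    Θ = T-prod d (suc k)
    r₁ : ∀ y b n p → y * (b * n) * p ≡ y * (b * (n * p))
    r₁ = solve-∀
    r₂ : ∀ y b n p → y * (b * (n * p)) ≡ y * (b * p) * n
    r₂ = solve-∀
    r₃ : ∀ y b n p → y * (b * n) * p ≡ y * (b * p) * n
    r₃ = solve-∀

-- Binomial coefficients

C≤2^ : ∀ n k → n C k ≤ 2 ^ n
C≤2^ n       zero    = ≤-trans (≤-reflexive (nC0 n)) (m^n>0 2 n)
  where
  nC0 : ∀ n → n C 0 ≡ 1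
  nC0 zero    = refl
  nC0 (suc n) = refl
C≤2^ zero    (suc k) = z≤n
C≤2^ (suc n) (suc k) = begin
  suc n C suc k         ≡⟨ nCk+nC[k+1]≡[n+1]C[k+1] n k ⟨
  n C k + n C suc k     ≤⟨ +-mono-≤ (C≤2^ n k) (C≤2^ n (suc k)) ⟩
  2 ^ n + 2 ^ n         ≡⟨ cong (2 ^ n +_) (+-identityʳ (2 ^ n)) ⟨
  2 ^ suc n             ∎

C≤^ : ∀ n k → n C k ≤ n ^ k
C≤^ zero    zero    = ≤-refl
C≤^ (suc n) zero    = ≤-refl
C≤^ zero    (suc k) = z≤n
C≤^ (suc n) (suc k) = begin
  suc n C suc k         ≡⟨ nCk+nC[k+1]≡[n+1]C[k+1] n k ⟨
  n C k + n C suc k     ≤⟨ +-mono-≤ (C≤^ n k) (C≤^ n (suc k)) ⟩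
  suc n * n ^ k         ≤⟨ *-monoʳ-≤ (suc n) (^-monoˡ-≤ k (n≤1+n n)) ⟩
  suc n ^ suc k         ∎

C-factorial : ∀ a b → ((a + b) C a) * (a ! * b !) ≡ (a + b) !
C-factorial a b = begin-equality
  ((a + b) C a) * (a ! * b !)                                ≡⟨ cong (λ k → ((a + b) C a) * (a ! * k !)) (m+n∸m≡n a b) ⟨
  ((a + b) C a) * (a ! * (a + b ∸ a) !)                      ≡⟨ cong (_* (a ! * (a + b ∸ a) !)) (nCk≡n!/k![n-k]! (m≤m+n a b)) ⟩
  ((a + b) ! / (a ! * (a + b ∸ a) !)) * (a ! * (a + b ∸ a) !) ≡⟨ m/n*n≡m (k![n∸k]!∣n! (m≤m+n a b)) ⟩
  (a + b) ! ∎
  where instance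
    _ = a !* (a + b ∸ a) !≢0

C-absorb : ∀ a b → suc b * ((a + suc b) C a) ≡ (a + suc b) * ((a + b) C a)
C-absorb a b = *-cancelʳ-≡ _ _ (a ! * b !) {{a !* b !≢0}} (begin-equality
  suc b * ((a + suc b) C a) * (a ! * b !)  ≡⟨ r₁ (suc b) ((a + suc b) C a) (a !) (b !) ⟩
  ((a + suc b) C a) * (a ! * (suc b) !)      ≡⟨ C-factorial a (suc b) ⟩
  (a + suc b) !                            ≡⟨ cong _! (+-suc a b) ⟩
  suc (a + b) * (a + b) !                  ≡⟨ cong₂ _*_ (sym (+-suc a b)) (sym (C-factorial a b)) ⟩
  (a + suc b) * (((a + b) C a) * (a ! * b !)) ≡⟨ *-assoc (a + suc b) _ _ ⟨
  (a + suc b) * ((a + b) C a) * (a ! * b !) ∎)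
  where
  r₁ : ∀ s c x y → s * c * (x * y) ≡ c * (x * (s * y))
  r₁ = solve-∀

-- Shaped to meet `C-absorb`: after division it compares the growth of C(a + b, a) with that of b^a
-- when b increases by one.
bernoulli : ∀ a b → (a + suc b) * b ^ a ≤ suc b ^ suc a
bernoulli zero    b = ≤-refl
bernoulli (suc a) b = begin
  (suc a + suc b) * (b * b ^ a)   ≡⟨ *-assoc (suc a + suc b) b (b ^ a) ⟨
  (suc a + suc b) * b * b ^ a     ≤⟨ *-monoˡ-≤ (b ^ a) (≤-trans (m≤m+n ((suc a + suc b) * b) (a + 1)) (≤-reflexive (r₁ a b))) ⟩
  suc b * (a + suc b) * b ^ a     ≡⟨ *-assoc (suc b) (a + suc b) (b ^ a) ⟩
  suc b * ((a + suc b) * b ^ a)   ≤⟨ *-monoʳ-≤ (suc b) (bernoulli a b) ⟩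
  suc b * suc b ^ suc a           ∎
  where
  r₁ : ∀ a b → (suc a + suc b) * b + (a + 1) ≡ suc b * (a + suc b)
  r₁ = solve-∀

-- Induction on b - a. At a = b the central binomial coefficient is at most 4^a; when b grows by
-- one, the left side gains the factor (a + b + 1)/(b + 1), at most the factor (1 + 1/b)^a gained on
-- the right. The base has to be below 9/2, the rate in `few-crossing`.
C-upper : ∀ a r → ((a + (a + r)) C a) * a ^ a ≤ 4 ^ a * (a + r) ^ a
C-upper a zero = begin
  ((a + (a + 0)) C a) * a ^ a   ≤⟨ *-monoˡ-≤ (a ^ a) (C≤2^ (a + (a + 0)) a) ⟩
  2 ^ (a + (a + 0)) * a ^ a   ≡⟨ cong (_* a ^ a) (^-*-assoc 2 2 a) ⟨
  4 ^ a * a ^ a               ≡⟨ cong (λ k → 4 ^ a * k ^ a) (+-identityʳ a) ⟨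
  4 ^ a * (a + 0) ^ a         ∎
C-upper a (suc r) rewrite +-suc a r = *-cancelˡ-≤ (suc b) (begin
  suc b * (((a + suc b) C a) * a ^ a)       ≡⟨ *-assoc (suc b) ((a + suc b) C a) (a ^ a) ⟨
  suc b * ((a + suc b) C a) * a ^ a       ≡⟨ cong (_* a ^ a) (C-absorb a b) ⟩
  (a + suc b) * ((a + b) C a) * a ^ a     ≡⟨ *-assoc (a + suc b) _ _ ⟩
  (a + suc b) * (((a + b) C a) * a ^ a)     ≤⟨ *-monoʳ-≤ (a + suc b) (C-upper a r) ⟩
  (a + suc b) * (4 ^ a * b ^ a)           ≡⟨ r₁ (a + suc b) (4 ^ a) (b ^ a) ⟩
  4 ^ a * ((a + suc b) * b ^ a)           ≤⟨ *-monoʳ-≤ (4 ^ a) (bernoulli a b) ⟩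
  4 ^ a * (suc b * suc b ^ a)             ≡⟨ r₁ (4 ^ a) (suc b) (suc b ^ a) ⟩
  suc b * (4 ^ a * suc b ^ a)             ∎)
  where
  b : ℕ
  b = a + r
  r₁ : ∀ x y z → x * (y * z) ≡ y * (x * z)
  r₁ = solve-∀

C-upper′ : ∀ a b → a ≤ b → ((a + b) C a) * a ^ a ≤ 4 ^ a * b ^ a
C-upper′ a b a≤b = subst (λ b → ((a + b) C a) * a ^ a ≤ 4 ^ a * b ^ a) (m+[n∸m]≡n a≤b) (C-upper a (b ∸ a))

-- Exponential growth

9/8-growth : ∀ t → 8 ^ t * (8 + t) ≤ 8 * 9 ^ t
9/8-growth zero    = ≤-refl
9/8-growth (suc t) = begin
  8 * 8 ^ t * (8 + suc t)       ≤⟨ m≤m+n _ (8 ^ t * t) ⟩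
  8 * 8 ^ t * (8 + suc t) + 8 ^ t * t ≡⟨ r₁ (8 ^ t) t ⟩
  9 * (8 ^ t * (8 + t))         ≤⟨ *-monoʳ-≤ 9 (9/8-growth t) ⟩
  9 * (8 * 9 ^ t)               ≡⟨ r₂ (9 ^ t) ⟩
  8 * (9 * 9 ^ t)               ∎
  where
  r₁ : ∀ p t → 8 * p * (8 + suc t) + p * t ≡ 9 * (p * (8 + t))
  r₁ = solve-∀
  r₂ : ∀ p → 9 * (8 * p) ≡ 8 * (9 * p)
  r₂ = solve-∀

-- With t = a/3 rounded down, 1 + a ≤ 6t and 2 + a ≤ 7t, while three uses of (9/8)^t ≥ t/8 give
-- (9/8)^a ≥ t³/512. So t ≥ 6 · 7 · 512 Q = 21504 Q is enough.
quadratic-absorbed : ∀ Q a → 3 * (21504 * Q + 1) ≤ a → Q * ((1 + a) * (2 + a)) * 8 ^ a ≤ 9 ^ a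
quadratic-absorbed Q a h = cancelʳ-≤ (512 * 1) (s≤s z≤n) (begin
  Q * ((1 + a) * (2 + a)) * 8 ^ a * (512 * 1)           ≤⟨ *-monoˡ-≤ (512 * 1) (*-monoˡ-≤ (8 ^ a) (*-monoʳ-≤ Q (*-mono-≤ bound₁ bound₂))) ⟩
  Q * (6 * t * (7 * t)) * 8 ^ a * (512 * 1)             ≡⟨ r₁ Q t (8 ^ a) ⟩
  21504 * Q * (t * t) * 8 ^ a                           ≤⟨ *-monoˡ-≤ (8 ^ a) (*-monoˡ-≤ (t * t) (≤-trans (m≤m+n _ 1) t-large)) ⟩
  t * (t * t) * 8 ^ a                                   ≡⟨ cong (t * (t * t) *_) (split 8) ⟩
  t * (t * t) * (8 ^ r * (8 ^ t * (8 ^ t * 8 ^ t)))     ≡⟨ r₂ t (8 ^ t) (8 ^ r) ⟩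
  8 ^ r * (8 ^ t * t * (8 ^ t * t * (8 ^ t * t)))       ≤⟨ *-mono-≤ (^-monoˡ-≤ r (n≤1+n 8)) (*-mono-≤ cube (*-mono-≤ cube cube)) ⟩
  9 ^ r * (8 * 9 ^ t * (8 * 9 ^ t * (8 * 9 ^ t)))       ≡⟨ r₃ (9 ^ r) (9 ^ t) ⟩
  9 ^ r * (9 ^ t * (9 ^ t * 9 ^ t)) * (512 * 1)         ≡⟨ cong (_* (512 * 1)) (split 9) ⟨
  9 ^ a * (512 * 1)                                     ∎)
  where
  t r : ℕ
  t = a / 3
  r = a % 3
  a≡ : a ≡ r + t * 3
  a≡ = m≡m%n+[m/n]*n a 3
  r≤2 : r ≤ 2
  r≤2 = ≤-pred (m%n<n a 3)
  t-large : 21504 * Q + 1 ≤ t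
  t-large = ≮⇒≥ λ t< → <-irrefl refl (begin-strict
    a                          ≡⟨ a≡ ⟩
    r + t * 3                  ≤⟨ +-monoˡ-≤ (t * 3) r≤2 ⟩
    2 + t * 3                  <⟨ n<1+n _ ⟩
    suc t * 3                  ≤⟨ *-monoˡ-≤ 3 t< ⟩
    (21504 * Q + 1) * 3        ≡⟨ *-comm (21504 * Q + 1) 3 ⟩
    3 * (21504 * Q + 1)        ≤⟨ h ⟩
    a                          ∎)
  1≤t : 1 ≤ t
  1≤t = ≤-trans (m≤n+m 1 (21504 * Q)) t-large
  bound : ∀ c → c + a ≤ (2 + c) * t + 3 * t
  bound c = begin
    c + a                    ≡⟨ cong (c +_) a≡ ⟩
    c + (r + t * 3)          ≤⟨ +-monoʳ-≤ c (+-monoˡ-≤ (t * 3) r≤2) ⟩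
    c + (2 + t * 3)          ≡⟨ s₁ c t ⟩
    (2 + c) * 1 + 3 * t      ≤⟨ +-monoˡ-≤ (3 * t) (*-monoʳ-≤ (2 + c) 1≤t) ⟩
    (2 + c) * t + 3 * t      ∎
    where
    s₁ : ∀ c t → c + (2 + t * 3) ≡ (2 + c) * 1 + 3 * t
    s₁ = solve-∀
  bound₁ : 1 + a ≤ 6 * t
  bound₁ = ≤-trans (bound 1) (≤-reflexive (s₁ t))
    where
    s₁ : ∀ t → 3 * t + 3 * t ≡ 6 * t
    s₁ = solve-∀
  bound₂ : 2 + a ≤ 7 * t
  bound₂ = ≤-trans (bound 2) (≤-reflexive (s₁ t))
    where
    s₁ : ∀ t → 4 * t + 3 * t ≡ 7 * t
    s₁ = solve-∀
  cube : 8 ^ t * t ≤ 8 * 9 ^ t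
  cube = ≤-trans (*-monoʳ-≤ (8 ^ t) (m≤n+m t 8)) (9/8-growth t)
  split : ∀ b → b ^ a ≡ b ^ r * (b ^ t * (b ^ t * b ^ t))
  split b = trans (cong (b ^_) (trans a≡ (cong (r +_) (s₁ t)))) (trans (^-distribˡ-+-* b r (t + (t + t)))
    (cong (b ^ r *_) (trans (^-distribˡ-+-* b t (t + t)) (cong (b ^ t *_) (^-distribˡ-+-* b t t)))))
    where
    s₁ : ∀ t → t * 3 ≡ t + (t + t)
    s₁ = solve-∀
  r₁ : ∀ Q t p → Q * (6 * t * (7 * t)) * p * (512 * 1) ≡ 21504 * Q * (t * t) * p
  r₁ = solve-∀
  r₂ : ∀ t p q → t * (t * t) * (q * (p * (p * p))) ≡ q * (p * t * (p * t * (p * t)))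
  r₂ = solve-∀
  r₃ : ∀ q p → q * (8 * p * (8 * p * (8 * p))) ≡ q * (p * (p * p)) * (512 * 1)
  r₃ = solve-∀

-- Union bounds over vertex sets

size-∷ : ∀ {n} b (A : Vec Bool n) → size (b ∷ A) ≡ 𝟙 b + size A
size-∷ b A = ∑-suc _

size≤n : ∀ {n} (A : Vec Bool n) → size A ≤ n
size≤n A = ≤-trans (m≤m+n (size A) (cosize A)) (≤-reflexive (size+cosize A))

S-allSubsets : ∀ n (f : Vec Bool (suc n) → ℕ) →
  S (allSubsets (suc n)) f ≡ S (allSubsets n) (λ A → f (true ∷ A)) + S (allSubsets n) (λ A → f (false ∷ A))
S-allSubsets n f = trans (S-vecsOver bools n f) (trans (S-∷ true (false ∷ []) g) (cong (g true +_)
  (trans (S-∷ false [] g) (trans (cong (g false +_) (S-[] g)) (+-identityʳ _)))))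
  where
  g : Bool → ℕ
  g b = S (allSubsets n) (λ A → f (b ∷ A))

#subsets : ∀ n a → S (allSubsets n) (λ A → 𝟙 (size A ≡ᵇ a)) ≡ n C a
#subsets zero a = trans (S-∷ [] [] f) (trans (cong₂ _+_ (cong (λ s → 𝟙 (s ≡ᵇ a)) (∑-zero _)) (S-[] f)) (base a))
  where
  f : Vec Bool 0 → ℕ
  f A = 𝟙 (size A ≡ᵇ a)
  base : ∀ a → 𝟙 (0 ≡ᵇ a) + 0 ≡ 0 C a
  base zero    = refl
  base (suc a) = refl
#subsets (suc n) zero = trans (S-allSubsets n _) (trans
  (cong₂ _+_ (trans (S-cong (allSubsets n) λ A → cong (λ s → 𝟙 (s ≡ᵇ 0)) (size-∷ true A)) (S-0 (allSubsets n)))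
             (trans (S-cong (allSubsets n) λ A → cong (λ s → 𝟙 (s ≡ᵇ 0)) (size-∷ false A)) (#subsets n 0)))
  (nC0 n))
  where
  nC0 : ∀ n → n C 0 ≡ 1
  nC0 zero    = refl
  nC0 (suc n) = refl
#subsets (suc n) (suc a) = trans (S-allSubsets n _) (trans
  (cong₂ _+_ (trans (S-cong (allSubsets n) λ A → cong (λ s → 𝟙 (s ≡ᵇ suc a)) (size-∷ true A)) (#subsets n a))
             (trans (S-cong (allSubsets n) λ A → cong (λ s → 𝟙 (s ≡ᵇ suc a)) (size-∷ false A)) (#subsets n (suc a))))
  (nCk+nC[k+1]≡[n+1]C[k+1] n a))

Σ< : ℕ → (ℕ → ℕ) → ℕ
Σ< zero    f = 0
Σ< (suc n) f = Σ< n f + f n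

≡ᵇ-true : ∀ m n → (m ≡ᵇ n) ≡ true → m ≡ n
≡ᵇ-true zero    zero    _ = refl
≡ᵇ-true (suc m) (suc n) e = cong suc (≡ᵇ-true m n e)

≡ᵇ-refl : ∀ m → (m ≡ᵇ m) ≡ true
≡ᵇ-refl zero    = refl
≡ᵇ-refl (suc m) = ≡ᵇ-refl m

Σ<-pick : ∀ n s z → s < n → z ≤ Σ< n (λ a → 𝟙 (s ≡ᵇ a) * z)
Σ<-pick (suc n) s z s< with m≤n⇒m<n∨m≡n s<
... | inj₁ s<n = ≤-trans (Σ<-pick n s z (≤-pred s<n)) (m≤m+n _ _)
... | inj₂ refl = ≤-trans (≤-reflexive (trans (sym (+-identityʳ z)) (cong (λ b → 𝟙 b * z) (sym (≡ᵇ-refl s))))) (m≤n+m _ (Σ< s _))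

S-Σ< : ∀ (xs : List X) n (f : X → ℕ → ℕ) → S xs (λ x → Σ< n (f x)) ≡ Σ< n (λ a → S xs (λ x → f x a))
S-Σ< xs zero    f = S-0 xs
S-Σ< xs (suc n) f = trans (S-+ xs (λ x → Σ< n (f x)) (λ x → f x n)) (cong (_+ S xs (λ x → f x n)) (S-Σ< xs n f))

-- The weights 1/((a+1)(a+2)) sum to less than 1.
Σ<-telescope : ∀ (E : ℕ → ℕ) q N → (∀ a → E a * ((1 + a) * (2 + a) * q) ≤ N) → ∀ n → Σ< n E * q ≤ N
Σ<-telescope E q N h n = cancelʳ-≤ (suc n) (s≤s z≤n) (≤-trans (go n) (≤-trans (*-monoˡ-≤ N (n≤1+n n)) (≤-reflexive (*-comm (suc n) N))))
  where
  go : ∀ n → Σ< n E * q * suc n ≤ n * N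
  go zero    = z≤n
  go (suc n) = cancelʳ-≤ (suc n) (s≤s z≤n) (begin
    (Σ< n E + E n) * q * suc (suc n) * suc n ≡⟨ r₁ (Σ< n E) (E n) q n ⟩
    Σ< n E * q * suc n * (2 + n) + E n * ((1 + n) * (2 + n) * q) ≤⟨ +-mono-≤ (*-monoˡ-≤ (2 + n) (go n)) (h n) ⟩
    n * N * (2 + n) + N ≡⟨ r₂ n N ⟩
    suc n * N * suc n ∎)
    where
    r₁ : ∀ s e q n → (s + e) * q * (2 + n) * (1 + n) ≡ s * q * (1 + n) * (2 + n) + e * ((1 + n) * (2 + n) * q)
    r₁ = solve-∀
    r₂ : ∀ n N → n * N * (2 + n) + N ≡ (1 + n) * N * (1 + n)
    r₂ = solve-∀

classSum : ∀ {n} → (Vec Bool n → ℕ) → ℕ → ℕ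
classSum {n} Z a = S (allSubsets n) (λ A → 𝟙 (size A ≡ᵇ a) * Z A)

-- Giving size a the share 1/((a + 1)(a + 2)) of the budget costs only a polynomial in a and no
-- factor depending on n, although n + 1 sizes occur.
union-bound : ∀ {n} (Z : Vec Bool n → ℕ) q N → (∀ a → classSum Z a * ((1 + a) * (2 + a) * q) ≤ N) → S (allSubsets n) Z * q ≤ N
union-bound {n} Z q N h = begin
  S (allSubsets n) Z * q ≤⟨ *-monoˡ-≤ q (S-mono (allSubsets n) λ A → Σ<-pick (suc n) (size A) (Z A) (s≤s (size≤n A))) ⟩
  S (allSubsets n) (λ A → Σ< (suc n) (λ a → 𝟙 (size A ≡ᵇ a) * Z A)) * q ≡⟨ cong (_* q) (S-Σ< (allSubsets n) (suc n) (λ A a → 𝟙 (size A ≡ᵇ a) * Z A)) ⟩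
  Σ< (suc n) (classSum Z) * q ≤⟨ Σ<-telescope (classSum Z) q N h (suc n) ⟩
  N ∎

classSum-bound : ∀ {n} (Z : Vec Bool n → ℕ) a α β → (∀ A → size A ≡ a → Z A * α ≤ β) → classSum Z a * α ≤ (n C a) * β
classSum-bound {n} Z a α β h = begin
  classSum Z a * α ≡⟨ S-scaleʳ (allSubsets n) α _ ⟨
  S (allSubsets n) (λ A → 𝟙 (size A ≡ᵇ a) * Z A * α) ≤⟨ S-mono (allSubsets n) pointwise ⟩
  S (allSubsets n) (λ A → 𝟙 (size A ≡ᵇ a) * β) ≡⟨ S-scaleʳ (allSubsets n) β _ ⟩
  S (allSubsets n) (λ A → 𝟙 (size A ≡ᵇ a)) * β ≡⟨ cong (_* β) (#subsets n a) ⟩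
  (n C a) * β ∎
  where
  pointwise : ∀ A → 𝟙 (size A ≡ᵇ a) * Z A * α ≤ 𝟙 (size A ≡ᵇ a) * β
  pointwise A with size A ≡ᵇ a in eq
  ... | false = z≤n
  ... | true  = ≤-trans (≤-reflexive (cong (_* α) (+-identityʳ (Z A)))) (≤-trans (h A (≡ᵇ-true _ a eq)) (≤-reflexive (sym (+-identityʳ β))))

guard-≤ : ∀ b {z k N} → (b ≡ true → z * k ≤ N) → 𝟙 b * z * k ≤ N
guard-≤ true  {z} {k} h = ≤-trans (≤-reflexive (cong (_* k) (+-identityʳ z))) (h refl)
guard-≤ false h = z≤n

-- The two exceptional events

isSmall : ℕ → ℕ → Bool
isSmall V a = (1 ≤ᵇ a) ∧ (suc a ≤ᵇ V)

isLarge : ℕ → ℕ → ℕ → Bool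
isLarge C₀ n a = (C₀ ≤ᵇ a) ∧ (2 * a ≤ᵇ n)

-- A set of a vertices of a d-regular graph spans more than a edges when at most this many edges leave it.
denseBound : ℕ → ℕ → ℕ
denseBound d a = d * a ∸ 2 * suc a

#dense : ∀ d V {n} → Vec Bool n → ℕ
#dense d V A = 𝟙 (isSmall V (size A)) * #sparseCut d A (denseBound d (size A))

-- Deleting at most c edges at each vertex of A, and at most d vertices outside A, removes at most c|A| + d² edges
-- leaving A.
#weak : ∀ d c C₀ {n} → Vec Bool n → ℕ
#weak d c C₀ {n} A = 𝟙 (isLarge C₀ n (size A)) * #sparseCut d A (c * size A + d * d)

classSum-guard : ∀ {n} (g : ℕ → Bool) (Z : Vec Bool n → ℕ) a κ N → (g a ≡ true → classSum Z a * κ ≤ N) →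
  classSum (λ A → 𝟙 (g (size A)) * Z A) a * κ ≤ N
classSum-guard {n} g Z a κ N h = ≤-trans (≤-reflexive (cong (_* κ) pull)) (guard-≤ (g a) h)
  where
  pointwise : ∀ A → 𝟙 (size A ≡ᵇ a) * (𝟙 (g (size A)) * Z A) ≡ 𝟙 (g a) * (𝟙 (size A ≡ᵇ a) * Z A)
  pointwise A with size A ≡ᵇ a in eq
  ... | false = sym (*-zeroʳ (𝟙 (g a)))
  ... | true rewrite ≡ᵇ-true (size A) a eq = trans (+-identityʳ _) (cong (𝟙 (g a) *_) (sym (+-identityʳ (Z A))))
  pull : classSum (λ A → 𝟙 (g (size A)) * Z A) a ≡ 𝟙 (g a) * classSum Z a
  pull = trans (S-cong (allSubsets n) pointwise) (S-scaleˡ (allSubsets n) (𝟙 (g a)) _)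

cosize≡ : ∀ {n} (A : Vec Bool n) {a} → size A ≡ a → cosize A ≡ n ∸ a
cosize≡ {n} A refl = sym (trans (cong (_∸ size A) (sym (size+cosize A))) (m+n∸m≡n (size A) (cosize A)))

module _ (d V m : ℕ) (4≤d : 4 ≤ d) (1≤V : 1 ≤ V) where

  private
    W κ : ℕ
    W = (d * V) * (d * V)
    κ = (1 + V) * (2 + V) * m

  denseThreshold : ℕ
  denseThreshold = κ * W ^ V + (2 * (d * V) + 2 * (d * d)) + 1

  -- At bounded size constants are harmless: one switching costs at most W/n, and a + 1 of them give
  -- one factor 1/n more than the choice of the set can cancel. `denseThreshold` makes n exceed the
  -- constants collected.
  #dense-sum : ∀ n → denseThreshold ≤ n → S (allSubsets n) (#dense d V) * m ≤ numRegular d n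
  #dense-sum n large = union-bound (#dense d V) m N λ a → classSum-guard (isSmall V) (λ A → #sparseCut d A (denseBound d (size A))) a _ N (bound a)
    where
    N : ℕ
    N = numRegular d n
    1≤n : 1 ≤ n
    1≤n = ≤-trans (m≤n+m 1 (κ * W ^ V + (2 * (d * V) + 2 * (d * d)))) large
    1≤dV : 1 ≤ d * V
    1≤dV = *-mono-≤ (≤-trans (s≤s z≤n) 4≤d) 1≤V
    1≤W^V : 1 ≤ W ^ V
    1≤W^V = m^n>0 W {{>-nonZero (*-mono-≤ 1≤dV 1≤dV)}} V
    bound : ∀ a → isSmall V a ≡ true → classSum (λ A → #sparseCut d A (denseBound d (size A))) a * ((1 + a) * (2 + a) * m) ≤ N
    bound a small with ∧-split small
    ... | 1≤ᵇa , a<ᵇV = cancelʳ-≤ (W ^ V) 1≤W^V (begin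
      E * ((1 + a) * (2 + a) * m) * W ^ V ≤⟨ *-monoˡ-≤ (W ^ V) (*-monoʳ-≤ E (*-monoˡ-≤ m (*-mono-≤ (s≤s a≤V) (s≤s (s≤s a≤V))))) ⟩
      E * κ * W ^ V                       ≡⟨ *-assoc E κ (W ^ V) ⟩
      E * (κ * W ^ V)                     ≤⟨ *-monoʳ-≤ E (≤-trans (m≤m+n _ _) (≤-trans (m≤m+n _ 1) large)) ⟩
      E * n                               ≤⟨ cancelʳ-≤ (n ^ a) (m^n>0 n {{>-nonZero 1≤n}} a) E*n ⟩
      N * W ^ V                           ∎)
      where
      1≤a : 1 ≤ a
      1≤a = true-≤ᵇ 1 a 1≤ᵇa
      a<V : a < V
      a<V = true-≤ᵇ (suc a) V a<ᵇV
      a≤V : a ≤ V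
      a≤V = <⇒≤ a<V
      E p : ℕ
      E = classSum (λ A → #sparseCut d A (denseBound d (size A))) a
      p = (d * a) * (d * a)
      p≤W : p ≤ W
      p≤W = *-mono-≤ (*-monoʳ-≤ d a≤V) (*-monoʳ-≤ d a≤V)
      room : 2 * suc a ≤ d * a
      room = begin
        2 * suc a     ≡⟨ r₁ a ⟩
        2 * 1 + 2 * a ≤⟨ +-monoˡ-≤ (2 * a) (*-monoʳ-≤ 2 1≤a) ⟩
        2 * a + 2 * a ≡⟨ r₂ a ⟩
        4 * a         ≤⟨ *-monoˡ-≤ a 4≤d ⟩
        d * a         ∎
        where
        r₁ : ∀ a → 2 * suc a ≡ 2 * 1 + 2 * a
        r₁ = solve-∀
        r₂ : ∀ a → 2 * a + 2 * a ≡ 4 * a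
        r₂ = solve-∀
      cut-bound : ∀ A → size A ≡ a → #sparseCut d A (denseBound d (size A)) * n ^ suc a ≤ N * W ^ V
      cut-bound A refl = begin
        -- Exactly a + 1 switchings lead from `denseBound d a` up to d a, the largest cut that the
        -- degrees allow.
        #sparseCut d A (denseBound d a) * n ^ suc a ≤⟨ chain {#sparseCut d A} {n} {p} {d * a} ratio (suc a) (denseBound d a) (≤-reflexive (m+[n∸m]≡n room)) ⟩
        #sparseCut d A _ * p ^ suc a                ≤⟨ *-mono-≤ (#sparseCut≤ d A _) (≤-trans (^-monoˡ-≤ (suc a) p≤W) (^-monoʳ-≤ W {{>-nonZero (*-mono-≤ 1≤dV 1≤dV)}} a<V)) ⟩
        N * W ^ V ∎
        where
        ratio : ∀ i → 2 + i ≤ d * a → #sparseCut d A i * n ≤ #sparseCut d A (2 + i) * p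
        ratio i i≤ = begin
          #sparseCut d A i * n ≤⟨ *-monoʳ-≤ (#sparseCut d A i) (≤-trans (≤-reflexive (sym (*-identityˡ n))) (*-mono-≤ factor₁ factor₂)) ⟩
          #sparseCut d A i * ((d * a ∸ i) * (d * cosize A ∸ i ∸ 2 * (d * d))) ≤⟨ switching-inequality d A i ⟩
          #sparseCut d A (2 + i) * ((2 + i) * (2 + i)) ≤⟨ *-monoʳ-≤ (#sparseCut d A (2 + i)) (*-mono-≤ i≤ i≤) ⟩
          #sparseCut d A (2 + i) * p ∎
          where
          factor₁ : 1 ≤ d * a ∸ i
          factor₁ = m+n≤o⇒m≤o∸n 1 (≤-trans (n≤1+n (suc i)) i≤)
          factor₂ : n ≤ d * cosize A ∸ i ∸ 2 * (d * d)
          -- As d ≥ 2, the outer degree sum is at least 2n - d a; one n is kept and the other covers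
          -- the lower-order terms.
          factor₂ = m+n≤o⇒m≤o∸n n (m+n≤o⇒m≤o∸n (n + 2 * (d * d)) (+-cancelʳ-≤ (d * a) _ _ (begin
            n + 2 * (d * d) + i + d * a         ≤⟨ +-mono-≤ (+-monoʳ-≤ (n + 2 * (d * d)) (≤-trans (m≤n+m i 2) (≤-trans i≤ (*-monoʳ-≤ d a≤V)))) (*-monoʳ-≤ d a≤V) ⟩
            n + 2 * (d * d) + d * V + d * V     ≡⟨ r₁ n (d * d) (d * V) ⟩
            n + (2 * (d * V) + 2 * (d * d))     ≤⟨ +-monoʳ-≤ n (≤-trans (m≤n+m _ (κ * W ^ V)) (≤-trans (m≤m+n _ 1) large)) ⟩
            n + n                               ≡⟨ cong (n +_) (+-identityʳ n) ⟨
            2 * n                               ≤⟨ *-monoˡ-≤ n (≤-trans (s≤s (s≤s z≤n)) 4≤d) ⟩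
            d * n                               ≡⟨ cong (d *_) (trans (sym (size+cosize A)) (+-comm a (cosize A))) ⟩
            d * (cosize A + a)                  ≡⟨ *-distribˡ-+ d (cosize A) a ⟩
            d * cosize A + d * a                ∎)))
            where
            r₁ : ∀ n D x → n + 2 * D + x + x ≡ n + (2 * x + 2 * D)
            r₁ = solve-∀
      E*n : E * n * n ^ a ≤ N * W ^ V * n ^ a
      E*n = begin
        E * n * n ^ a          ≡⟨ *-assoc E n (n ^ a) ⟩
        E * n ^ suc a          ≤⟨ classSum-bound _ a (n ^ suc a) (N * W ^ V) cut-bound ⟩
        (n C a) * (N * W ^ V)  ≤⟨ *-monoˡ-≤ (N * W ^ V) (C≤^ n a) ⟩
        n ^ a * (N * W ^ V)    ≡⟨ *-comm (n ^ a) _ ⟩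
        N * W ^ V * n ^ a      ∎

module _ (d c k m : ℕ) (1≤d : 1 ≤ d) (k-large : 15 * d ≤ 64 * (suc k * k)) (c-small : 2 * c + 4 * (suc k + 2) + 1 ≤ d) where

  -- The first summand supplies 4d² ≤ b for `Blocks` and lets a dominate the 2d² in `room`; the
  -- second is the threshold of `quadratic-absorbed` at Q = m.
  weakThreshold : ℕ
  weakThreshold = 4 * (d * d) + 3 * (21504 * m + 1)

  -- The factor (b/a)^a of the binomial cancels the (a/b)^a of the switchings, leaving 4^a (2/9)^a =
  -- (8/9)^a for all sets of size a together. The inverse (9/8)^a is then spent on the weight (a +
  -- 1)(a + 2)m.
  #weak-sum : ∀ n → S (allSubsets n) (#weak d c weakThreshold) * m ≤ numRegular d n
  #weak-sum n = union-bound (#weak d c weakThreshold) m N λ a → classSum-guard (isLarge weakThreshold n) (λ A → #sparseCut d A (c * size A + d * d)) a _ N (bound a)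
    where
    N : ℕ
    N = numRegular d n
    bound : ∀ a → isLarge weakThreshold n a ≡ true → classSum (λ A → #sparseCut d A (c * size A + d * d)) a * ((1 + a) * (2 + a) * m) ≤ N
    bound a large with ∧-split large
    ... | C≤ᵇa , 2a≤ᵇn = cancelʳ-≤ (8 ^ a) (m^n>0 8 a) (begin
      E * ((1 + a) * (2 + a) * m) * 8 ^ a    ≡⟨ *-assoc E _ (8 ^ a) ⟩
      E * ((1 + a) * (2 + a) * m * 8 ^ a)    ≡⟨ cong (λ x → E * (x * 8 ^ a)) (*-comm ((1 + a) * (2 + a)) m) ⟩
      E * (m * ((1 + a) * (2 + a)) * 8 ^ a)  ≤⟨ *-monoʳ-≤ E (quadratic-absorbed m a (≤-trans (m≤n+m _ (4 * (d * d))) C≤a)) ⟩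
      E * 9 ^ a                              ≤⟨ cancelʳ-≤ (b ^ a) (m^n>0 b {{>-nonZero (≤-trans 1≤a a≤b)}} a) E*9 ⟩
      N * 8 ^ a                              ∎)
      where
      C≤a : weakThreshold ≤ a
      C≤a = true-≤ᵇ weakThreshold a C≤ᵇa
      2a≤n : 2 * a ≤ n
      2a≤n = true-≤ᵇ (2 * a) n 2a≤ᵇn
      E b : ℕ
      E = classSum (λ A → #sparseCut d A (c * size A + d * d)) a
      b = n ∸ a
      4dd≤a : 4 * (d * d) ≤ a
      4dd≤a = ≤-trans (m≤m+n _ _) C≤a
      a≤b : a ≤ b
      a≤b = m+n≤o⇒m≤o∸n a (≤-trans (≤-reflexive (cong (a +_) (sym (+-identityʳ a)))) 2a≤n)
      1≤a : 1 ≤ a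
      1≤a = ≤-trans (*-mono-≤ {1} {4} (s≤s z≤n) (*-mono-≤ 1≤d 1≤d)) 4dd≤a
      a+b : a + b ≡ n
      a+b = m+[n∸m]≡n (≤-trans (m≤m+n a (a + 0)) 2a≤n)
      -- The `+ 1` in `c-small` is worth a further a, which pays for the d² in the cut.
      room : 2 * (c * a + d * d) + 4 * a * (suc k + 2) ≤ a * d
      room = begin
        2 * (c * a + d * d) + 4 * a * (suc k + 2)    ≡⟨ r₁ c a (d * d) k ⟩
        a * (2 * c + 4 * (suc k + 2)) + 2 * (d * d)  ≤⟨ +-monoʳ-≤ (a * (2 * c + 4 * (suc k + 2))) (≤-trans (*-monoˡ-≤ (d * d) (s≤s (s≤s (z≤n {2})))) 4dd≤a) ⟩
        a * (2 * c + 4 * (suc k + 2)) + a            ≡⟨ r₂ a (2 * c + 4 * (suc k + 2)) ⟩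
        a * (2 * c + 4 * (suc k + 2) + 1)            ≤⟨ *-monoʳ-≤ a c-small ⟩
        a * d                                        ∎
        where
        r₁ : ∀ c a D k → 2 * (c * a + D) + 4 * a * (suc k + 2) ≡ a * (2 * c + 4 * (suc k + 2)) + 2 * D
        r₁ = solve-∀
        r₂ : ∀ a x → a * x + a ≡ a * (x + 1)
        r₂ = solve-∀
      cut-bound : ∀ A → size A ≡ a → #sparseCut d A (c * size A + d * d) * (b ^ a * 9 ^ a) ≤ N * (a ^ a * 2 ^ a)
      cut-bound A refl = few-crossing k (c * a + d * d) k-large room
        where
        open Blocks (#sparseCut d A) N d a b 1≤a a≤b 1≤d (≤-trans 4dd≤a a≤b) (#sparseCut≤ d A)
          (λ t → subst (λ b → #sparseCut d A t * ((d * a ∸ t) * (d * b ∸ t ∸ 2 * (d * d))) ≤ #sparseCut d A (2 + t) * ((2 + t) * (2 + t)))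
            (cosize≡ A {size A} refl) (switching-inequality d A t))
      E*9 : E * 9 ^ a * b ^ a ≤ N * 8 ^ a * b ^ a
      E*9 = begin
        E * 9 ^ a * b ^ a               ≡⟨ r₁ E (9 ^ a) (b ^ a) ⟩
        E * (b ^ a * 9 ^ a)             ≤⟨ classSum-bound _ a (b ^ a * 9 ^ a) (N * (a ^ a * 2 ^ a)) cut-bound ⟩
        (n C a) * (N * (a ^ a * 2 ^ a)) ≡⟨ r₂ (n C a) N (a ^ a) (2 ^ a) ⟩
        N * 2 ^ a * ((n C a) * a ^ a)   ≤⟨ *-monoʳ-≤ (N * 2 ^ a) (subst (λ n → (n C a) * a ^ a ≤ 4 ^ a * b ^ a) a+b (C-upper′ a b a≤b)) ⟩
        N * 2 ^ a * (4 ^ a * b ^ a)     ≡⟨ r₃ N (2 ^ a) (4 ^ a) (b ^ a) ⟩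
        N * (2 ^ a * 4 ^ a) * b ^ a     ≡⟨ cong (λ x → N * x * b ^ a) (^-distrib-* 2 4 a) ⟨
        N * 8 ^ a * b ^ a               ∎
        where
        r₁ : ∀ e x y → e * x * y ≡ e * (y * x)
        r₁ = solve-∀
        r₂ : ∀ c N x y → c * (N * (x * y)) ≡ N * y * (c * x)
        r₂ = solve-∀
        r₃ : ∀ N x y z → N * x * (y * z) ≡ N * (x * y) * z
        r₃ = solve-∀

-- Double negation

¬¬-→ : ∀ {A B : Set} → (A → ¬ ¬ B) → ¬ ¬ (A → B)
¬¬-→ f k = k λ a → ⊥-elim (f a λ b → k λ _ → b)

¬¬-∀Fin : ∀ {n} {P : Fin n → Set} → (∀ i → ¬ ¬ P i) → ¬ ¬ (∀ i → P i)
¬¬-∀Fin {zero}  h k = k λ ()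
¬¬-∀Fin {suc n} h k = h zero λ p → ¬¬-∀Fin (λ i → h (suc i)) λ ps → k λ { zero → p ; (suc i) → ps i }

¬¬-∀Vec : ∀ {n} {P : Vec Bool n → Set} → (∀ v → ¬ ¬ P v) → ¬ ¬ (∀ v → P v)
¬¬-∀Vec {zero}  h k = h [] λ p → k λ { [] → p }
¬¬-∀Vec {suc n} h k = ¬¬-∀Vec (λ v → h (true ∷ v)) λ p → ¬¬-∀Vec (λ v → h (false ∷ v)) λ q →
  k λ { (true ∷ v) → p v ; (false ∷ v) → q v }

-- Excluded middle is used once per index, under the double negation. This yields the set of
-- reachable vertices as a Boolean vector without a decision procedure for `Reach`.
¬¬-comprehension : ∀ {n} (P : Fin n → Set) →
  ¬ ¬ Σ (Vec Bool n) λ A → ∀ w → (lookup A w ≡ true → P w) × (P w → lookup A w ≡ true)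
¬¬-comprehension {zero}  P k = k ([] , λ ())
¬¬-comprehension {suc n} P k = ¬¬-comprehension (λ i → P (suc i)) λ { (A , h) →
  (λ ¬p → k (false ∷ A , λ { zero → (λ ()) , (λ p → contradiction p ¬p) ; (suc i) → h i }))
  (λ p → k (true ∷ A , λ { zero → (λ _ → p) , (λ _ → refl) ; (suc i) → h i })) }

¬¬-least : ∀ (P : ℕ → Set) r → P r → ¬ ¬ Σ ℕ λ m → P m × (∀ m′ → P m′ → m ≤ m′)
¬¬-least P r p k = go r r ≤-refl p
  where
  go : ∀ b r → r ≤ b → P r → ⊥
  go zero    r r≤ p = k (r , p , λ m′ _ → ≤-trans r≤ z≤n)
  go (suc b) r r≤ p = k (r , p , λ m′ p′ → ≮⇒≥ λ m′<r → go b m′ (≤-pred (≤-trans m′<r r≤)) p′)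

-- Subgraphs

deg≤maxDeg : ∀ {n} (G : Adj n) i → deg G i ≤ maxDeg G
deg≤maxDeg G i = rows G i
  where
  rows : ∀ {n m} (A : Vec (Vec Bool n) m) i → trues (lookup A i) ≤ foldr _⊔_ 0 (toList (mapⱽ trues A))
  rows (r ∷ A) zero    = m≤m⊔n _ _
  rows (r ∷ A) (suc i) = ≤-trans (rows A i) (m≤n⊔m (trues r) _)

maxDeg≤ : ∀ {n} (G : Adj n) {r} → (∀ i → deg G i ≤ r) → maxDeg G ≤ r
maxDeg≤ G h = rows G h
  where
  rows : ∀ {n m} (A : Vec (Vec Bool n) m) {r} → (∀ i → trues (lookup A i) ≤ r) → foldr _⊔_ 0 (toList (mapⱽ trues A)) ≤ r
  rows []      h = z≤n
  rows (r ∷ A) h = ⊔-lub (h zero) (rows A (λ i → h (suc i)))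

edge-− : ∀ {n} (G H : Adj n) i j → edge (G −G H) i j ≡ edge G i j ∧ not (edge H i j)
edge-− G H i j = trans (cong (λ r → lookup r j) (lookup-zipWith (zipWith λ a b → a ∧ not b) i G H))
  (lookup-zipWith (λ a b → a ∧ not b) j (lookup G i) (lookup H i))

matrix : ∀ {n} → (Fin n → Fin n → Bool) → Adj n
matrix f = tabulate λ i → tabulate (f i)

edge-matrix : ∀ {n} (f : Fin n → Fin n → Bool) i j → edge (matrix f) i j ≡ f i j
edge-matrix f i j = trans (cong (λ r → lookup r j) (lookup∘tabulate (λ i → tabulate (f i)) i)) (lookup∘tabulate (f i) j)

firstTrues : ∀ {n} → ℕ → Vec Bool n → Vec Bool n
firstTrues t       []          = []
firstTrues zero    (_ ∷ v)     = false ∷ firstTrues zero v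
firstTrues (suc t) (true ∷ v)  = true ∷ firstTrues t v
firstTrues (suc t) (false ∷ v) = false ∷ firstTrues (suc t) v

trues-firstTrues : ∀ {n} t (v : Vec Bool n) → t ≤ trues v → trues (firstTrues t v) ≡ t
trues-firstTrues zero    []          h = refl
trues-firstTrues zero    (b ∷ v)     h = trues-firstTrues zero v z≤n
trues-firstTrues (suc t) (true ∷ v)  (s≤s h) = cong suc (trues-firstTrues t v h)
trues-firstTrues (suc t) (false ∷ v) h = trues-firstTrues (suc t) v h

firstTrues-⊆ : ∀ {n} t (v : Vec Bool n) j → lookup (firstTrues t v) j ≡ true → lookup v j ≡ true
firstTrues-⊆ zero    (b ∷ v)     (suc j) h = firstTrues-⊆ zero v j h
firstTrues-⊆ (suc t) (true ∷ v)  zero    h = refl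
firstTrues-⊆ (suc t) (true ∷ v)  (suc j) h = firstTrues-⊆ t v j h
firstTrues-⊆ (suc t) (false ∷ v) (suc j) h = firstTrues-⊆ (suc t) v j h

∣∣≡trues : ∀ {n} (S : Vec Bool n) → ∣ S ∣ ≡ trues S
∣∣≡trues []          = refl
∣∣≡trues (true ∷ S)  = cong suc (∣∣≡trues S)
∣∣≡trues (false ∷ S) = ∣∣≡trues S

∣∣≡size : ∀ {n} (S : Vec Bool n) → ∣ S ∣ ≡ size S
∣∣≡size S = trans (∣∣≡trues S) (trues≡∑ S)

∉⇒false : ∀ {n} {S : Subset n} {i} → i ∉ S → lookup S i ≡ false
∉⇒false {S = S} {i} h with lookup S i in eq
... | false = refl
... | true  = contradiction (lookup⇒[]= i S eq) h

false⇒∉ : ∀ {n} {S : Subset n} {i} → lookup S i ≡ false → i ∉ S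
false⇒∉ h i∈ with trans (sym h) ([]=⇒lookup i∈)
... | ()

≢true⇒false : ∀ {b} → b ≢ true → b ≡ false
≢true⇒false {true}  h = contradiction refl h
≢true⇒false {false} h = refl

true≢false : ∀ {b} → b ≡ true → b ≡ false → ⊥
true≢false refl ()

-- Isolating a vertex

-- With d - k + 1 of its edges deleted, `v` keeps k - 1 neighbours, and these are the cutset. Every
-- other vertex loses at most one edge, so `v` determines the maximum degree.
module Star {d n} (G : Adj n) (g : IsGraph G) (dg : ∀ i → deg G i ≡ d) (v : Fin n)
  (k : ℕ) (1≤k : 1 ≤ k) (k≤d : k ≤ d) (d<n : d < n) where

  t : ℕ
  t = d ∸ k + 1

  R : Vec Bool n
  R = firstTrues t (lookup G v)

  t≤d : t ≤ d
  t≤d = begin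
    d ∸ k + 1 ≤⟨ +-monoʳ-≤ (d ∸ k) 1≤k ⟩
    d ∸ k + k ≡⟨ m∸n+n≡m k≤d ⟩
    d         ∎

  R-true : ∀ j → lookup R j ≡ true → edge G v j ≡ true
  R-true = firstTrues-⊆ t (lookup G v)

  Rv : lookup R v ≡ false
  Rv = ≢true⇒false λ h → true≢false (R-true v h) (proj₂ g v)

  f : Fin n → Fin n → Bool
  f i j = ((i == v) ∧ lookup R j) ∨ ((j == v) ∧ lookup R i)

  H : Adj n
  H = matrix f

  H-graph : IsGraph H
  H-graph = (λ i j → trans (edge-matrix f i j) (trans (Bool.∨-comm ((i == v) ∧ lookup R j) _) (sym (edge-matrix f j i)))) ,
    λ i → trans (edge-matrix f i i) (diagonal i)
    where
    diagonal : ∀ i → f i i ≡ false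
    diagonal i = ≢true⇒false λ h → case (∨-split {(i == v) ∧ lookup R i} h)
      where
      loop : (i == v) ∧ lookup R i ≡ true → ⊥
      loop h with ∧-split {i == v} h
      ... | p , q with ==⇒≡ i v p
      ...   | refl = true≢false q Rv
      case : ((i == v) ∧ lookup R i ≡ true) ⊎ ((i == v) ∧ lookup R i ≡ true) → ⊥
      case (inj₁ h) = loop h
      case (inj₂ h) = loop h

  H⊆G : H ⊆G G
  H⊆G = H-graph , λ i j h → sub i j (∨-split {(i == v) ∧ lookup R j} (trans (sym (edge-matrix f i j)) h))
    where
    sub : ∀ i j → ((i == v) ∧ lookup R j ≡ true) ⊎ ((j == v) ∧ lookup R i ≡ true) → edge G i j ≡ true
    sub i j (inj₁ h) with ∧-split {i == v} h
    ... | p , q with ==⇒≡ i v p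
    ...   | refl = R-true j q
    sub i j (inj₂ h) with ∧-split {j == v} h
    ... | p , q with ==⇒≡ j v p
    ...   | refl = trans (proj₁ g i j) (R-true i q)

  edge-v : ∀ j → edge H v j ≡ lookup R j
  edge-v j = trans (edge-matrix f v j) (center j)
    where
    center : ∀ j → f v j ≡ lookup R j
    center j rewrite ==-refl v | Rv with lookup R j
    ... | true  = refl
    ... | false = Bool.∧-zeroʳ (j == v)

  deg-v : deg H v ≡ t
  deg-v = trans (deg≡∑ H v) (trans (∑-cong λ j → cong 𝟙 (edge-v j))
    (trans (sym (trues≡∑ R)) (trues-firstTrues t (lookup G v) (≤-trans t≤d (≤-reflexive (sym (dg v)))))))

  maxDeg-H : maxDeg H ≡ t
  maxDeg-H = ≤-antisym (maxDeg≤ H bound) (≤-trans (≤-reflexive (sym deg-v)) (deg≤maxDeg H v))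
    where
    leaf : ∀ i → i ≢ v → ∀ j → 𝟙 (edge H i j) ≤ 𝟙 (j == v) * 1
    leaf i i≢v j rewrite edge-matrix f i j | ≢⇒== i≢v with j == v
    ... | true  = 𝟙≤1 (lookup R i)
    ... | false = z≤n
    bound : ∀ i → deg H i ≤ t
    bound i with i Fin.≟ v
    ... | yes refl = ≤-reflexive deg-v
    ... | no i≢v   = begin
      deg H i                    ≡⟨ deg≡∑ H i ⟩
      ∑ (λ j → 𝟙 (edge H i j))   ≤⟨ ∑-mono (leaf i i≢v) ⟩
      ∑ (λ j → 𝟙 (j == v) * 1)   ≡⟨ ∑-pick v (λ _ → 1) ⟩
      1                          ≤⟨ m≤n+m 1 (d ∸ k) ⟩
      t                          ∎

  cutset : Subset n
  cutset = lookup (G −G H) v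

  cutset-size : size cutset + t ≡ d
  cutset-size = begin-equality
    ∑ (inside cutset) + t                           ≡⟨ cong (∑ (inside cutset) +_) (trans (sym deg-v) (deg≡∑ H v)) ⟩
    ∑ (inside cutset) + ∑ (λ j → 𝟙 (edge H v j))    ≡⟨ ∑-+ _ _ ⟨
    ∑ (λ j → inside cutset j + 𝟙 (edge H v j))      ≡⟨ ∑-cong pointwise ⟩
    ∑ (λ j → 𝟙 (edge G v j))                        ≡⟨ deg≡∑ G v ⟨
    deg G v                                         ≡⟨ dg v ⟩
    d                                               ∎
    where
    split : ∀ a b → (b ≡ true → a ≡ true) → 𝟙 (a ∧ not b) + 𝟙 b ≡ 𝟙 a
    split true  true  h = refl
    split true  false h = refl
    split false true  h = contradiction (h refl) λ ()
    split false false h = refl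
    pointwise : ∀ j → inside cutset j + 𝟙 (edge H v j) ≡ 𝟙 (edge G v j)
    pointwise j = trans (cong (λ b → 𝟙 b + 𝟙 (edge H v j)) (edge-− G H v j))
      (split (edge G v j) (edge H v j) (proj₂ H⊆G v j))

  cutset<k : suc (size cutset) ≤ k
  cutset<k = +-cancelʳ-≤ (d ∸ k) _ _ (≤-reflexive (begin-equality
    suc (size cutset) + (d ∸ k)   ≡⟨ r₁ (size cutset) (d ∸ k) ⟩
    size cutset + (d ∸ k + 1)     ≡⟨ cutset-size ⟩
    d                             ≡⟨ m+[n∸m]≡n k≤d ⟨
    k + (d ∸ k)                   ∎))
    where
    r₁ : ∀ s x → suc s + x ≡ s + (x + 1)
    r₁ = solve-∀

  v∉cutset : lookup cutset v ≡ false
  v∉cutset = trans (edge-− G H v v) (cong (_∧ not (edge H v v)) (proj₂ g v))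

  -- The cutset and `v` make up at most k ≤ d < n vertices, so something is left to be separated
  -- from `v`.
  other : ∃ λ w → w ≢ v × lookup cutset w ≡ false
  other = find (∑-positive outsideOf (+-cancelʳ-≤ (size cutset + 1) 1 _ (begin
      1 + (size cutset + 1)                    ≡⟨ cong suc (+-comm (size cutset) 1) ⟩
      suc (suc (size cutset))                  ≤⟨ s≤s (≤-trans cutset<k k≤d) ⟩
      suc d                                    ≤⟨ d<n ⟩
      n                                        ≡⟨ *-identityʳ n ⟨
      n * 1                                    ≡⟨ ∑-const n 1 ⟨
      ∑ {n} (λ _ → 1)                          ≤⟨ ∑-mono cover ⟩
      ∑ (λ j → outsideOf j + (inside cutset j + 𝟙 (j == v) * 1)) ≡⟨ trans (∑-+ outsideOf _) (cong (∑ outsideOf +_) (trans (∑-+ (inside cutset) _) (cong (size cutset +_) (∑-pick v (λ _ → 1))))) ⟩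
      ∑ outsideOf + (size cutset + 1)          ∎)))
    where
    outsideOf : Fin n → ℕ
    outsideOf j = 𝟙 (not (lookup cutset j) ∧ not (j == v))
    cover : ∀ j → 1 ≤ outsideOf j + (inside cutset j + 𝟙 (j == v) * 1)
    cover j with lookup cutset j | j == v
    ... | true  | true  = s≤s z≤n
    ... | true  | false = s≤s z≤n
    ... | false | true  = s≤s z≤n
    ... | false | false = s≤s z≤n
    find : ∃ (λ j → 1 ≤ outsideOf j) → ∃ λ w → w ≢ v × lookup cutset w ≡ false
    find (j , h) with not (lookup cutset j) ∧ not (j == v) in eq
    ... | true with ∧-split {not (lookup cutset j)} eq
    ...   | p , q = j , (λ { refl → true≢false (==-refl j) (not-true q) }) , not-true p

  trapped : ∀ {w} → Reach (G −G H) cutset v w → w ≡ v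
  trapped here = refl
  trapped (step {w} {w′} r e w∉) with trapped r
  ... | refl = ⊥-elim (true≢false e (∉⇒false {S = cutset} w∉))

  ¬kConn : ¬ KConn k (G −G H)
  ¬kConn conn with other
  ... | w , w≢v , w∉ = w≢v (trapped (conn cutset (≤-trans (≤-reflexive (cong suc (∣∣≡size cutset))) cutset<k) v w
    (false⇒∉ {S = cutset} v∉cutset) (false⇒∉ {S = cutset} w∉)))

-- Cutting along a vertex partition

module Cut {n} (G : Adj n) (g : IsGraph G) (P : Vec Bool n) where

  f : Fin n → Fin n → Bool
  f i j = edge G i j ∧ (lookup P i xor lookup P j)

  H : Adj n
  H = matrix f

  H⊆G : H ⊆G G
  H⊆G = ((λ i j → trans (edge-matrix f i j) (trans (cong₂ _∧_ (proj₁ g i j) (Bool.xor-comm (lookup P i) (lookup P j))) (sym (edge-matrix f j i)))) ,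
      λ i → trans (edge-matrix f i i) (cong (_∧ (lookup P i xor lookup P i)) (proj₂ g i))) ,
    λ i j h → proj₁ (∧-split (trans (sym (edge-matrix f i j)) h))

  stays : ∀ {u w} → lookup P u ≡ true → Reach (G −G H) ∅ u w → lookup P w ≡ true
  stays pu here = pu
  stays pu (step {w} {w′} r e _) with stays pu r | trans (sym (edge-− G H w w′)) e
  ... | pw | h = same (lookup P w′) pw (subst (λ b → edge G w w′ ∧ not b ≡ true) (edge-matrix f w w′) h)
    where
    same : ∀ b → lookup P w ≡ true → edge G w w′ ∧ not (edge G w w′ ∧ (lookup P w xor b)) ≡ true → b ≡ true
    same true  _  _ = refl
    same false pw h rewrite pw with edge G w w′
    same false pw () | true
    same false pw () | false

  -- The empty set already separates `u` from `w`, so one deletion defeats every k ≥ 1.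
  ¬kConn : ∀ {u w} k → 1 ≤ k → lookup P u ≡ true → lookup P w ≡ false → ¬ KConn k (G −G H)
  ¬kConn {u} {w} k 1≤k pu pw conn = true≢false (stays pu (conn ∅ (≤-trans (≤-reflexive (cong suc (∣⊥∣≡0 n))) 1≤k) u w ∉⊥ ∉⊥)) pw

-- Stiebitz's theorem on internal partitions, for regular graphs

module Stiebitz {n d} (G : Adj n) (g : IsGraph G) (dg : ∀ i → deg G i ≡ d) (q : ℕ) (q-small : suc (q + q) ≤ d) (v₀ : Fin n) where

  VSet : Set
  VSet = Fin n → Bool

  e : Fin n → Fin n → ℕ
  e i j = 𝟙 (edge G i j)

  nbr : VSet → Fin n → ℕ
  nbr A x = ∑ λ j → 𝟙 (A j) * e x j

  Nonempty : VSet → Set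
  Nonempty A = ∃ λ x → A x ≡ true

  Internal : ℕ → VSet → Set
  Internal r A = ∀ x → A x ≡ true → r ≤ nbr A x

  _⊑_ : VSet → VSet → Set
  A ⊑ B = ∀ x → A x ≡ true → B x ≡ true

  Disjoint : VSet → VSet → Set
  Disjoint A B = ∀ x → A x ≡ true → B x ≡ true → ⊥

  -- The surplus of one over q is a reserve: it lets a set lose any one vertex and remain
  -- q-internal.
  HasStrong : VSet → Set
  HasStrong A = Σ VSet λ X → Nonempty X × X ⊑ A × Internal (suc q) X

  Feasible : Set
  Feasible = Σ VSet λ A → Σ VSet λ B → Nonempty A × Nonempty B × Disjoint A B × Internal q A × Internal q B

  insert remove : VSet → Fin n → VSet
  insert A x i = A i ∨ (i == x)
  remove A x i = A i ∧ not (i == x)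

  ⊑-insert : ∀ A x → A ⊑ insert A x
  ⊑-insert A x i h = cong (_∨ (i == x)) h

  remove-⊑ : ∀ A x → remove A x ⊑ A
  remove-⊑ A x i h = proj₁ (∧-split h)

  remove-≢ : ∀ A x {i} → remove A x i ≡ true → i ≢ x
  remove-≢ A x {i} h refl = true≢false (==-refl i) (not-true (proj₂ (∧-split {A i} h)))

  nbr-mono : ∀ {A B} → A ⊑ B → ∀ x → nbr A x ≤ nbr B x
  nbr-mono {A} {B} h x = ∑-mono λ j → *-monoˡ-≤ (e x j) (𝟙-mono (A j) (B j) (h j))

  nbr-complement : ∀ A x → nbr A x + nbr (not ∘ A) x ≡ d
  nbr-complement A x = begin-equality
    nbr A x + nbr (not ∘ A) x                      ≡⟨ ∑-+ _ _ ⟨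
    ∑ (λ j → 𝟙 (A j) * e x j + 𝟙 (not (A j)) * e x j) ≡⟨ ∑-cong (λ j → trans (sym (*-distribʳ-+ (e x j) (𝟙 (A j)) _)) (trans (cong (_* e x j) (𝟙-not (A j))) (*-identityˡ (e x j)))) ⟩
    ∑ (e x)                                        ≡⟨ deg≡∑ G x ⟨
    deg G x                                        ≡⟨ dg x ⟩
    d                                              ∎

  nbr-remove : ∀ A x z → nbr A z ≤ suc (nbr (remove A x) z)
  nbr-remove A x z = begin
    nbr A z                                                       ≤⟨ ∑-mono pointwise ⟩
    ∑ (λ j → 𝟙 (j == x) * 1 + 𝟙 (remove A x j) * e z j)           ≡⟨ ∑-+ _ _ ⟩
    ∑ (λ j → 𝟙 (j == x) * 1) + nbr (remove A x) z                 ≡⟨ cong (_+ nbr (remove A x) z) (∑-pick x (λ _ → 1)) ⟩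
    suc (nbr (remove A x) z)                                      ∎
    where
    pointwise : ∀ j → 𝟙 (A j) * e z j ≤ 𝟙 (j == x) * 1 + 𝟙 (remove A x j) * e z j
    pointwise j with A j | j == x
    ... | false | _     = z≤n
    ... | true  | true  = ≤-trans (≤-reflexive (*-identityˡ (e z j))) (≤-trans (𝟙≤1 (edge G z j)) (s≤s z≤n))
    ... | true  | false = ≤-refl

  -- Nonemptiness is at stake only if `x` is the known element; that vertex has a neighbour in `X`,
  -- different from it since there are no loops.
  remove-strong : ∀ X x → Nonempty X → Internal (suc q) X → Nonempty (remove X x) × Internal q (remove X x)
  remove-strong X x (z , cz) int = ne , λ w h → ≤-pred (≤-trans (int w (remove-⊑ X x w h)) (nbr-remove X x w))
    where
    keep : ∀ w → X w ≡ true → w ≢ x → Nonempty (remove X x)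
    keep w cw w≢x = w , ∧-join cw (cong not (≢⇒== w≢x))
    ne : Nonempty (remove X x)
    ne with z Fin.≟ x
    ... | no z≢x = keep z cz z≢x
    ... | yes refl with ∑-positive (λ j → 𝟙 (X j) * e z j) (≤-trans (s≤s z≤n) (int z cz))
    ...   | j , p with X j in cj | edge G z j in ej
    ...     | true  | true  = keep j cj λ { refl → edge⇒≢ G g ej refl }
    ...     | true  | false = contradiction p λ ()
    ...     | false | _     = contradiction p λ ()

  card : VSet → ℕ
  card A = ∑ λ i → 𝟙 (A i)

  card≤n : ∀ A → card A ≤ n
  card≤n A = ≤-trans (∑-mono λ i → 𝟙≤1 (A i)) (≤-reflexive (trans (∑-const n 1) (*-identityʳ n)))

  card-insert : ∀ A x → A x ≡ false → card (insert A x) ≡ suc (card A)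
  card-insert A x h = begin-equality
    card (insert A x)                    ≡⟨ ∑-cong pointwise ⟩
    ∑ (λ i → 𝟙 (i == x) * 1 + 𝟙 (A i))   ≡⟨ ∑-+ _ _ ⟩
    ∑ (λ i → 𝟙 (i == x) * 1) + card A    ≡⟨ cong (_+ card A) (∑-pick x (λ _ → 1)) ⟩
    suc (card A)                         ∎
    where
    pointwise : ∀ i → 𝟙 (insert A x i) ≡ 𝟙 (i == x) * 1 + 𝟙 (A i)
    pointwise i with i == x in eq
    ... | true rewrite ==⇒≡ i x eq | h = refl
    ... | false = cong 𝟙 (Bool.∨-identityʳ (A i))

  card-remove : ∀ A x → A x ≡ true → suc (card (remove A x)) ≡ card A
  card-remove A x h = begin-equality
    suc (card (remove A x))                      ≡⟨ cong (_+ card (remove A x)) (∑-pick x (λ _ → 1)) ⟨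
    ∑ (λ i → 𝟙 (i == x) * 1) + card (remove A x) ≡⟨ ∑-+ _ _ ⟨
    ∑ (λ i → 𝟙 (i == x) * 1 + 𝟙 (remove A x i))  ≡⟨ ∑-cong pointwise ⟨
    card A                                       ∎
    where
    pointwise : ∀ i → 𝟙 (A i) ≡ 𝟙 (i == x) * 1 + 𝟙 (remove A x i)
    pointwise i with i == x in eq
    ... | true rewrite ==⇒≡ i x eq | h = refl
    ... | false = cong 𝟙 (sym (Bool.∧-identityʳ (A i)))

  card-mono : ∀ {A B} → A ⊑ B → card A ≤ card B
  card-mono {A} {B} h = ∑-mono λ i → 𝟙-mono (A i) (B i) (h i)

  Partition : Set
  Partition = Σ VSet λ P → Nonempty P × Nonempty (not ∘ P) × Internal q P × Internal q (not ∘ P)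

  -- Grow the first part as long as some vertex has q neighbours in it.
  feasible⇒partition : Feasible → Partition
  feasible⇒partition (A , B , neA , neB , dis , intA , intB) = grow n A (m≤m+n n (card A)) neA dis intA
    where
    grow : ∀ fuel A → n ≤ fuel + card A → Nonempty A → Disjoint A B → Internal q A → Partition
    grow fuel A n≤ neA dis intA with Fin.any? (λ x → (A x Bool.≟ false) ×-dec ((B x Bool.≟ false) ×-dec (q ≤? nbr A x)))
    ... | no none = A , neA , (proj₁ neB , cong not (outsideA (proj₁ neB) (proj₂ neB))) , intA , complement
      where
      outsideA : ∀ x → B x ≡ true → A x ≡ false
      outsideA x bx = ≢true⇒false λ ax → dis x ax bx
      complement : Internal q (not ∘ A)
      complement x h with B x Bool.≟ true
      ... | yes bx = ≤-trans (intB x bx) (nbr-mono (λ y by → cong not (outsideA y by)) x)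
      ... | no ¬bx = +-cancelˡ-≤ (suc q) _ _ (begin
        suc q + q                   ≤⟨ q-small ⟩
        d                           ≡⟨ nbr-complement A x ⟨
        nbr A x + nbr (not ∘ A) x   ≤⟨ +-monoˡ-≤ _ (<⇒≤ (≰⇒> λ q≤ → none (x , not-true h , ≢true⇒false ¬bx , q≤))) ⟩
        q + nbr (not ∘ A) x         ≤⟨ n≤1+n _ ⟩
        suc q + nbr (not ∘ A) x     ∎)
    grow zero A n≤ neA dis intA | yes (x , ax , bx , q≤) = ⊥-elim (<-irrefl refl (≤-trans (≤-reflexive (sym (card-insert A x ax))) (≤-trans (card≤n (insert A x)) n≤)))
    grow (suc fuel) A n≤ neA dis intA | yes (x , ax , bx , q≤) = grow fuel (insert A x)
      (≤-trans n≤ (≤-reflexive (trans (sym (+-suc fuel (card A))) (cong (fuel +_) (sym (card-insert A x ax))))))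
      (proj₁ neA , ⊑-insert A x _ (proj₂ neA))
      (λ y h by → dis′ y (∨-split h) by)
      (λ y h → int′ y (∨-split h))
      where
      dis′ : ∀ y → (A y ≡ true) ⊎ ((y == x) ≡ true) → B y ≡ true → ⊥
      dis′ y (inj₁ ay) by = dis y ay by
      dis′ y (inj₂ y≡) by with ==⇒≡ y x y≡
      ... | refl = true≢false by bx
      int′ : ∀ y → (A y ≡ true) ⊎ ((y == x) ≡ true) → q ≤ nbr (insert A x) y
      int′ y (inj₁ ay) = ≤-trans (intA y ay) (nbr-mono (⊑-insert A x) y)
      int′ y (inj₂ y≡) with ==⇒≡ y x y≡
      ... | refl = ≤-trans q≤ (nbr-mono (⊑-insert A x) y)

  cut : VSet → VSet → ℕ
  cut A B = ∑∑ λ i j → 𝟙 (A i) * 𝟙 (B j) * e i j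

  cut-comm : ∀ A B → cut A B ≡ cut B A
  cut-comm A B = trans (∑∑-swap _) (∑∑-cong λ i j → trans (cong (λ b → 𝟙 (A j) * 𝟙 (B i) * 𝟙 b) (proj₁ g j i)) (cong (_* e i j) (*-comm (𝟙 (A j)) (𝟙 (B i)))))

  Complementary : VSet → VSet → Set
  Complementary A B = ∀ i → B i ≡ not (A i)

  complementary-sym : ∀ {A B} → Complementary A B → Complementary B A
  complementary-sym {A} h i = trans (sym (Bool.not-involutive (A i))) (cong not (sym (h i)))

  complementary-move : ∀ {A B} x → Complementary A B → Complementary (remove A x) (insert B x)
  complementary-move {A} {B} x h i rewrite h i with A i | i == x
  ... | true  | true  = refl
  ... | true  | false = refl
  ... | false | true  = refl
  ... | false | false = refl

  -- Only pairs involving `x` change: its edges to `B` leave the cut and its edges to `A` enter. The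
  -- comparison is made pair by pair, with the terms of `x` as corrections.
  cut-move : ∀ {A B} x → A x ≡ true → B x ≡ false → cut (remove A x) (insert B x) + nbr B x ≤ cut A B + nbr A x
  cut-move {A} {B} x ax bx = begin
    cut (remove A x) (insert B x) + nbr B x
      ≡⟨ cong (cut (remove A x) (insert B x) +_) (trans (sym (∑-pick x (nbr B))) (∑-cong λ i → sym (∑-scaleˡ (𝟙 (i == x)) _))) ⟩
    cut (remove A x) (insert B x) + ∑∑ (λ i j → 𝟙 (i == x) * (𝟙 (B j) * e i j)) ≡⟨ ∑∑-+ _ _ ⟨
    ∑∑ (λ i j → 𝟙 (remove A x i) * 𝟙 (insert B x j) * e i j + 𝟙 (i == x) * (𝟙 (B j) * e i j)) ≤⟨ ∑∑-mono pointwise ⟩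
    ∑∑ (λ i j → 𝟙 (A i) * 𝟙 (B j) * e i j + 𝟙 (j == x) * (𝟙 (A i) * e j i)) ≡⟨ ∑∑-+ _ _ ⟩
    cut A B + ∑∑ (λ i j → 𝟙 (j == x) * (𝟙 (A i) * e j i))
      ≡⟨ cong (cut A B +_) (trans (∑∑-swap _) (trans (∑-cong λ j → ∑-scaleˡ (𝟙 (j == x)) _) (∑-pick x (nbr A)))) ⟩
    cut A B + nbr A x ∎
    where
    table : ∀ a b p r k → (p ≡ true → a ≡ true) → (r ≡ true → b ≡ false) →
      𝟙 (a ∧ not p) * 𝟙 (b ∨ r) * k + 𝟙 p * (𝟙 b * k) ≤ 𝟙 a * 𝟙 b * k + 𝟙 r * (𝟙 a * k)
    table a     b     true  r     k h₁ h₂ rewrite h₁ refl = ≤-trans (≤-reflexive (sym (*-assoc 1 (𝟙 b) k))) (m≤m+n (1 * 𝟙 b * k) _)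
    table true  true  false true  k h₁ h₂ = contradiction (h₂ refl) λ ()
    table true  true  false false k h₁ h₂ = ≤-refl
    table true  false false true  k h₁ h₂ = ≤-reflexive (r₁ k)
      where
      r₁ : ∀ k → k + 0 + 0 ≡ k + 0 + 0
      r₁ = solve-∀
    table true  false false false k h₁ h₂ = z≤n
    table false b     false r     k h₁ h₂ = z≤n
    pointwise : ∀ i j → 𝟙 (remove A x i) * 𝟙 (insert B x j) * e i j + 𝟙 (i == x) * (𝟙 (B j) * e i j) ≤ 𝟙 (A i) * 𝟙 (B j) * e i j + 𝟙 (j == x) * (𝟙 (A i) * e j i)
    pointwise i j = ≤-trans (table (A i) (B j) (i == x) (j == x) (e i j)
        (λ h → trans (cong A (==⇒≡ i x h)) ax) (λ h → trans (cong B (==⇒≡ j x h)) bx))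
      (≤-reflexive (cong (λ b → 𝟙 (A i) * 𝟙 (B j) * e i j + 𝟙 (j == x) * (𝟙 (A i) * 𝟙 b)) (proj₁ g i j)))

  strong-⊑ : ∀ {A B} → A ⊑ B → HasStrong A → HasStrong B
  strong-⊑ h (X , ne , C⊑ , int) = X , ne , (λ x cx → h x (C⊑ x cx)) , int

  -- Otherwise `A` would be strong itself, or empty; in the latter case `B` is the whole vertex set,
  -- which is strong because d ≥ q + 1.
  loose-vertex : ∀ A B → Complementary A B → ¬ HasStrong A → ¬ HasStrong B → ∃ λ x → A x ≡ true × nbr A x ≤ q
  loose-vertex A B comp ¬sA ¬sB with Fin.any? (λ x → (A x Bool.≟ true) ×-dec (nbr A x ≤? q))
  ... | yes (x , p) = x , p
  ... | no none with Fin.any? (λ x → A x Bool.≟ true)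
  ...   | yes ne = ⊥-elim (¬sA (A , ne , (λ _ h → h) , λ x ax → ≰⇒> λ le → none (x , ax , le)))
  ...   | no empty = ⊥-elim (¬sB (B , (v₀ , allB v₀) , (λ _ h → h) , λ x _ → everything x))
    where
    allB : ∀ x → B x ≡ true
    allB x = trans (comp x) (cong not (≢true⇒false λ ax → empty (x , ax)))
    everything : ∀ x → suc q ≤ nbr B x
    everything x = begin
      suc q             ≤⟨ s≤s (m≤m+n q q) ⟩
      suc (q + q)       ≤⟨ q-small ⟩
      d                 ≡⟨ dg x ⟨
      deg G x           ≡⟨ deg≡∑ G x ⟩
      ∑ (e x)           ≡⟨ ∑-cong (λ j → trans (sym (*-identityˡ (e x j))) (cong (λ b → 𝟙 b * e x j) (sym (allB j)))) ⟩
      nbr B x           ∎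

  -- Of the d ≥ 2q + 1 edges at `x` at most q go to `A`, so at least q + 1 leave the cut and at most
  -- q enter it.
  cut-decreases : ∀ {A B} x → Complementary A B → A x ≡ true → nbr A x ≤ q → suc (cut (remove A x) (insert B x)) ≤ cut A B
  cut-decreases {A} {B} x comp ax loose = +-cancelʳ-≤ q _ _ (begin
    suc (cut A′ B′) + q       ≡⟨ +-suc (cut A′ B′) q ⟨
    cut A′ B′ + suc q         ≤⟨ +-monoʳ-≤ (cut A′ B′) tight ⟩
    cut A′ B′ + nbr B x       ≤⟨ cut-move {A} {B} x ax (trans (comp x) (cong not ax)) ⟩
    cut A B + nbr A x         ≤⟨ +-monoʳ-≤ (cut A B) loose ⟩
    cut A B + q               ∎)
    where
    A′ B′ : VSet
    A′ = remove A x
    B′ = insert B x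
    tight : suc q ≤ nbr B x
    tight = +-cancelˡ-≤ q _ _ (begin
      q + suc q                   ≡⟨ +-suc q q ⟩
      suc (q + q)                 ≤⟨ q-small ⟩
      d                           ≡⟨ nbr-complement A x ⟨
      nbr A x + nbr (not ∘ A) x   ≤⟨ +-monoˡ-≤ _ loose ⟩
      q + nbr (not ∘ A) x         ≡⟨ cong (q +_) (∑-cong λ j → cong (λ b → 𝟙 b * e x j) (comp j)) ⟨
      q + nbr B x                 ∎)

  -- Among partitions without strong subset on either side, moving a loose vertex lowers the cut;
  -- if both such moves create strong subsets X and D, these become feasible after deleting the moved vertices.
  noStrong⇒¬infeasible : ¬ Feasible → ∀ fuel A B → cut A B ≤ fuel → Complementary A B → ¬ HasStrong A → ¬ HasStrong B → ⊥
  noStrong⇒¬infeasible infeasible fuel A B cut≤ comp ¬sA ¬sB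
    with loose-vertex A B comp ¬sA ¬sB | loose-vertex B A (complementary-sym comp) ¬sB ¬sA
  ... | x , ax , loose-x | y , by , loose-y = descend fuel cut≤
    where
    moved-x : suc (cut (remove A x) (insert B x)) ≤ cut A B
    moved-x = cut-decreases x comp ax loose-x
    moved-y : suc (cut (remove B y) (insert A y)) ≤ cut A B
    moved-y = ≤-trans (cut-decreases y (complementary-sym comp) by loose-y) (≤-reflexive (cut-comm B A))
    feasible : HasStrong (insert B x) → HasStrong (insert A y) → Feasible
    feasible (X , neC , C⊑ , strongC) (D , neD , D⊑ , strongD) =
      remove D x , remove X y , proj₁ D′ , proj₁ C′ ,
      (λ i di ci → disjoint i (∨-split (D⊑ i (remove-⊑ D x i di))) (∨-split (C⊑ i (remove-⊑ X y i ci))) (remove-≢ D x di) (remove-≢ X y ci)) ,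
      proj₂ D′ , proj₂ C′
      where
      D′ : Nonempty (remove D x) × Internal q (remove D x)
      D′ = remove-strong D x neD strongD
      C′ : Nonempty (remove X y) × Internal q (remove X y)
      C′ = remove-strong X y neC strongC
      disjoint : ∀ i → (A i ≡ true) ⊎ ((i == y) ≡ true) → (B i ≡ true) ⊎ ((i == x) ≡ true) → i ≢ x → i ≢ y → ⊥
      disjoint i (inj₂ i≡y) _          _   i≢y = i≢y (==⇒≡ i y i≡y)
      disjoint i (inj₁ _)   (inj₂ i≡x) i≢x _   = i≢x (==⇒≡ i x i≡x)
      disjoint i (inj₁ ai)  (inj₁ bi)  _   _   = true≢false bi (trans (comp i) (cong not ai))
    descend : ∀ fuel → cut A B ≤ fuel → ⊥
    descend zero       cut≤ = contradiction (≤-trans moved-x cut≤) λ ()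
    descend (suc fuel) cut≤ =
      noStrong⇒¬infeasible infeasible fuel (remove A x) (insert B x) (≤-pred (≤-trans moved-x cut≤)) (complementary-move x comp)
        (λ s → ¬sA (strong-⊑ (remove-⊑ A x) s))
        λ sB → noStrong⇒¬infeasible infeasible fuel (remove B y) (insert A y) (≤-pred (≤-trans moved-y cut≤)) (complementary-move y (complementary-sym comp))
          (λ s → ¬sB (strong-⊑ (remove-⊑ B y) s))
          λ sA → infeasible (feasible sB sA)

  -- As long as a q-internal set has a strong subset, that subset minus a vertex is a smaller
  -- nonempty q-internal set. Once the shrinking stops, a strong subset of the complement would be
  -- feasible together with the set reached, so neither side has one and the descent on cuts
  -- applies.
  ¬¬feasible : ¬ ¬ Feasible
  ¬¬feasible infeasible = shrink (card everything) everything ≤-refl (v₀ , refl) λ x _ → begin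
    q                         ≤⟨ ≤-trans (m≤m+n q q) (≤-trans (n≤1+n (q + q)) q-small) ⟩
    d                         ≡⟨ dg x ⟨
    deg G x                   ≡⟨ deg≡∑ G x ⟩
    ∑ (e x)                   ≡⟨ ∑-cong (λ j → *-identityˡ (e x j)) ⟨
    nbr everything x          ∎
    where
    everything : VSet
    everything _ = true
    shrink : ∀ fuel A → card A ≤ fuel → Nonempty A → Internal q A → ⊥
    shrink fuel A card≤ neA intA = noStrong⇒¬infeasible infeasible (cut A (not ∘ A)) A (not ∘ A) ≤-refl (λ _ → refl)
      (smaller fuel card≤)
      λ { (X , neC , C⊑ , strong) → infeasible (A , X , neA , neC , (λ x ax cx → true≢false ax (not-true (C⊑ x cx))) ,
          intA , λ x cx → ≤-trans (n≤1+n q) (strong x cx)) }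
      where
      smaller : ∀ fuel → card A ≤ fuel → ¬ HasStrong A
      smaller fuel card≤ (X , neC@(z , cz) , C⊑ , strong) with fuel | ≤-trans (≤-reflexive (card-remove X z cz)) (≤-trans (card-mono C⊑) card≤)
      ... | suc fuel | s≤s card≤ = shrink fuel (remove X z) card≤ (proj₁ C′) (proj₂ C′)
        where
        C′ : Nonempty (remove X z) × Internal q (remove X z)
        C′ = remove-strong X z neC strong

  -- Each vertex retains q neighbours on its own side, hence loses at most d - q edges.
  balanced-cut : ¬ ¬ Σ (Adj n) λ H → H ⊆G G × maxDeg H ≤ d ∸ q × (∀ k → 1 ≤ k → ¬ KConn k (G −G H))
  balanced-cut none = ¬¬feasible λ fe → build (feasible⇒partition fe)
    where
    build : Partition → ⊥
    build (P , (u , pu) , (w , pw) , intP , intN) = none (Cut.H G g A , Cut.H⊆G G g A , maxDeg≤ (Cut.H G g A) bound ,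
      λ k 1≤k → Cut.¬kConn G g A k 1≤k (trans (lookup∘tabulate P u) pu) (trans (lookup∘tabulate P w) (not-true pw)))
      where
      A : Vec Bool n
      A = tabulate P
      crossing : ∀ i j → edge (Cut.H G g A) i j ≡ edge G i j ∧ (P i xor P j)
      crossing i j = trans (edge-matrix (Cut.f G g A) i j) (cong₂ (λ a b → edge G i j ∧ (a xor b)) (lookup∘tabulate P i) (lookup∘tabulate P j))
      bound : ∀ i → deg (Cut.H G g A) i ≤ d ∸ q
      bound i = ≤-trans (≤-reflexive (trans (deg≡∑ (Cut.H G g A) i) (∑-cong λ j → cong 𝟙 (crossing i j)))) (side i (P i) refl)
        where
        side : ∀ i b → P i ≡ b → ∑ (λ j → 𝟙 (edge G i j ∧ (P i xor P j))) ≤ d ∸ q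
        side i true  pi rewrite pi = m+n≤o⇒m≤o∸n _ (begin
          ∑ (λ j → 𝟙 (edge G i j ∧ not (P j))) + q ≡⟨ cong (_+ q) (∑-cong λ j → trans (cong 𝟙 (Bool.∧-comm (edge G i j) _)) (𝟙-∧ (not (P j)) _)) ⟩
          nbr (not ∘ P) i + q                      ≤⟨ +-monoʳ-≤ (nbr (not ∘ P) i) (intP i pi) ⟩
          nbr (not ∘ P) i + nbr P i                ≡⟨ +-comm (nbr (not ∘ P) i) _ ⟩
          nbr P i + nbr (not ∘ P) i                ≡⟨ nbr-complement P i ⟩
          d                                        ∎)
        side i false pi rewrite pi = m+n≤o⇒m≤o∸n _ (begin
          ∑ (λ j → 𝟙 (edge G i j ∧ P j)) + q       ≡⟨ cong (_+ q) (∑-cong λ j → trans (cong 𝟙 (Bool.∧-comm (edge G i j) _)) (𝟙-∧ (P j) _)) ⟩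
          nbr P i + q                              ≤⟨ +-monoʳ-≤ (nbr P i) (intN i (cong not pi)) ⟩
          nbr P i + nbr (not ∘ P) i                ≡⟨ nbr-complement P i ⟩
          d                                        ∎)

-- Connectivity after deleting a sparse subgraph

reach-trans : ∀ {n} {G : Adj n} {S u v w} → Reach G S u v → edge G v w ≡ true → lookup S w ≡ false → Reach G S u w
reach-trans {S = S} r e w∉ = step r e (false⇒∉ {S = S} w∉)

module Robust {n d} (G : Adj n) (g : IsGraph G) (dg : ∀ i → deg G i ≡ d)
  (c C₀ V : ℕ) (V-large : C₀ + d ≤ V)
  (noDense : ∀ W → isSmall V (size W) ≡ true → denseBound d (size W) < cross W G)
  (noWeak : ∀ A → isLarge C₀ n (size A) ≡ true → c * size A + d * d < cross A G)
  (k : ℕ) (5≤k : 5 ≤ k) (k≤d : k ≤ d) (d∸k≤c : d ∸ k ≤ c)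
  (H : Adj n) (H⊆G : H ⊆G G) (ΔH : maxDeg H ≤ d ∸ k) where

  -- The degree sum turns a cut above `denseBound` into a bound on the inside. As `inner` counts
  -- every edge twice, it amounts to at most |W| edges.
  inner-small : ∀ W → isSmall V (size W) ≡ true → suc (inner W G) ≤ 2 * suc (size W)
  inner-small W small = ≰⇒> λ le → <-irrefl refl (<-≤-trans (noDense W small) (begin
    cross W G                      ≡⟨ m+n∸m≡n (inner W G) (cross W G) ⟨
    inner W G + cross W G ∸ inner W G ≡⟨ cong (_∸ inner W G) (inner+cross W G dg) ⟩
    d * size W ∸ inner W G         ≤⟨ ∸-monoʳ-≤ (d * size W) le ⟩
    denseBound d (size W)          ∎))

  -- `A` is a union of components left after removing `H` and `S`. Both sides of a separation are of
  -- this kind, and the argument is applied to the smaller one.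
  module ClosedSet (A S : Vec Bool n) (1≤A : 1 ≤ size A) (2A≤n : 2 * size A ≤ n) (S<k : size S < k)
    (A∩S : ∀ i → lookup A i ≡ true → lookup S i ≡ false)
    (closed : ∀ i j → lookup A i ≡ true → edge (G −G H) i j ≡ true → lookup A j ≡ true ⊎ lookup S j ≡ true) where

    a : ℕ
    a = size A
    s : ℕ
    s = size S

    e h : Fin n → Fin n → ℕ
    e i j = 𝟙 (edge G i j)
    h i j = 𝟙 (edge H i j)

    leaving : ∀ i j → lookup A i ≡ true → edge G i j ≡ true → edge H i j ≡ false → lookup A j ≡ true ⊎ lookup S j ≡ true
    leaving i j ai gij hij = closed i j ai (trans (edge-− G H i j) (∧-join gij (cong not hij)))

    H-weight : ∑∑ (λ i j → inside A i * h i j) ≤ a * (d ∸ k)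
    H-weight = begin
      ∑∑ (λ i j → inside A i * h i j)      ≡⟨ ∑-cong (λ i → trans (∑-scaleˡ (inside A i) (h i)) (cong (inside A i *_) (sym (deg≡∑ H i)))) ⟩
      ∑ (λ i → inside A i * deg H i)       ≤⟨ ∑-mono (λ i → *-monoʳ-≤ (inside A i) (≤-trans (deg≤maxDeg H i) ΔH)) ⟩
      ∑ (λ i → inside A i * (d ∸ k))       ≡⟨ ∑-scaleʳ (d ∸ k) (inside A) ⟩
      a * (d ∸ k)                          ∎

    -- An edge leaving `A` was deleted, at most d - k at each vertex of `A`, or it ends in `S`,
    -- where fewer than k ≤ d vertices have d edges each.
    few-leave : cross A G ≤ c * a + d * d
    few-leave = begin
      cross A G                                                ≤⟨ ∑∑-mono pointwise ⟩
      ∑∑ (λ i j → inside A i * h i j + inside S j * e j i)     ≡⟨ ∑∑-+ _ _ ⟩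
      ∑∑ (λ i j → inside A i * h i j) + ∑∑ (λ i j → inside S j * e j i) ≤⟨ +-mono-≤ H-weight (≤-reflexive S-weight) ⟩
      a * (d ∸ k) + s * d                                      ≤⟨ +-mono-≤ (*-monoʳ-≤ a d∸k≤c) (*-monoˡ-≤ d (≤-trans (<⇒≤ S<k) k≤d)) ⟩
      a * c + d * d                                            ≡⟨ cong (_+ d * d) (*-comm a c) ⟩
      c * a + d * d                                            ∎
      where
      S-weight : ∑∑ (λ i j → inside S j * e j i) ≡ s * d
      S-weight = trans (∑∑-swap _) (trans (∑-cong λ j → trans (∑-scaleˡ (inside S j) (e j)) (cong (inside S j *_) (trans (sym (deg≡∑ G j)) (dg j)))) (∑-scaleʳ d (inside S)))
      table : ∀ a b s e h → (a ≡ true → e ≡ true → h ≡ false → b ≡ true ⊎ s ≡ true) →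
        𝟙 a * 𝟙 (not b) * 𝟙 e ≤ 𝟙 a * 𝟙 h + 𝟙 s * 𝟙 e
      table false b     s     e     h     _ = z≤n
      table true  true  s     e     h     _ = z≤n
      table true  false s     false h     _ = z≤n
      table true  false s     true  true  _ = s≤s z≤n
      table true  false true  true  false _ = s≤s z≤n
      table true  false false true  false f with f refl refl refl
      ... | inj₁ ()
      ... | inj₂ ()
      pointwise : ∀ i j → inside A i * outside A j * e i j ≤ inside A i * h i j + inside S j * e j i
      pointwise i j = ≤-trans (table (lookup A i) (lookup A j) (lookup S j) (edge G i j) (edge H i j) (leaving i j))
        (≤-reflexive (cong (λ b → inside A i * h i j + inside S j * 𝟙 b) (proj₁ g i j)))

    I E : ℕ
    I = inner A G
    E = ∑∑ λ i j → inside A i * inside S j * e i j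

    -- Every vertex of `A` keeps at least k edges after the deletion, and all of them end in `A` or
    -- `S`.
    many-stay : k * a ≤ I + E
    many-stay = +-cancelʳ-≤ (a * (d ∸ k)) _ _ (begin
      k * a + a * (d ∸ k)           ≡⟨ trans (cong (_+ a * (d ∸ k)) (*-comm k a)) (sym (*-distribˡ-+ a k (d ∸ k))) ⟩
      a * (k + (d ∸ k))             ≡⟨ cong (a *_) (m+[n∸m]≡n k≤d) ⟩
      a * d                         ≡⟨ ∑-scaleʳ d (inside A) ⟨
      ∑ (λ i → inside A i * d)      ≡⟨ ∑-cong (λ i → trans (∑-scaleˡ (inside A i) (e i)) (cong (inside A i *_) (trans (sym (deg≡∑ G i)) (dg i)))) ⟨
      ∑∑ (λ i j → inside A i * e i j) ≤⟨ ∑∑-mono (λ i j → table (lookup A i) (lookup A j) (lookup S j) (edge G i j) (edge H i j) (leaving i j)) ⟩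
      ∑∑ (λ i j → inside A i * inside A j * e i j + inside A i * inside S j * e i j + inside A i * h i j) ≡⟨ trans (∑∑-+ _ _) (cong (_+ ∑∑ (λ i j → inside A i * h i j)) (∑∑-+ _ _)) ⟩
      I + E + ∑∑ (λ i j → inside A i * h i j) ≤⟨ +-monoʳ-≤ (I + E) H-weight ⟩
      I + E + a * (d ∸ k)           ∎)
      where
      table : ∀ a b s e h → (a ≡ true → e ≡ true → h ≡ false → b ≡ true ⊎ s ≡ true) →
        𝟙 a * 𝟙 e ≤ 𝟙 a * 𝟙 b * 𝟙 e + 𝟙 a * 𝟙 s * 𝟙 e + 𝟙 a * 𝟙 h
      table false b     s     e     h     _ = z≤n
      table true  b     s     false h     _ = z≤n
      table true  true  s     true  h     _ = s≤s z≤n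
      table true  false true  true  h     _ = s≤s z≤n
      table true  false false true  true  _ = s≤s z≤n
      table true  false false true  false f with f refl refl refl
      ... | inj₁ ()
      ... | inj₂ ()

    W : Vec Bool n
    W = tabulate λ i → lookup A i ∨ lookup S i

    inside-W : ∀ i → inside W i ≡ inside A i + inside S i
    inside-W i = trans (cong 𝟙 (lookup∘tabulate (λ i → lookup A i ∨ lookup S i) i)) (table (lookup A i) (lookup S i) (A∩S i))
      where
      table : ∀ a s → (a ≡ true → s ≡ false) → 𝟙 (a ∨ s) ≡ 𝟙 a + 𝟙 s
      table true  s f rewrite f refl = refl
      table false s f = refl

    size-W : size W ≡ a + s
    size-W = trans (∑-cong inside-W) (∑-+ (inside A) (inside S))

    inner-W : I + (E + E) ≤ inner W G
    inner-W = begin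
      I + (E + E)                   ≡⟨ cong (λ x → I + (E + x)) E-sym ⟩
      I + (E + ∑∑ (λ i j → inside S i * inside A j * e i j)) ≡⟨ trans (∑∑-+ _ _) (cong (I +_) (∑∑-+ _ _)) ⟨
      ∑∑ (λ i j → inside A i * inside A j * e i j + (inside A i * inside S j * e i j + inside S i * inside A j * e i j)) ≤⟨ ∑∑-mono pointwise ⟩
      inner W G                     ∎
      where
      E-sym : E ≡ ∑∑ (λ i j → inside S i * inside A j * e i j)
      E-sym = trans (∑∑-swap _) (∑∑-cong λ i j → trans (cong (λ b → inside A j * inside S i * 𝟙 b) (proj₁ g j i)) (cong (_* e i j) (*-comm (inside A j) (inside S i))))
      expand : ∀ a s b t e → (a + s) * (b + t) * e ≡ a * b * e + (a * t * e + s * b * e) + s * t * e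
      expand = solve-∀
      pointwise : ∀ i j → inside A i * inside A j * e i j + (inside A i * inside S j * e i j + inside S i * inside A j * e i j) ≤ inside W i * inside W j * e i j
      pointwise i j = ≤-trans (m≤m+n _ (inside S i * inside S j * e i j)) (≤-reflexive (sym (trans
        (cong₂ (λ x y → x * y * e i j) (inside-W i) (inside-W j)) (expand (inside A i) (inside S i) (inside A j) (inside S j) (e i j)))))

    -- Serves the case a = 1, where it leaves no edge inside `A`. The diagonal pairs are added to
    -- `I` to make room for a.
    loopless : I + a ≤ a * a
    loopless = begin
      I + a                                             ≡⟨ cong (I +_) (∑-cong (λ i → ∑-pick i (λ _ → inside A i))) ⟨
      I + ∑∑ (λ i j → 𝟙 (j == i) * inside A i)          ≡⟨ ∑∑-+ _ _ ⟨
      ∑∑ (λ i j → inside A i * inside A j * e i j + 𝟙 (j == i) * inside A i) ≤⟨ ∑∑-mono pointwise ⟩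
      ∑∑ (λ i j → inside A i * inside A j)              ≡⟨ ∑-product (inside A) (inside A) ⟩
      a * a                                             ∎
      where
      pointwise : ∀ i j → inside A i * inside A j * e i j + 𝟙 (j == i) * inside A i ≤ inside A i * inside A j
      pointwise i j with j == i in eq
      ... | false = ≤-trans (≤-reflexive (+-identityʳ _)) (≤-trans (*-monoʳ-≤ (inside A i * inside A j) (𝟙≤1 (edge G i j))) (≤-reflexive (*-identityʳ _)))
      ... | true rewrite ==⇒≡ j i eq | proj₂ g i | *-zeroʳ (inside A i * inside A i) | +-identityʳ (inside A i) = square (lookup A i)
        where
        square : ∀ b → 𝟙 b ≤ 𝟙 b * 𝟙 b
        square true  = ≤-refl
        square false = z≤n

    E≤ : E ≤ a * s
    E≤ = ≤-trans (∑∑-mono λ i j → ≤-trans (*-monoʳ-≤ (inside A i * inside S j) (𝟙≤1 (edge G i j))) (≤-reflexive (*-identityʳ _))) (≤-reflexive (∑-product (inside A) (inside S)))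

    -- For small `A` the sparsity bounds of `A` and A ∪ S are added, because the sum 2I + 2E weighs
    -- `I` and `E` equally, as `many-stay` does. The outcome k a ≤ 2a + k fails for a ≥ 2, and a = 1
    -- would leave a vertex with k edges into fewer than k vertices.
    impossible : ⊥
    impossible with C₀ ≤? a
    ... | yes C₀≤a = <-irrefl refl (<-≤-trans (noWeak A (∧-join (≤ᵇ-true C₀≤a) (≤ᵇ-true 2A≤n))) few-leave)
    ... | no C₀≰a = small-case a refl
      where
      a<C₀ : a < C₀
      a<C₀ = ≰⇒> C₀≰a
      small-A : isSmall V a ≡ true
      small-A = ∧-join (≤ᵇ-true 1≤A) (≤ᵇ-true (≤-trans a<C₀ (≤-trans (m≤m+n C₀ d) V-large)))
      -- Joining `S`, of fewer than d vertices, must not lead out of the range of small sets; hence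
      -- V ≥ C₀ + d.
      small-W : isSmall V (size W) ≡ true
      small-W = ∧-join (≤ᵇ-true (≤-trans 1≤A (≤-trans (m≤m+n a s) (≤-reflexive (sym size-W)))))
        (≤ᵇ-true (≤-trans (≤-reflexive (cong suc size-W)) (≤-trans (+-mono-≤ a<C₀ (≤-trans (<⇒≤ S<k) k≤d)) V-large)))
      sparse : k * a ≤ 2 * a + k
      sparse = *-cancelˡ-≤ 2 (+-cancelʳ-≤ 2 _ _ (begin
        2 * (k * a) + 2                    ≤⟨ +-monoˡ-≤ 2 (*-monoʳ-≤ 2 many-stay) ⟩
        2 * (I + E) + 2                    ≡⟨ r₁ I E ⟩
        suc I + suc (I + (E + E))          ≤⟨ +-mono-≤ (inner-small A small-A) (≤-trans (s≤s inner-W) (inner-small W small-W)) ⟩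
        2 * suc a + 2 * suc (size W)       ≡⟨ cong (λ w → 2 * suc a + 2 * suc w) size-W ⟩
        2 * suc a + 2 * suc (a + s)        ≡⟨ r₂ a s ⟩
        2 * (2 * a + suc s) + 2            ≤⟨ +-monoˡ-≤ 2 (*-monoʳ-≤ 2 (+-monoʳ-≤ (2 * a) S<k)) ⟩
        2 * (2 * a + k) + 2                ∎))
        where
        r₁ : ∀ I E → 2 * (I + E) + 2 ≡ suc I + suc (I + (E + E))
        r₁ = solve-∀
        r₂ : ∀ a s → 2 * suc a + 2 * suc (a + s) ≡ 2 * (2 * a + suc s) + 2
        r₂ = solve-∀
      small-case : ∀ x → a ≡ x → ⊥
      small-case zero          eq = contradiction (subst (1 ≤_) eq 1≤A) λ ()
      small-case (suc zero)    eq = <-irrefl refl (begin-strict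
        k              ≡⟨ *-identityʳ k ⟨
        k * 1          ≡⟨ cong (k *_) eq ⟨
        k * a          ≤⟨ many-stay ⟩
        I + E          ≤⟨ +-mono-≤ I≤0 E≤ ⟩
        0 + a * s      ≡⟨ cong (_* s) eq ⟩
        1 * s          ≡⟨ *-identityˡ s ⟩
        s              <⟨ S<k ⟩
        k              ∎)
        where
        I≤0 : I ≤ 0
        I≤0 = +-cancelʳ-≤ 1 I 0 (subst (λ x → I + x ≤ x * x) eq loopless)
      -- With a = x + 2 this comes down to 5(x + 1) > 2(x + 2), tight at x = 0; here 5 ≤ k is used.
      small-case (suc (suc x)) eq = <-irrefl refl (begin-strict
        2 * a + k                    ≡⟨ cong (λ a → 2 * a + k) eq ⟩
        2 * (2 + x) + k              <⟨ m<m+n _ (s≤s (z≤n {3 * x})) ⟩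
        2 * (2 + x) + k + suc (3 * x)  ≡⟨ r₁ x k ⟩
        k + 5 * (1 + x)              ≤⟨ +-monoʳ-≤ k (*-monoˡ-≤ (1 + x) 5≤k) ⟩
        k + k * (1 + x)              ≡⟨ *-suc k (1 + x) ⟨
        k * (2 + x)                  ≡⟨ cong (k *_) eq ⟨
        k * a                        ≤⟨ sparse ⟩
        2 * a + k                    ∎)
        where
        r₁ : ∀ x k → 2 * (2 + x) + k + suc (3 * x) ≡ k + 5 * (1 + x)
        r₁ = solve-∀

  H-sym : ∀ i j → edge (G −G H) i j ≡ edge (G −G H) j i
  H-sym i j = trans (edge-− G H i j) (trans (cong₂ (λ p q → p ∧ not q) (proj₁ g i j) (proj₁ (proj₁ H⊆G) i j)) (sym (edge-− G H j i)))

  -- All quantifiers range over finite types, so it is enough to refute one unreachable pair. The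
  -- vertices reached from `u`, and those neither reached nor in `S`, are both closed, the latter by
  -- the symmetry of G - H; the smaller set has at most n/2 vertices.
  ¬¬kConn : ¬ ¬ KConn k (G −G H)
  ¬¬kConn = ¬¬-∀Vec λ S → ¬¬-→ λ S<k → ¬¬-∀Fin λ u → ¬¬-∀Fin λ v → ¬¬-→ λ u∉ → ¬¬-→ λ v∉ ¬reach →
    ¬¬-comprehension (Reach (G −G H) S u) λ { (A , spec) →
      separated S (≤-trans (≤-reflexive (cong suc (sym (∣∣≡size S)))) S<k) u v (∉⇒false u∉) (∉⇒false v∉) ¬reach A spec }
    where
    separated : ∀ (S : Subset n) → size S < k → ∀ u v → lookup S u ≡ false → lookup S v ≡ false → ¬ Reach (G −G H) S u v →
      (A : Vec Bool n) → (∀ w → (lookup A w ≡ true → Reach (G −G H) S u w) × (Reach (G −G H) S u w → lookup A w ≡ true)) → ⊥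
    separated S S<k u v u∉ v∉ ¬reach A spec = smaller (≤-total a b)
      where
      B : Vec Bool n
      B = tabulate λ i → not (lookup A i) ∧ not (lookup S i)
      B-spec : ∀ i → lookup B i ≡ not (lookup A i) ∧ not (lookup S i)
      B-spec = lookup∘tabulate λ i → not (lookup A i) ∧ not (lookup S i)
      a b : ℕ
      a = size A
      b = size B
      A∌S : ∀ i → lookup A i ≡ true → lookup S i ≡ false
      A∌S i ai with proj₁ (spec i) ai
      ... | here = u∉
      ... | step _ _ i∉ = ∉⇒false i∉
      B∌S : ∀ i → lookup B i ≡ true → lookup S i ≡ false
      B∌S i bi = not-true (proj₂ (∧-split {not (lookup A i)} (trans (sym (B-spec i)) bi)))
      A-closed : ∀ i j → lookup A i ≡ true → edge (G −G H) i j ≡ true → lookup A j ≡ true ⊎ lookup S j ≡ true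
      A-closed i j ai e with lookup S j in sj
      ... | true  = inj₂ refl
      ... | false = inj₁ (proj₂ (spec j) (reach-trans (proj₁ (spec i) ai) e sj))
      B-closed : ∀ i j → lookup B i ≡ true → edge (G −G H) i j ≡ true → lookup B j ≡ true ⊎ lookup S j ≡ true
      B-closed i j bi e with lookup S j in sj | lookup A j in aj
      ... | true  | _     = inj₂ refl
      ... | false | false = inj₁ (trans (B-spec j) (cong₂ (λ x y → not x ∧ not y) aj sj))
      ... | false | true with A-closed j i aj (trans (H-sym j i) e)
      ...   | inj₁ ai = ⊥-elim (true≢false ai (not-true (proj₁ (∧-split {not (lookup A i)} (trans (sym (B-spec i)) bi)))))
      ...   | inj₂ si = ⊥-elim (true≢false si (B∌S i bi))
      nonempty : ∀ (X : Vec Bool n) i → lookup X i ≡ true → 1 ≤ size X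
      nonempty X i xi = ≤-trans (≤-reflexive (cong 𝟙 (sym xi))) (∑-term (inside X) i)
      1≤a : 1 ≤ a
      1≤a = nonempty A u (proj₂ (spec u) here)
      1≤b : 1 ≤ b
      1≤b = nonempty B v (trans (B-spec v) (cong₂ (λ x y → not x ∧ not y) (≢true⇒false λ av → ¬reach (proj₁ (spec v) av)) v∉))
      a+b≤n : a + b ≤ n
      a+b≤n = begin
        a + b                               ≡⟨ ∑-+ (inside A) (inside B) ⟨
        ∑ (λ i → inside A i + inside B i)   ≤⟨ ∑-mono pointwise ⟩
        ∑ {n} (λ _ → 1)                     ≡⟨ trans (∑-const n 1) (*-identityʳ n) ⟩
        n                                   ∎
        where
        table : ∀ x y → 𝟙 x + 𝟙 (not x ∧ not y) ≤ 1
        table true  y     = ≤-refl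
        table false true  = z≤n
        table false false = ≤-refl
        pointwise : ∀ i → inside A i + inside B i ≤ 1
        pointwise i = ≤-trans (≤-reflexive (cong (λ x → inside A i + 𝟙 x) (B-spec i))) (table (lookup A i) (lookup S i))
      half : ∀ {x y} → x ≤ y → x + y ≤ n → 2 * x ≤ n
      half {x} x≤y h = ≤-trans (≤-reflexive (cong (x +_) (+-identityʳ x))) (≤-trans (+-monoʳ-≤ x x≤y) h)
      smaller : a ≤ b ⊎ b ≤ a → ⊥
      smaller (inj₁ a≤b) = ClosedSet.impossible A S 1≤a (half a≤b a+b≤n) S<k A∌S A-closed
      smaller (inj₂ b≤a) = ClosedSet.impossible B S 1≤b (half b≤a (≤-trans (≤-reflexive (+-comm b a)) a+b≤n)) S<k B∌S B-closed

-- Bounding the exponential series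

/-toℚᵘ : ∀ p q .{{_ : NonZero q}} → toℚᵘ (pos p /ℚ q) ℚᵘ.≃ (pos p ℚᵘ./ q)
/-toℚᵘ p (suc q) = ℚ.toℚᵘ-fromℚᵘ (mkℚᵘ (pos p) q)

/-≤ : ∀ p q r s .{{_ : NonZero q}} .{{_ : NonZero s}} → p * s ≤ r * q → (pos p /ℚ q) ≤ℚ (pos r /ℚ s)
/-≤ p (suc q) r (suc s) h = ℚ.toℚᵘ-cancel-≤ (ℚᵘ.≤-respˡ-≃ (ℚᵘ.≃-sym (/-toℚᵘ p (suc q))) (ℚᵘ.≤-respʳ-≃ (ℚᵘ.≃-sym (/-toℚᵘ r (suc s)))
  (*≤* (subst₂ ℤ._≤_ (ℤ.pos-* p (suc s)) (ℤ.pos-* r (suc q)) (+≤+ h)))))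

/-+-≤ : ∀ p q r s u t .{{_ : NonZero q}} .{{_ : NonZero s}} .{{_ : NonZero t}} → (p * s + r * q) * t ≤ u * (q * s) →
  (pos p /ℚ q) +ℚ (pos r /ℚ s) ≤ℚ (pos u /ℚ t)
/-+-≤ p (suc q) r (suc s) u (suc t) h = ℚ.toℚᵘ-cancel-≤ (ℚᵘ.≤-respˡ-≃ (ℚᵘ.≃-sym sum≃) (ℚᵘ.≤-respʳ-≃ (ℚᵘ.≃-sym (/-toℚᵘ u (suc t)))
  (*≤* (subst₂ ℤ._≤_ numerator (ℤ.pos-* u (suc q * suc s)) (+≤+ h)))))
  where
  sum≃ : toℚᵘ ((pos p /ℚ suc q) +ℚ (pos r /ℚ suc s)) ℚᵘ.≃ mkℚᵘ (pos p) q ℚᵘ.+ mkℚᵘ (pos r) s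
  sum≃ = ℚᵘ.≃-trans (ℚ.toℚᵘ-homo-+ (pos p /ℚ suc q) (pos r /ℚ suc s)) (ℚᵘ.+-cong (/-toℚᵘ p (suc q)) (/-toℚᵘ r (suc s)))
  numerator : pos ((p * suc s + r * suc q) * suc t) ≡ (pos p ℤ.* pos (suc s) ℤ.+ pos r ℤ.* pos (suc q)) ℤ.* pos (suc t)
  numerator = trans (ℤ.pos-* (p * suc s + r * suc q) (suc t)) (cong (ℤ._* pos (suc t))
    (trans (ℤ.pos-+ (p * suc s) (r * suc q)) (cong₂ ℤ._+_ (ℤ.pos-* p (suc s)) (ℤ.pos-* r (suc q)))))

-- 8^N/N! is largest at N = 7 and N = 8, where it is about 416.
8^≤500*! : ∀ N → 8 ^ N ≤ 500 * N !
8^≤500*! 0 = ≤ᵇ⇒≤ _ _ _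
8^≤500*! 1 = ≤ᵇ⇒≤ _ _ _
8^≤500*! 2 = ≤ᵇ⇒≤ _ _ _
8^≤500*! 3 = ≤ᵇ⇒≤ _ _ _
8^≤500*! 4 = ≤ᵇ⇒≤ _ _ _
8^≤500*! 5 = ≤ᵇ⇒≤ _ _ _
8^≤500*! 6 = ≤ᵇ⇒≤ _ _ _
8^≤500*! 7 = ≤ᵇ⇒≤ _ _ _
8^≤500*! (suc N@(suc (suc (suc (suc (suc (suc (suc M)))))))) = begin
  8 * 8 ^ N           ≤⟨ *-mono-≤ (m≤m+n 8 M) (8^≤500*! N) ⟩
  suc N * (500 * N !) ≡⟨ swapˡ (suc N) 500 (N !) ⟩
  500 * (suc N) !     ∎
  where
  swapˡ : ∀ a b c → a * (b * c) ≡ b * (a * c)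
  swapˡ x y z = trans (sym (*-assoc x y z)) (trans (cong (_* z) (*-comm x y)) (*-assoc y x z))

expTerm-≤ : ∀ a N → a ≤ 4 → a ^ N * 2 ^ N ≤ 500 * N !
expTerm-≤ a N a≤4 = begin
  a ^ N * 2 ^ N ≡⟨ ^-distrib-* a 2 N ⟨
  (a * 2) ^ N   ≤⟨ ^-monoˡ-≤ N (*-monoˡ-≤ 2 a≤4) ⟩
  8 ^ N         ≤⟨ 8^≤500*! N ⟩
  500 * N !     ∎

-- The term of index N is at most 500/2^N = 1000/2^N - 1000/2^(N+1), so a partial sum plus 1000/2^N
-- never increases, and it starts at 1000.
expPartial-tail : ∀ a → a ≤ 4 → ∀ N → expPartial a N +ℚ ((pos 1000) /ℚ (2 ^ N)) {{m^n≢0 2 N}} ≤ℚ ((pos 1000) /ℚ 1)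
expPartial-tail a a≤4 zero    = ℚ.≤-reflexive (ℚ.+-identityˡ _)
expPartial-tail a a≤4 (suc N) = ℚ.≤-trans (ℚ.≤-reflexive (ℚ.+-assoc (expPartial a N) _ _))
  (ℚ.≤-trans (ℚ.+-monoʳ-≤ (expPartial a N) (/-+-≤ (a ^ N) (N !) 1000 (2 ^ suc N) 1000 (2 ^ N) {{N !≢0}} {{m^n≢0 2 (suc N)}} {{m^n≢0 2 N}} arithmetic))
  (expPartial-tail a a≤4 N))
  where
  r₁ : ∀ x t f → (x * (2 * t) + 1000 * f) * t ≡ 2 * (x * t) * t + 1000 * (f * t)
  r₁ = solve-∀
  r₂ : ∀ t f → 2 * (500 * f) * t + 1000 * (f * t) ≡ 1000 * (f * (2 * t))
  r₂ = solve-∀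
  arithmetic : (a ^ N * 2 ^ suc N + 1000 * N !) * 2 ^ N ≤ 1000 * (N ! * 2 ^ suc N)
  arithmetic = begin
    (a ^ N * (2 * 2 ^ N) + 1000 * N !) * 2 ^ N            ≡⟨ r₁ (a ^ N) (2 ^ N) (N !) ⟩
    2 * (a ^ N * 2 ^ N) * 2 ^ N + 1000 * (N ! * 2 ^ N)    ≤⟨ +-monoˡ-≤ _ (*-monoˡ-≤ (2 ^ N) (*-monoʳ-≤ 2 (expTerm-≤ a N a≤4))) ⟩
    2 * (500 * N !) * 2 ^ N + 1000 * (N ! * 2 ^ N)        ≡⟨ r₂ (2 ^ N) (N !) ⟩
    1000 * (N ! * (2 * 2 ^ N))                            ∎

expLE : ∀ a M → a ≤ 4 → 1000 ≤ M → ExpLE a M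
expLE a M a≤4 1000≤M N = ℚ.≤-trans (ℚ.≤-trans (ℚ.≤-reflexive (sym (ℚ.+-identityʳ (expPartial a N)))) (ℚ.+-monoʳ-≤ (expPartial a N) nonneg))
  (ℚ.≤-trans (expPartial-tail a a≤4 N) (/-≤ 1000 1 M 1 (*-monoˡ-≤ 1 1000≤M)))
  where
  nonneg : 0ℚ ≤ℚ ((pos 1000) /ℚ (2 ^ N)) {{m^n≢0 2 N}}
  nonneg = ℚ.≤-trans (/-≤ 0 1 0 1 z≤n) (/-≤ 0 1 1000 (2 ^ N) {{_}} {{m^n≢0 2 N}} z≤n)

-- The Stiebitz cut gives far more than is asked: (2r - d)² ≤ 4, so it is e^4 that is compared with
-- d^(64 d), and e^4 < 1000 ≤ d.
belowUpper : ∀ d r → 1000 ≤ d → 2 * r ≤ d + 2 → BelowUpper d r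
belowUpper d r large h with 2 * r ≤? d
... | yes p = inj₁ p
... | no  _ = inj₂ (expLE ((2 * r ∸ d) ^ 2) (d ^ (64 * d)) (^-monoˡ-≤ 2 {y = 2} (m≤n+o⇒m∸n≤o (2 * r) d h)) (begin
  1000          ≤⟨ large ⟩
  d             ≡⟨ ^-identityʳ d ⟨
  d ^ 1         ≤⟨ ^-monoʳ-≤ d {{>-nonZero 1≤d}} (*-mono-≤ {1} {64} (s≤s z≤n) 1≤d) ⟩
  d ^ (64 * d)  ∎))
  where
  1≤d : 1 ≤ d
  1≤d = ≤-trans (s≤s z≤n) large

-- The resilience threshold

HighK? : ∀ d k → Dec (HighK d k)
HighK? d k = (d ≤? 2 * k) ×-dec (4 * d ≤? (2 * k ∸ d) ^ 2)

HighK-mono : ∀ {d k k′} → k ≤ k′ → HighK d k → HighK d k′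
HighK-mono {d} k≤ (p , q) = ≤-trans p (*-monoʳ-≤ 2 k≤) , ≤-trans q (^-monoˡ-≤ 2 (∸-monoˡ-≤ d (*-monoʳ-≤ 2 k≤)))

HighK-top : ∀ d → 4 ≤ d → HighK d d
HighK-top d 4≤d = m≤m+n d _ , (begin
  4 * d             ≤⟨ *-monoˡ-≤ d 4≤d ⟩
  d * d             ≡⟨ cong (d *_) (*-identityʳ d) ⟨
  d ^ 2             ≡⟨ cong (_^ 2) (trans (cong (λ x → d + x ∸ d) (+-identityʳ d)) (m+n∸m≡n d d)) ⟨
  (2 * d ∸ d) ^ 2   ∎)

least : ∀ {P : ℕ → Set} → (∀ n → Dec (P n)) → ∀ n → P n → Σ ℕ λ m → P m × (∀ m′ → P m′ → m ≤ m′)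
least {P} P? n p = go n n ≤-refl p
  where
  go : ∀ fuel n → n ≤ fuel → P n → Σ ℕ λ m → P m × (∀ m′ → P m′ → m ≤ m′)
  go fuel n n≤ p with anyUpTo? P? n
  go fuel       n n≤ p | no none = n , p , λ m′ p′ → ≮⇒≥ λ m′<n → none (m′ , m′<n , p′)
  go zero       n n≤ p | yes (m , m<n , _) = contradiction (≤-trans m<n n≤) λ ()
  go (suc fuel) n n≤ p | yes (m , m<n , q) = go fuel m (≤-pred (≤-trans m<n n≤)) q

-- `c` bounds the maximum degree of the deletions to be survived, about d/2 - √d. The field `k`,
-- about √d/2, is not a connectivity: k + 1 is the number of switching blocks that gain. `k-large`
-- makes their gain reach 9/2, and `c-small` makes them fit.
record Parameters (d : ℕ) : Set where
  field
    c k       : ℕ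
    c-bound   : ∀ k → HighK d k → d ∸ k ≤ c
    k-large   : 15 * d ≤ 64 * (suc k * k)
    c-small   : 2 * c + 4 * (suc k + 2) + 1 ≤ d

-- 4d ≤ h² and 50000 ≤ d force h ≥ 441, hence k ≥ 107, which is what k-large needs.
parameters : ∀ d → 50000 ≤ d → Parameters d
parameters d d-large with least (HighK? d) d (HighK-top d (≤-trans (m≤m+n 4 49996) d-large))
... | k₀ , (d≤2k₀ , 4d≤h²) , minimal = record
  { c = c ; k = k ; c-bound = λ k high → ∸-monoʳ-≤ d (minimal k high) ; k-large = k-large ; c-small = c-small }
  where
  h c x k : ℕ
  h = 2 * k₀ ∸ d
  c = d ∸ k₀
  -- `c-small` reads 2c + 4k + 13 ≤ d, and d = 2c + h, so (h - 13)/4 rounded down is the largest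
  -- choice.
  x = h ∸ 13
  k = x / 4
  k₀≤d : k₀ ≤ d
  k₀≤d = minimal d (HighK-top d (≤-trans (m≤m+n 4 49996) d-large))
  2c+h : 2 * c + h ≡ d
  2c+h = +-cancelʳ-≡ d _ _ (begin-equality
    2 * c + h + d           ≡⟨ +-assoc (2 * c) h d ⟩
    2 * c + (h + d)         ≡⟨ cong (2 * c +_) (m∸n+n≡m d≤2k₀) ⟩
    2 * c + 2 * k₀          ≡⟨ *-distribˡ-+ 2 c k₀ ⟨
    2 * (c + k₀)            ≡⟨ cong (2 *_) (m∸n+n≡m k₀≤d) ⟩
    2 * d                   ≡⟨ cong (d +_) (+-identityʳ d) ⟩
    d + d                   ∎)
  h-large : 441 ≤ h
  h-large = ≮⇒≥ λ h< → <-irrefl refl (begin-strict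
    4 * 50000  ≤⟨ *-monoʳ-≤ 4 d-large ⟩
    4 * d      ≤⟨ 4d≤h² ⟩
    h ^ 2      ≤⟨ ^-monoˡ-≤ 2 (≤-pred h<) ⟩
    440 ^ 2    <⟨ ≤ᵇ⇒≤ (suc (440 ^ 2)) (4 * 50000) _ ⟩
    4 * 50000  ∎)
  h≡ : h ≡ 13 + x
  h≡ = sym (m+[n∸m]≡n (≤-trans (m≤m+n 13 428) h-large))
  x≡ : x ≡ x % 4 + k * 4
  x≡ = m≡m%n+[m/n]*n x 4
  x≤ : x ≤ 3 + k * 4
  x≤ = ≤-trans (≤-reflexive x≡) (+-monoˡ-≤ (k * 4) (≤-pred (m%n<n x 4)))
  107≤k : 107 ≤ k
  107≤k = ≮⇒≥ λ k< → <-irrefl refl (begin-strict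
    441              ≤⟨ h-large ⟩
    h                ≡⟨ h≡ ⟩
    13 + x           ≤⟨ +-monoʳ-≤ 13 x≤ ⟩
    16 + k * 4       ≤⟨ +-monoʳ-≤ 16 (*-monoˡ-≤ 4 {k} {106} (≤-pred k<)) ⟩
    16 + 106 * 4     <⟨ ≤ᵇ⇒≤ (suc (16 + 106 * 4)) 441 _ ⟩
    441              ∎)
  k-large : 15 * d ≤ 64 * (suc k * k)
  -- Up to lower-order terms k is h/4, so k² is at least d/4 = 16d/64. Asking for 15d/64 leaves room
  -- for those terms from k = 107 on.
  k-large = *-cancelˡ-≤ 4 (begin
    4 * (15 * d)                 ≡⟨ r₁ d ⟩
    15 * (4 * d)                 ≤⟨ *-monoʳ-≤ 15 4d≤h² ⟩
    15 * (h * (h * 1))           ≤⟨ *-monoʳ-≤ 15 (*-mono-≤ h≤ (*-monoˡ-≤ 1 h≤)) ⟩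
    15 * ((16 + k * 4) * ((16 + k * 4) * 1)) ≡⟨ r₂ k ⟩
    240 * (k * k) + 1920 * k + 48 * 80         ≤⟨ +-monoʳ-≤ (240 * (k * k) + 1920 * k) (*-monoʳ-≤ 48 (≤-trans (m≤m+n 80 27) 107≤k)) ⟩
    240 * (k * k) + 1920 * k + 48 * k          ≡⟨ r₃ k ⟩
    240 * (k * k) + 256 * k + 16 * (107 * k)   ≤⟨ +-monoʳ-≤ (240 * (k * k) + 256 * k) (*-monoʳ-≤ 16 (*-monoˡ-≤ k 107≤k)) ⟩
    240 * (k * k) + 256 * k + 16 * (k * k)     ≡⟨ r₄ k ⟩
    4 * (64 * (suc k * k))                     ∎)
    where
    r₁ : ∀ d → 4 * (15 * d) ≡ 15 * (4 * d)
    r₁ = solve-∀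
    r₂ : ∀ k → 15 * ((16 + k * 4) * ((16 + k * 4) * 1)) ≡ 240 * (k * k) + 1920 * k + 48 * 80
    r₂ = solve-∀
    r₃ : ∀ k → 240 * (k * k) + 1920 * k + 48 * k ≡ 240 * (k * k) + 256 * k + 16 * (107 * k)
    r₃ = solve-∀
    r₄ : ∀ k → 240 * (k * k) + 256 * k + 16 * (k * k) ≡ 4 * (64 * (suc k * k))
    r₄ = solve-∀
    h≤ : h ≤ 16 + k * 4
    h≤ = ≤-trans (≤-reflexive h≡) (+-monoʳ-≤ 13 x≤)
  c-small : 2 * c + 4 * (suc k + 2) + 1 ≤ d
  c-small = begin
    2 * c + 4 * (suc k + 2) + 1    ≡⟨ r₁ (2 * c) k ⟩
    2 * c + (13 + k * 4)           ≤⟨ +-monoʳ-≤ (2 * c) (≤-trans (+-monoʳ-≤ 13 (≤-trans (m≤n+m (k * 4) (x % 4)) (≤-reflexive (sym x≡)))) (≤-reflexive (sym h≡))) ⟩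
    2 * c + h                      ≡⟨ 2c+h ⟩
    d                              ∎
    where
    r₁ : ∀ c k → c + 4 * (suc k + 2) + 1 ≡ c + (13 + k * 4)
    r₁ = solve-∀

-- Graphs avoiding both events

kConn-mono : ∀ {n k k′} (G : Adj n) → k ≤ k′ → KConn k′ G → KConn k G
kConn-mono G k≤ conn S S<k = conn S (≤-trans S<k k≤)

-- WHP only bounds lists of graphs with ¬ Event, so ¬ ¬ Event suffices and connectivity need not be decided.
module Typical {d n} (d-large : 50000 ≤ d) (d<n : d < n) (P : Parameters d) (C₀ V : ℕ) (V-large : C₀ + d ≤ V)
  (G : Adj n) (reg : IsRegular d G)
  (noDense : ∀ W → isSmall V (size W) ≡ true → denseBound d (size W) < cross W G)
  (noWeak : ∀ A → isLarge C₀ n (size A) ≡ true → Parameters.c P * size A + d * d < cross A G) where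

  g : IsGraph G
  g = proj₁ (regular⁻ G reg)

  dg : ∀ i → deg G i ≡ d
  dg = proj₂ (regular⁻ G reg)

  v₀ : Fin n
  v₀ = fromℕ< (≤-trans (s≤s z≤n) d<n)

  robust : ∀ k → HighK d k → k ≤ d → ∀ H → H ⊆G G → maxDeg H ≤ d ∸ k → ¬ ¬ KConn k (G −G H)
  robust k high k≤d H H⊆G ΔH = Robust.¬¬kConn G g dg (Parameters.c P) C₀ V V-large noDense noWeak k 5≤k k≤d (Parameters.c-bound P k high) H H⊆G ΔH
    where
    5≤k : 5 ≤ k
    5≤k = ≮⇒≥ λ k<5 → <-irrefl refl (begin-strict
      50000   ≤⟨ d-large ⟩
      d       ≤⟨ proj₁ high ⟩
      2 * k   ≤⟨ *-monoʳ-≤ 2 (≤-pred k<5) ⟩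
      2 * 4   <⟨ ≤ᵇ⇒≤ 9 50000 _ ⟩
      50000   ∎)

  highResilience : ∀ k → HighK d k → k ≤ d → LocalResilience k G (d ∸ k + 1)
  highResilience k high k≤d = (H , H⊆G , maxDeg-H , ¬kConn) ,
    λ H′ H′⊆G ¬conn → ≮⇒≥ λ small → robust k high k≤d H′ H′⊆G (≤-pred (≤-trans small (≤-reflexive (+-comm (d ∸ k) 1)))) ¬conn
    where
    1≤k : 1 ≤ k
    1≤k = ≮⇒≥ λ k<1 → <-irrefl refl (begin-strict
      0       <⟨ s≤s z≤n ⟩
      50000   ≤⟨ d-large ⟩
      d       ≤⟨ proj₁ high ⟩
      2 * k   ≤⟨ *-monoʳ-≤ 2 (≤-pred k<1) ⟩
      0       ∎)
    open Star G g dg v₀ k 1≤k k≤d d<n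

  LowResilience : ℕ → Set
  LowResilience k = 1 ≤ k → ¬ HighK d k → Σ ℕ (λ r → LocalResilience k G r × AboveLower d r × r ≤ d ∸ k + 1 × BelowUpper d r)

  ¬high⇒<d : ∀ k → ¬ HighK d k → k < d
  ¬high⇒<d k ¬high = ≰⇒> λ d≤k → ¬high (HighK-mono d≤k (HighK-top d (≤-trans (m≤m+n 4 49996) d-large)))

  -- If r were at most d/2 - √d, then d - r would lie in the high range and so above k; by `robust`,
  -- G - H could not fail to be (d - r)-connected, hence k-connected.
  aboveLower : ∀ k r → ¬ HighK d k → ∀ H → H ⊆G G → maxDeg H ≡ r → ¬ KConn k (G −G H) → AboveLower d r
  aboveLower k r ¬high H H⊆G ΔH ¬conn with d ≤? 2 * r | (d ∸ 2 * r) ^ 2 <? 4 * d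
  ... | yes p | _     = inj₁ p
  ... | no _  | yes q = inj₂ q
  ... | no p  | no q  = ⊥-elim (robust (d ∸ r) high (m∸n≤m d r) H H⊆G (≤-reflexive (trans ΔH (sym (m∸[m∸n]≡n r≤d))))
      λ conn → ¬conn (kConn-mono (G −G H) (≮⇒≥ λ lt → ¬high (HighK-mono (<⇒≤ lt) high)) conn))
    where
    2r≤d : 2 * r ≤ d
    2r≤d = <⇒≤ (≰⇒> p)
    r≤d : r ≤ d
    r≤d = ≤-trans (m≤m+n r (r + 0)) 2r≤d
    excess : 2 * (d ∸ r) ∸ d ≡ d ∸ 2 * r
    excess = begin-equality
      2 * (d ∸ r) ∸ d      ≡⟨ cong (_∸ d) (*-distribˡ-∸ 2 d r) ⟩
      2 * d ∸ 2 * r ∸ d    ≡⟨ ∸-+-assoc (2 * d) (2 * r) d ⟩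
      2 * d ∸ (2 * r + d)  ≡⟨ cong₂ _∸_ (cong (d +_) (+-identityʳ d)) (+-comm (2 * r) d) ⟩
      d + d ∸ (d + 2 * r)  ≡⟨ [m+n]∸[m+o]≡n∸o d d (2 * r) ⟩
      d ∸ 2 * r            ∎
    high : HighK d (d ∸ r)
    high = ≤-trans (m+n≤o⇒m≤o∸n d (≤-trans (+-monoʳ-≤ d 2r≤d) (≤-reflexive (cong (d +_) (sym (+-identityʳ d)))))) (≤-reflexive (sym (*-distribˡ-∸ 2 d r))) ,
      ≤-trans (≮⇒≥ q) (≤-reflexive (cong (_^ 2) (sym excess)))

  -- Both upper bounds come from minimality of r, compared with the star at `v₀` and with the
  -- Stiebitz cut for q = (d - 1)/2 rounded down, for which d - q ≤ d/2 + 1.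
  ¬¬lowResilience : ∀ k → ¬ ¬ LowResilience k
  ¬¬lowResilience k = ¬¬-→ λ 1≤k → ¬¬-→ λ ¬high none →
    balanced λ { (H₁ , H₁⊆G , ΔH₁ , cut) →
    ¬¬-least Achieves _ (Star.H G g dg v₀ k 1≤k (<⇒≤ (¬high⇒<d k ¬high)) d<n , Star.H⊆G G g dg v₀ k 1≤k (<⇒≤ (¬high⇒<d k ¬high)) d<n ,
        Star.maxDeg-H G g dg v₀ k 1≤k (<⇒≤ (¬high⇒<d k ¬high)) d<n , Star.¬kConn G g dg v₀ k 1≤k (<⇒≤ (¬high⇒<d k ¬high)) d<n)
      λ { (r , (H , H⊆G , ΔH , ¬conn) , minimal) → none (r ,
        ((H , H⊆G , ΔH , ¬conn) , λ H′ H′⊆G ¬conn′ → minimal (maxDeg H′) (H′ , H′⊆G , refl , ¬conn′)) ,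
        aboveLower k r ¬high H H⊆G ΔH ¬conn ,
        minimal _ (Star.H G g dg v₀ k 1≤k (<⇒≤ (¬high⇒<d k ¬high)) d<n , Star.H⊆G G g dg v₀ k 1≤k (<⇒≤ (¬high⇒<d k ¬high)) d<n ,
          Star.maxDeg-H G g dg v₀ k 1≤k (<⇒≤ (¬high⇒<d k ¬high)) d<n , Star.¬kConn G g dg v₀ k 1≤k (<⇒≤ (¬high⇒<d k ¬high)) d<n) ,
        belowUpper d r (≤-trans (m≤m+n 1000 49000) d-large)
          (≤-trans (*-monoʳ-≤ 2 (≤-trans (minimal _ (H₁ , H₁⊆G , refl , cut k 1≤k)) ΔH₁)) 2[d∸q]≤)) } }
    where
    Achieves : ℕ → Set
    Achieves r = Σ (Adj n) λ H → H ⊆G G × maxDeg H ≡ r × ¬ KConn k (G −G H)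
    d′ q : ℕ
    d′ = d ∸ 1
    q = d′ / 2
    d≡ : d ≡ suc (d′ % 2 + q * 2)
    d≡ = trans (sym (m+[n∸m]≡n (≤-trans (s≤s z≤n) d-large))) (cong suc (m≡m%n+[m/n]*n d′ 2))
    double : ∀ q → q * 2 ≡ q + q
    double = solve-∀
    balanced : ¬ ¬ Σ (Adj n) λ H → H ⊆G G × maxDeg H ≤ d ∸ q × (∀ k → 1 ≤ k → ¬ KConn k (G −G H))
    balanced = Stiebitz.balanced-cut G g dg q (≤-trans (s≤s (≤-trans (≤-reflexive (sym (double q))) (m≤n+m (q * 2) (d′ % 2)))) (≤-reflexive (sym d≡))) v₀
    2[d∸q]≤ : 2 * (d ∸ q) ≤ d + 2
    2[d∸q]≤ = begin
      2 * (d ∸ q)          ≡⟨ *-distribˡ-∸ 2 d q ⟩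
      2 * d ∸ 2 * q        ≤⟨ m≤n+o⇒m∸n≤o (2 * d) (2 * q) (begin
        2 * d                      ≡⟨ cong (d +_) (+-identityʳ d) ⟩
        d + d                      ≤⟨ +-monoʳ-≤ d (≤-reflexive d≡) ⟩
        d + suc (d′ % 2 + q * 2)   ≤⟨ +-monoʳ-≤ d (+-monoˡ-≤ (q * 2) (m%n<n d′ 2)) ⟩
        d + (2 + q * 2)            ≡⟨ r₁ d q ⟩
        2 * q + (d + 2)            ∎) ⟩
      d + 2                ∎
      where
      r₁ : ∀ d q → d + (2 + q * 2) ≡ 2 * q + (d + 2)
      r₁ = solve-∀

  -- Outside the high range k is less than d, so the second clause concerns finitely many k and
  -- their double negations can be collected.
  ¬¬event : ¬ ¬ Event d G
  ¬¬event none = ¬¬-∀Fin {d} (λ i → ¬¬lowResilience (toℕ i)) λ low → none (highResilience ,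
    λ k 1≤k ¬high → subst LowResilience (Fin.toℕ-fromℕ< (¬high⇒<d k ¬high)) (low (fromℕ< (¬high⇒<d k ¬high))) 1≤k ¬high)

-- First moment and conclusion

module _ (d : ℕ) (d-large : 50000 ≤ d) (m : ℕ) (1≤m : 1 ≤ m) where

  private
    P : Parameters d
    P = parameters d d-large
    open Parameters P
    1≤d : 1 ≤ d
    1≤d = ≤-trans (s≤s z≤n) d-large
    4≤d : 4 ≤ d
    4≤d = ≤-trans (m≤m+n 4 49996) d-large
    C₀ V : ℕ
    -- Each of the two events receives half of the allowance 1/m.
    C₀ = weakThreshold d c k (2 * m) 1≤d k-large c-small
    V = C₀ + d
    1≤V : 1 ≤ V
    1≤V = ≤-trans 1≤d (m≤n+m d C₀)

    dense weak : ∀ {n} → Vec Bool n → Adj n → Bool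
    dense A G = isSmall V (size A) ∧ (cross A G ≤ᵇ denseBound d (size A))
    weak {n} A G = isLarge C₀ n (size A) ∧ (cross A G ≤ᵇ c * size A + d * d)

    -- A first-moment count: it is positive on every violator, so its sum over the regular graphs
    -- bounds the number of violators.
    badness : ∀ {n} → Adj n → ℕ
    badness {n} G = S (allSubsets n) λ A → 𝟙 (dense A G) + 𝟙 (weak A G)

    total-badness : ∀ n → S (allAdj n) (λ G → 𝟙 (regularB d G) * badness G) ≡ S (allSubsets n) (#dense d V) + S (allSubsets n) (#weak d c C₀)
    total-badness n = begin-equality
      S (allAdj n) (λ G → 𝟙 (regularB d G) * badness G)
        ≡⟨ S-cong (allAdj n) (λ G → sym (S-scaleˡ (allSubsets n) (𝟙 (regularB d G)) _)) ⟩
      S (allAdj n) (λ G → S (allSubsets n) (λ A → 𝟙 (regularB d G) * (𝟙 (dense A G) + 𝟙 (weak A G))))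
        ≡⟨ S-swap (allAdj n) (allSubsets n) _ ⟩
      S (allSubsets n) (λ A → S (allAdj n) (λ G → 𝟙 (regularB d G) * (𝟙 (dense A G) + 𝟙 (weak A G))))
        ≡⟨ S-cong (allSubsets n) (λ A → trans (S-cong (allAdj n) (λ G → split (regularB d G) (isSmall V (size A)) (isLarge C₀ n (size A)) _ _))
             (trans (S-+ (allAdj n) _ _) (cong₂ _+_
               (S-scaleˡ (allAdj n) (𝟙 (isSmall V (size A))) (𝟙 ∘ sparseCut d A (denseBound d (size A))))
               (S-scaleˡ (allAdj n) (𝟙 (isLarge C₀ n (size A))) (𝟙 ∘ sparseCut d A (c * size A + d * d)))))) ⟩
      S (allSubsets n) (λ A → #dense d V A + #weak d c C₀ A) ≡⟨ S-+ (allSubsets n) _ _ ⟩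
      S (allSubsets n) (#dense d V) + S (allSubsets n) (#weak d c C₀) ∎
      where
      split : ∀ r s l x y → 𝟙 r * (𝟙 (s ∧ x) + 𝟙 (l ∧ y)) ≡ 𝟙 s * 𝟙 (r ∧ x) + 𝟙 l * 𝟙 (r ∧ y)
      split r s l x y rewrite 𝟙-∧ s x | 𝟙-∧ l y | 𝟙-∧ r x | 𝟙-∧ r y = expand (𝟙 r) (𝟙 s) (𝟙 l) (𝟙 x) (𝟙 y)
        where
        expand : ∀ r s l x y → r * (s * x + l * y) ≡ s * (r * x) + l * (r * y)
        expand = solve-∀

    bad : ∀ {n} → d < n → (G : Adj n) → IsRegular d G → ¬ Event d G → 1 ≤ badness G
    bad {n} d<n G reg ¬event = ≮⇒≥ λ none → Typical.¬¬event d-large d<n P C₀ V ≤-refl G reg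
      (λ W small → ≰⇒> λ le → absurd W none (≤-trans (≤-reflexive (cong 𝟙 (sym (∧-join small (≤ᵇ-true le))))) (m≤m+n (𝟙 (dense W G)) _)))
      (λ A large → ≰⇒> λ le → absurd A none (≤-trans (≤-reflexive (cong 𝟙 (sym (∧-join large (≤ᵇ-true le))))) (m≤n+m (𝟙 (weak A G)) _)))
      ¬event
      where
      absurd : ∀ A → badness G < 1 → 1 ≤ 𝟙 (dense A G) + 𝟙 (weak A G) → ⊥
      absurd A none one = <-irrefl refl (≤-trans (s≤s (≤-trans one (S-∈ (λ A → 𝟙 (dense A G) + 𝟙 (weak A G)) (∈-allSubsets A)))) none)

  -- The summand d + 1 ensures d < n, which the star needs to have a vertex beyond its cutset.
  sizeThreshold : ℕ
  sizeThreshold = denseThreshold d V (2 * m) 4≤d 1≤V + suc d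

  few-violators : ∀ n → sizeThreshold ≤ n → (B : List (Adj n)) → Unique B →
    All (λ G → IsRegular d G × ¬ Event d G) B → m * length B ≤ numRegular d n
  few-violators n n-large B unique violators = *-cancelˡ-≤ 2 (begin
    2 * (m * length B)                      ≡⟨ *-assoc 2 m (length B) ⟨
    2 * m * length B                        ≤⟨ *-monoʳ-≤ (2 * m) (unique-length≤S _≟ᴬ_ (allAdj n) B (λ G → 𝟙 (regularB d G) * badness G) unique (All.map weighty violators)) ⟩
    2 * m * S (allAdj n) (λ G → 𝟙 (regularB d G) * badness G) ≡⟨ cong (2 * m *_) (total-badness n) ⟩
    2 * m * (D + W)                         ≡⟨ trans (*-comm (2 * m) (D + W)) (*-distribʳ-+ (2 * m) D W) ⟩
    D * (2 * m) + W * (2 * m)               ≤⟨ +-mono-≤ (#dense-sum d V (2 * m) 4≤d 1≤V n (≤-trans (m≤m+n _ (suc d)) n-large)) (#weak-sum d c k (2 * m) 1≤d k-large c-small n) ⟩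
    numRegular d n + numRegular d n         ≡⟨ cong (numRegular d n +_) (+-identityʳ (numRegular d n)) ⟨
    2 * numRegular d n                      ∎)
    where
    D W : ℕ
    D = S (allSubsets n) (#dense d V)
    W = S (allSubsets n) (#weak d c C₀)
    weighty : ∀ {G} → IsRegular d G × ¬ Event d G → G ∈ allAdj n × 1 ≤ 𝟙 (regularB d G) * badness G
    weighty {G} (reg , ¬event) = ∈-allAdj G , ≤-trans (bad (≤-trans (m≤n+m (suc d) (denseThreshold d V (2 * m) 4≤d 1≤V)) n-large) G reg ¬event)
      (≤-reflexive (trans (sym (*-identityˡ (badness G))) (cong (λ b → 𝟙 b * badness G) (sym reg))))

theorem2 : Σ ℕ (λ d₀ → 0 < d₀ × (∀ d → d₀ ≤ d → WHP d (Event d)))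
theorem2 = 50000 , s≤s z≤n , λ d d-large m 1≤m → sizeThreshold d d-large m 1≤m , λ n n-large _ → few-violators d d-large m 1≤m n n-large
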